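{- There is a deterministic fully dynamic algorithm that, on a graph whose maximum degree is at most $\Delta$ at all times, maintains a proper vertex coloring using $(1+o(1))\Delta$ colors with amortized update time $O\!\left(\log^{4+o(1)}\Delta/(\log\log\Delta)^2\right)$.
   Context: Dynamic setting: fixed vertex set, the graph starts with no edges and undergoes a sequence of edge insertions and deletions; the bound $\Delta$ on the maximum degree is known to the algorithm. After each update the coloring must be proper (adjacent vertices receive different colors). The $o(1)$ is with respect to $\Delta\to\infty$. Amortized update time $\alpha$ means the total time for the first $t$ updates is at most $\alpha t$ for every $t$. -}

module Defs where

open import Data.Bool.Base using (Bool; if_then_else_; _∧_; _∨_; _xor_)
open import Data.Empty using (⊥)
open import Data.Fin.Base using (Fin; toℕ)
import Data.Fin.Properties as Fin
open import Data.Integer.Base using (+_; -[1+_])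
open import Data.List.Base using (List; []; _∷_; length; filter; allFin)
open import Data.Maybe.Base using (Maybe; just; nothing)
open import Data.Nat.Base
open import Data.Nat.DivMod using (_/_; _%_)
open import Data.Nat.Logarithm using (⌊log₂_⌋; ⌈log₂_⌉)
open import Data.Nat.Properties using (m^n≢0)
open import Data.Product.Base using (_×_; _,_; ∃-syntax)
import Data.Rational.Base as ℚ
open import Data.Rational.Base using (ℚ; 0ℚ; 1ℚ)
open import Data.Sum.Base using (_⊎_; inj₁; inj₂)
import Data.Sum.Base as Sum
open import Data.Unit.Base using (⊤)
open import Relation.Binary.Definitions using (Decidable; Symmetric)
open import Relation.Binary.PropositionalEquality.Core
  using (_≡_; _≢_; sym; trans)
open import Relation.Nullary.Decidable using (_×-dec_; _⊎-dec_; ¬?; no)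
open import Relation.Nullary.Negation using (¬_)

------------------------------------------------------------------------
-- Dynamic graphs

record Graph (n : ℕ) : Set₁ where
  field
    Adj    : Fin n → Fin n → Set
    adj?   : Decidable Adj
    symm   : Symmetric Adj
    irrefl : ∀ {x} → ¬ Adj x x

  degree : Fin n → ℕ
  degree x = length (filter (adj? x) (allFin n))

open Graph public

MaxDegree≤ : ∀ {n} → ℕ → Graph n → Set
MaxDegree≤ Δ G = ∀ x → degree G x ≤ Δ

edgeless : ∀ n → Graph n
edgeless n = record
  { Adj    = λ _ _ → ⊥
  ; adj?   = λ _ _ → no (λ ())
  ; symm   = λ ()
  ; irrefl = λ ()
  }

-- {x , y} = {u , v} as unordered pairs.
SamePair : ∀ {n} → Fin n → Fin n → Fin n → Fin n → Set
SamePair u v x y = (x ≡ u × y ≡ v) ⊎ (x ≡ v × y ≡ u)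

samePair? : ∀ {n} (u v : Fin n) → Decidable (SamePair u v)
samePair? u v x y =
  ((x Fin.≟ u) ×-dec (y Fin.≟ v)) ⊎-dec ((x Fin.≟ v) ×-dec (y Fin.≟ u))

samePair-sym : ∀ {n} (u v : Fin n) → Symmetric (SamePair u v)
samePair-sym u v (inj₁ (p , q)) = inj₂ (q , p)
samePair-sym u v (inj₂ (p , q)) = inj₁ (q , p)

samePair-irrefl : ∀ {n} {u v x : Fin n} → u ≢ v → ¬ SamePair u v x x
samePair-irrefl u≢v (inj₁ (p , q)) = u≢v (trans (sym p) q)
samePair-irrefl u≢v (inj₂ (p , q)) = u≢v (trans (sym q) p)

data Update (n : ℕ) : Set where
  insert : (u v : Fin n) → u ≢ v → Update n
  delete : (u v : Fin n) → Update n

update : ∀ {n} → Update n → Graph n → Graph n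
update (insert u v u≢v) G = record
  { Adj    = λ x y → Adj G x y ⊎ SamePair u v x y
  ; adj?   = λ x y → adj? G x y ⊎-dec samePair? u v x y
  ; symm   = Sum.map (symm G) (samePair-sym u v)
  ; irrefl = Sum.[ irrefl G , samePair-irrefl u≢v ]
  }
update (delete u v) G = record
  { Adj    = λ x y → Adj G x y × ¬ SamePair u v x y
  ; adj?   = λ x y → adj? G x y ×-dec ¬? (samePair? u v x y)
  ; symm   = λ (a , ¬p) → symm G a , λ p → ¬p (samePair-sym u v p)
  ; irrefl = λ (a , _) → irrefl G a
  }

updates : ∀ {n} → List (Update n) → Graph n → Graph n
updates []       G = G
updates (x ∷ xs) G = updates xs (update x G)

Legal : ∀ {n} → Graph n → Update n → Set
Legal G (insert u v _) = ¬ Adj G u v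
Legal G (delete u v)   = Adj G u v

Admissible : ∀ {n} → ℕ → Graph n → List (Update n) → Set
Admissible Δ G []       = ⊤
Admissible Δ G (x ∷ xs) =
  Legal G x × MaxDegree≤ Δ (update x G) × Admissible Δ (update x G) xs

ProperColoring : ∀ {n} → Graph n → ℕ → (Fin n → ℕ) → Set
ProperColoring G k color =
  (∀ x → color x < k) × (∀ x y → Adj G x y → color x ≢ color y)

------------------------------------------------------------------------
-- Word RAM with w-bit words.  Words are naturals below 2 ^ w.  All
-- instructions, including indirect memory access, have unit cost.

truncate : ℕ → ℕ → ℕ
truncate w a = _%_ a (2 ^ w) {{m^n≢0 2 w}}

data Op : Set where
  add sub mul div rem and or xor shl shr lt eq : Op

bit : Bool → ℕ
bit b = if b then 1 else 0

bitwise : (Bool → Bool → Bool) → ℕ → ℕ → ℕ → ℕ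
bitwise f zero    a b = 0
bitwise f (suc w) a b =
  bit (f (a % 2 ≡ᵇ 1) (b % 2 ≡ᵇ 1)) + 2 * bitwise f w (a / 2) (b / 2)

-- Arithmetic is modulo 2 ^ w; division and remainder by 0 give 0.
evalOp : ℕ → Op → ℕ → ℕ → ℕ
evalOp w add a b       = truncate w (a + b)
evalOp w sub a b       = truncate w (a + (2 ^ w ∸ b))
evalOp w mul a b       = truncate w (a * b)
evalOp w div a zero    = 0
evalOp w div a (suc b) = a / suc b
evalOp w rem a zero    = 0
evalOp w rem a (suc b) = a % suc b
evalOp w and a b       = bitwise _∧_ w a b
evalOp w or  a b       = bitwise _∨_ w a b
evalOp w xor a b       = bitwise _xor_ w a b
evalOp w shl a b       = truncate w (a * 2 ^ b)
evalOp w shr a b       = _/_ a (2 ^ b) {{m^n≢0 2 b}}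
evalOp w lt  a b       = truncate w (bit (a <ᵇ b))
evalOp w eq  a b       = truncate w (bit (a ≡ᵇ b))

Reg : Set
Reg = ℕ

data Instr : Set where
  const : (r : Reg) (k : ℕ) → Instr           -- r ← k
  copy  : (r s : Reg) → Instr                 -- r ← s
  calc  : Op → (r s t : Reg) → Instr          -- r ← s op t
  load  : (r s : Reg) → Instr                 -- r ← mem[s]
  store : (r s : Reg) → Instr                 -- mem[r] ← s
  jump  : (ℓ : ℕ) → Instr                     -- go to ℓ
  jumpz : (r : Reg) (ℓ : ℕ) → Instr           -- if r = 0 go to ℓ

Program : Set
Program = List Instr

record State : Set where
  constructor ⟨_,_,_⟩
  field
    pc  : ℕ
    reg : Reg → ℕ
    mem : ℕ → ℕ

open State public

_[_↦_] : (ℕ → ℕ) → ℕ → ℕ → (ℕ → ℕ)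
(f [ i ↦ a ]) j = if i ≡ᵇ j then a else f j

fetch : Program → ℕ → Maybe Instr
fetch []      _       = nothing
fetch (i ∷ P) zero    = just i
fetch (i ∷ P) (suc ℓ) = fetch P ℓ

exec : ℕ → Instr → State → State
exec w (const r k)    ⟨ p , R , M ⟩ = ⟨ suc p , R [ r ↦ truncate w k ] , M ⟩
exec w (copy r s)     ⟨ p , R , M ⟩ = ⟨ suc p , R [ r ↦ R s ] , M ⟩
exec w (calc o r s t) ⟨ p , R , M ⟩ =
  ⟨ suc p , R [ r ↦ evalOp w o (R s) (R t) ] , M ⟩
exec w (load r s)     ⟨ p , R , M ⟩ = ⟨ suc p , R [ r ↦ M (R s) ] , M ⟩
exec w (store r s)    ⟨ p , R , M ⟩ = ⟨ suc p , R , M [ R r ↦ R s ] ⟩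
exec w (jump ℓ)       ⟨ p , R , M ⟩ = ⟨ ℓ , R , M ⟩
exec w (jumpz r ℓ)    ⟨ p , R , M ⟩ =
  ⟨ (if R r ≡ᵇ 0 then ℓ else suc p) , R , M ⟩

-- Halts P w s T s′: from s, the program halts in s′ after exactly T
-- instructions.  A program halts when pc leaves its range.
data Halts (P : Program) (w : ℕ) : State → ℕ → State → Set where
  done : ∀ {s} → fetch P (pc s) ≡ nothing → Halts P w s 0 s
  step : ∀ {s i T s′} → fetch P (pc s) ≡ just i →
         Halts P w (exec w i s) T s′ → Halts P w s (suc T) s′

------------------------------------------------------------------------
-- Dynamic algorithms

-- The word size is Θ(log (n + Δ)): a word can hold a vertex and the number
-- Δ, and memory has polynomial size.
wordSize : (c n Δ : ℕ) → ℕ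
wordSize c n Δ = c * ⌈log₂ (2 + n + Δ) ⌉

-- Registers 0 and 1 initially hold n and Δ; everything else is zero.
initial : (n Δ : ℕ) → State
initial n Δ = ⟨ 0 , ((λ _ → 0) [ 0 ↦ n ]) [ 1 ↦ Δ ] , (λ _ → 0) ⟩

-- An update is announced in registers 2, 3, 4 (its kind and the two
-- endpoints) and the program is restarted; all other registers and the
-- memory persist from one update to the next.
announce : ∀ {n} → Update n → State → State
announce (insert u v _) ⟨ _ , R , M ⟩ =
  ⟨ 0 , ((R [ 2 ↦ 0 ]) [ 3 ↦ toℕ u ]) [ 4 ↦ toℕ v ] , M ⟩
announce (delete u v)   ⟨ _ , R , M ⟩ =
  ⟨ 0 , ((R [ 2 ↦ 1 ]) [ 3 ↦ toℕ u ]) [ 4 ↦ toℕ v ] , M ⟩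

-- Processing a whole update sequence, with the total time.
data Run {n} (P : Program) (w : ℕ) : State → List (Update n) → ℕ → State → Set where
  []  : ∀ {s} → Run P w s [] 0 s
  _∷_ : ∀ {s x xs T s′ U s″} → Halts P w (announce x s) T s′ →
        Run P w s′ xs U s″ → Run P w s (x ∷ xs) (T + U) s″

-- The maintained coloring is stored explicitly in the first n memory cells.
coloring : ∀ {n} → State → Fin n → ℕ
coloring s x = mem s (toℕ x)

-- Prefixes of admissible sequences are admissible and the machine is
-- deterministic, so quantifying over all finite sequences says that the
-- coloring is proper after each update and that the time bound holds for the
-- first t updates, for every t.
MaintainsColoring : (P : Program) (c : ℕ) (colors time : ℕ → ℕ) → Set
MaintainsColoring P c colors time =
  ∀ (n Δ : ℕ) (xs : List (Update n)) → Admissible Δ (edgeless n) xs →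
  ∃[ T ] ∃[ s ]
    Run P (wordSize c n Δ) (initial n Δ) xs T s ×
    ProperColoring (updates xs (edgeless n)) (colors Δ) (coloring s) ×
    T ≤ time Δ * length xs

------------------------------------------------------------------------
-- Asymptotics as Δ → ∞

fromℕ : ℕ → ℚ
fromℕ m = (+ m) ℚ./ 1

IsLittleO1 : (ℕ → ℚ) → Set
IsLittleO1 f =
  ∀ (ε : ℚ) → 0ℚ ℚ.< ε → ∃[ D ] ∀ Δ → D ≤ Δ → ℚ.∣ f Δ ∣ ℚ.≤ ε

-- f(Δ) ≤ (1 + o(1)) Δ.  The value at Δ = 0 is left free, since even an
-- edgeless graph needs one color.
AtMost[1+o1]Δ : (ℕ → ℕ) → Set
AtMost[1+o1]Δ f =
  ∃[ δ ] IsLittleO1 δ ×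
    (∀ Δ → 1 ≤ Δ → fromℕ (f Δ) ℚ.≤ (1ℚ ℚ.+ δ Δ) ℚ.* fromℕ Δ)

-- a ≤ C · x ^ r for a rational exponent r = p / q, with both sides raised to
-- the power q (and x ^ p moved to the left when p < 0).
_≤_·_^ℚ_ : ℕ → ℕ → ℕ → ℚ → Set
a ≤ C · x ^ℚ r with ℚ.numerator r
... | + p      = a ^ ℚ.denominatorℕ r ≤ C ^ ℚ.denominatorℕ r * x ^ p
... | -[1+ p ] = a ^ ℚ.denominatorℕ r * x ^ suc p ≤ C ^ ℚ.denominatorℕ r

-- f(Δ) = O(log^{k + o(1)} Δ / (log log Δ)²).  Rounding the logarithms down
-- changes each by at most a constant factor, absorbed in C (for Δ ≥ 4, where
-- ⌊log₂ ⌊log₂ Δ⌋⌋ ≥ 1).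
O[log^_+o1/loglog²] : ℕ → (ℕ → ℕ) → Set
O[log^ k +o1/loglog²] f =
  ∃[ η ] IsLittleO1 η × ∃[ C ] ∃[ D ] ∀ Δ → D ≤ Δ →
    (f Δ * ⌊log₂ ⌊log₂ Δ ⌋ ⌋ ^ 2) ≤ C · ⌊log₂ Δ ⌋ ^ℚ (fromℕ k ℚ.+ η Δ)

-- Colors are mixed radix numbers with H digits; the level of an edge is the
-- largest j such that its endpoints agree in the j lowest digits, so an edge is
-- monochromatic when its level is H.  With s about log Δ, every digit but the
-- last has s + 2 values, while the bound t on the number of neighbors that agree
-- with a vertex shrinks only by a factor s from one level to the next.  It starts
-- with Δ; as soon as t ≤ s (s + 1), a last digit with t + 1 values can avoid all
-- remaining neighbors.
--
-- Only a monochromatic inserted edge u v causes a change, and only u changes its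
-- color.  Take a level i such that at most t i neighbors of u, say x, agree with
-- it up to level i, but more than t (i + 1) up to level i + 1, and choose the
-- digits after i one by one, each time the one least frequent among the neighbors
-- that still agree.  The numbers of agreeing neighbors then shrink by s + 2 per
-- level, so they add up to at most x / (s + 1), whereas more than x / s was
-- attained at level i + 1 alone before.  Hence the total level of all edges drops
-- by x / (s (s + 1)), which pays for the O(x H) steps of the change.
--
-- There are (1 + 2 / s) ^ L (1 + 1 / s) Δ colors for L = H - 1 at most about
-- log Δ / log log Δ, which is (1 + o(1)) Δ, and an insertion raises the total level
-- by at most H, for an amortized time of O(H² s²).

module Submission where

open import Defs
open import Data.Bool.Base using (Bool; true; false; if_then_else_; _∧_; T)
open import Data.Empty using (⊥)
open import Data.Fin.Base using (Fin; toℕ; fromℕ<; zero; suc)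
open import Data.Fin.Patterns
import Data.Fin.Properties as Fin
open import Data.Integer.Base using (-[1+_]) renaming (+_ to ⁺_)
import Data.Integer.Base as ℤ
import Data.Integer.Properties as ℤ
open import Data.List.Base as List using (List; []; _∷_; _++_; length)
open import Data.List.Membership.Propositional using (_∈_)
open import Data.List.Membership.Propositional.Properties using (∈-filter⁺; ∈-allFin)
open import Data.List.Properties using (length-++; ++-assoc)
open import Data.List.Relation.Unary.Any using (index)
open import Data.List.Relation.Unary.Any.Properties using (lookup-index)
open import Data.Maybe.Base using (just; nothing)
open import Data.Nat.Base
open import Data.Nat.Divisibility using (_∣_; ∣-refl; ∣n⇒∣m*n)
open import Data.Nat.DivMod
open import Data.Nat.Induction using (<-rec)
open import Data.Nat.Logarithm
open import Data.Nat.Properties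
open import Data.Nat.Tactic.RingSolver using (solve-∀)
open import Data.Product.Base using (_×_; _,_; proj₁; proj₂; ∃-syntax)
import Data.Rational.Base as ℚ
open import Data.Rational.Base using (mkℚ; 0ℚ; 1ℚ; toℚᵘ; fromℚᵘ)
import Data.Rational.Properties as ℚ
import Data.Rational.Unnormalised.Base as ℚᵘ
open import Data.Rational.Unnormalised.Base using (ℚᵘ; mkℚᵘ)
import Data.Rational.Unnormalised.Properties as ℚᵘ
open import Data.Sum.Base using (_⊎_; inj₁; inj₂)
open import Data.Unit.Base using (⊤; tt)
open import Data.Vec.Base using (Vec; []; _∷_; lookup; _[_]≔_; head)
open import Data.Vec.Properties using (lookup∘update; lookup∘update′)
open import Function.Base using (_∘_; case_of_)
open import Relation.Binary.PropositionalEquality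
open import Relation.Nullary.Decidable using (Dec; yes; no; _×-dec_; _⊎-dec_)
open import Relation.Nullary.Negation using (¬_; contradiction)

-- A structured language

-- A suitable level always exists: `v` agrees with `u` at level `H`, where the threshold is 0, while
-- at level 0 the threshold `Δ` bounds every degree, so a walk down the levels must stop in between.
-- The digits before the stop are kept, hence only edges gathered on the walk change level. Their
-- old levels add up to more than `x * i + t (i + 1)`, the new ones to at most `x * i + S` with
-- `(s + 1) S ≤ x`; and `A = s (s + 1)` is the denominator of `1 / s - 1 / (s + 1)`. A change also
-- has a cost independent of `x`: clearing and scanning the digit counts takes up to `A + 1`
-- iterations each per level. This `O(H A)` is charged to the insertion directly. One fixed program
-- must serve all `n` and `Δ`. It is written in a structured language whose semantics counts only
-- loop iterations; a verified compiler spends boundedly many instructions per iteration, and all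
-- machine constants collect in `rate`. The data are arrays addressed in base `2 + n + Δ`, and zero
-- memory already represents the edgeless graph, so nothing of size `n²` has to be initialized.

data BinOp : Set where
  plus times minus quot modu same less : BinOp

infixl 6 _divℕ_ _modℕ_

-- Division by 0 gives 0 as on the machine, so that `op-sound` has no side condition for `quot` and
-- `modu`.
_divℕ_ _modℕ_ : ℕ → ℕ → ℕ
a divℕ zero  = 0
a divℕ suc b = a / suc b
a modℕ zero  = 0
a modℕ suc b = a % suc b

apply : BinOp → ℕ → ℕ → ℕ
apply plus  a b = a + b
apply times a b = a * b
apply minus a b = a ∸ b
apply quot  a b = a divℕ b
apply modu  a b = a modℕ b
apply same  a b = bit (a ≡ᵇ b)
apply less  a b = bit (a <ᵇ b)

data Atom (d : ℕ) : Set where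
  var : Fin d → Atom d
  lit : ℕ → Atom d

data Exp (d : ℕ) : Set where
  atom : Atom d → Exp d
  bin  : BinOp → Exp d → Exp d → Exp d
  get  : (t : ℕ) (a b c : Atom d) → Exp d

infix  5 _:=_
infixr 4 _⨾_

-- A `call` contains the body itself, so there is no recursion and compilation inlines it. All
-- locals of the body are passed as arguments, and its local 0 is the result.
data Cmd : ℕ → Set where
  _:=_  : ∀ {d} → Fin d → Exp d → Cmd d
  put   : ∀ {d} (t : ℕ) (a b c : Atom d) → Exp d → Cmd d
  _⨾_   : ∀ {d} → Cmd d → Cmd d → Cmd d
  cond  : ∀ {d} → Exp d → Cmd d → Cmd d → Cmd d
  while : ∀ {d} → Exp d → Cmd d → Cmd d
  call  : ∀ {d m} → Fin d → Cmd (suc m) → Vec (Exp d) (suc m) → Cmd d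
  skip  : ∀ {d} → Cmd d

-- Memory is seen as a family of three-dimensional arrays.
Mem : Set
Mem = ℕ → ℕ → ℕ → ℕ → ℕ

Env : ℕ → Set
Env = Vec ℕ

-- The test on the tag comes first, so that arrays with other tags are
-- unchanged by computation.
write : Mem → ℕ → ℕ → ℕ → ℕ → ℕ → Mem
write V t a b c x t′ =
  if t ≡ᵇ t′
  then (λ a′ b′ c′ →
          if (a ≡ᵇ a′) ∧ (b ≡ᵇ b′) ∧ (c ≡ᵇ c′) then x else V t′ a′ b′ c′)
  else V t′

value : ∀ {d} → Atom d → Env d → ℕ
value (var x) e = lookup e x
value (lit k) e = k

eval : ∀ {d} → Exp d → Env d → Mem → ℕ
eval (atom a)      e V = value a e
eval (bin o f g)   e V = apply o (eval f e V) (eval g e V)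
eval (get t a b c) e V = V t (value a e) (value b e) (value c e)

evals : ∀ {d m} → Vec (Exp d) m → Env d → Mem → Env m
evals []       e V = []
evals (f ∷ fs) e V = eval f e V ∷ evals fs e V

-- Semantics with iteration counts, and weakest preconditions

module Semantics (W B : ℕ) where

  -- Conditions under which arithmetic modulo `W` coincides with arithmetic on `ℕ`; a negative
  -- difference would wrap around on the machine, whereas `∸` cuts it to 0.
  SafeOp : BinOp → ℕ → ℕ → Set
  SafeOp plus  a b = a + b < W
  SafeOp times a b = a * b < W
  SafeOp minus a b = b ≤ a × a < W
  SafeOp _     a b = ⊤

  -- Boolean tests on literals compute, so the safety of a concrete command leaves no obligation for
  -- them.
  SafeLit : ∀ {d} → ℕ → Atom d → Set
  SafeLit m (var x) = ⊤
  SafeLit m (lit k) = T (k <ᵇ m)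

  InRange : ∀ {d} → Atom d → Env d → Set
  InRange (var x) e = lookup e x < B
  InRange (lit k) e = T (k <ᵇ 2)

  Safe : ∀ {d} → Exp d → Env d → Mem → Set
  Safe (atom a)      e V = SafeLit 8 a
  Safe (bin o f g)   e V =
    Safe f e V × Safe g e V × SafeOp o (eval f e V) (eval g e V)
  Safe (get t a b c) e V =
    T (t <ᵇ 16) × InRange a e × InRange b e × InRange c e

  Safes : ∀ {d m} → Vec (Exp d) m → Env d → Mem → Set
  Safes []       e V = ⊤
  Safes (f ∷ fs) e V = Safe f e V × Safes fs e V

  -- The last index counts loop iterations.
  data Exec : ∀ {d} → Cmd d → Env d → Mem → Env d → Mem → ℕ → Set where
    assign : ∀ {d x f} {e : Env d} {V} → Safe f e V →
             Exec (x := f) e V (e [ x ]≔ eval f e V) V 0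
    putting : ∀ {d t a b c f} {e : Env d} {V} →
              Safe (get t a b c) e V → Safe f e V →
              Exec (put t a b c f) e V e (write V t (value a e) (value b e) (value c e) (eval f e V)) 0
    seq : ∀ {d c c′} {e e′ e″ : Env d} {V V′ V″ k k′} →
          Exec c e V e′ V′ k → Exec c′ e′ V′ e″ V″ k′ →
          Exec (c ⨾ c′) e V e″ V″ (k + k′)
    cond≢0 : ∀ {d f c c′} {e e′ : Env d} {V V′ k} →
             Safe f e V → eval f e V ≢ 0 → Exec c e V e′ V′ k →
             Exec (cond f c c′) e V e′ V′ k
    cond≡0 : ∀ {d f c c′} {e e′ : Env d} {V V′ k} →
             Safe f e V → eval f e V ≡ 0 → Exec c′ e V e′ V′ k →
             Exec (cond f c c′) e V e′ V′ k
    while≡0 : ∀ {d f c} {e : Env d} {V} → Safe f e V → eval f e V ≡ 0 →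
              Exec (while f c) e V e V 0
    while≢0 : ∀ {d f c} {e e′ e″ : Env d} {V V′ V″ k k′} →
              Safe f e V → eval f e V ≢ 0 → Exec c e V e′ V′ k →
              Exec (while f c) e′ V′ e″ V″ k′ →
              Exec (while f c) e V e″ V″ (suc (k + k′))
    calling : ∀ {d m x c fs} {e : Env d} {e′ : Env (suc m)} {V V′ k} →
              Safes fs e V → Exec c (evals fs e V) V e′ V′ k →
              Exec (call x c fs) e V (e [ x ]≔ head e′) V′ k
    skipping : ∀ {d} {e : Env d} {V} → Exec skip e V e V 0

  Post : ℕ → Set₁
  Post d = Env d → Mem → ℕ → Set

  -- A terminating run is part of the claim, so specifications express total correctness.
  WP : ∀ {d} → Cmd d → Env d → Mem → Post d → Set
  WP c e V Q = ∃[ e′ ] ∃[ V′ ] ∃[ k ] Exec c e V e′ V′ k × Q e′ V′ k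

  -- Weakest preconditions that reduce on straight-line code.
  wp : ∀ {d} → Cmd d → Env d → Mem → Post d → Set
  wp (x := f) e V Q = Safe f e V × Q (e [ x ]≔ eval f e V) V 0
  wp (put t a b c f) e V Q = (Safe (get t a b c) e V × Safe f e V) ×
    Q e (write V t (value a e) (value b e) (value c e) (eval f e V)) 0
  wp (c ⨾ c′) e V Q =
    wp c e V (λ e′ V′ k → wp c′ e′ V′ (λ e″ V″ k′ → Q e″ V″ (k + k′)))
  wp (cond f c c′) e V Q =
    Safe f e V × (eval f e V ≢ 0 → wp c e V Q) × (eval f e V ≡ 0 → wp c′ e V Q)
  wp (while f c) e V Q = WP (while f c) e V Q
  wp (call x c fs) e V Q =
    Safes fs e V × WP c (evals fs e V) V (λ e′ V′ k → Q (e [ x ]≔ head e′) V′ k)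
  wp skip e V Q = Q e V 0

  wp⇒WP : ∀ {d} (c : Cmd d) {e V Q} → wp c e V Q → WP c e V Q
  wp⇒WP (x := f) (s , q) = _ , _ , _ , assign s , q
  wp⇒WP (put t a b c f) ((s , s′) , q) = _ , _ , _ , putting s s′ , q
  wp⇒WP (c ⨾ c′) p with wp⇒WP c p
  ... | _ , _ , _ , r , p′ with wp⇒WP c′ p′
  ... | _ , _ , _ , r′ , q = _ , _ , _ , seq r r′ , q
  wp⇒WP (cond f c c′) {e} {V} (s , p , p′) with eval f e V ≟ 0
  ... | no nz with wp⇒WP c (p nz)
  ...   | _ , _ , _ , r , q = _ , _ , _ , cond≢0 s nz r , q
  wp⇒WP (cond f c c′) {e} {V} (s , p , p′) | yes z with wp⇒WP c′ (p′ z)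
  ...   | _ , _ , _ , r , q = _ , _ , _ , cond≡0 s z r , q
  wp⇒WP (while f c) p = p
  wp⇒WP (call x c fs) (s , _ , _ , _ , r , q) = _ , _ , _ , calling s r , q
  wp⇒WP skip q = _ , _ , _ , skipping , q

  WP-map : ∀ {d} {c : Cmd d} {e V} {Q Q′ : Post d} →
           (∀ {e′ V′ k} → Q e′ V′ k → Q′ e′ V′ k) → WP c e V Q → WP c e V Q′
  WP-map f (_ , _ , _ , r , q) = _ , _ , _ , r , f q

  Exec⇒wp : ∀ {d} (c : Cmd d) {e V e′ V′ k} {Q : Post d} → Exec c e V e′ V′ k → Q e′ V′ k → wp c e V Q
  Exec⇒wp (x := f)         (assign p)      q = p , q
  Exec⇒wp (put t a b c f)  (putting p p′)  q = (p , p′) , q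
  Exec⇒wp (c ⨾ c′)         (seq r r′)      q = Exec⇒wp c r (Exec⇒wp c′ r′ q)
  Exec⇒wp (cond f c c′)    (cond≢0 p nz r) q = p , (λ _ → Exec⇒wp c r q) , λ z → contradiction z nz
  Exec⇒wp (cond f c c′)    (cond≡0 p z r)  q = p , (λ nz → contradiction z nz) , λ _ → Exec⇒wp c′ r q
  Exec⇒wp (while f c)      r               q = _ , _ , _ , r , q
  Exec⇒wp (call x c fs)    (calling p r)   q = p , _ , _ , _ , r , q
  Exec⇒wp skip             skipping        q = q

  -- Lets a specification of a whole command be used inside the `wp` of a larger one.
  WP⇒wp : ∀ {d} (c : Cmd d) {e V Q} → WP c e V Q → wp c e V Q
  WP⇒wp c (_ , _ , _ , r , q) = Exec⇒wp c r q

  WP-⨾ : ∀ {d} {c c′ : Cmd d} {e V Q} →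
         WP c e V (λ e′ V′ k → WP c′ e′ V′ (λ e″ V″ k′ → Q e″ V″ (k + k′))) →
         WP (c ⨾ c′) e V Q
  WP-⨾ (_ , _ , _ , r , _ , _ , _ , r′ , q) = _ , _ , _ , seq r r′ , q

  -- Evaluated arguments appear as table lookups such as `V 1 0 0 j`, whereas specifications speak
  -- of `place j`.
  WP-args : ∀ {d} {c : Cmd d} {e e′ V Q} → e ≡ e′ → WP c e V Q → WP c e′ V Q
  WP-args refl p = p

  -- Inv m e V k: at most m iterations remain and k have been counted.
  while-rule : ∀ {d} {f : Exp d} {c : Cmd d} {Q : Post d}
    (Inv : ℕ → Env d → Mem → ℕ → Set) →
    (∀ {m e V k} → Inv m e V k → Safe f e V) →
    (∀ {m e V k} → Inv m e V k → eval f e V ≡ 0 → Q e V k) →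
    (∀ {m e V k} → Inv m e V k → eval f e V ≢ 0 → ∃[ m′ ] m ≡ suc m′ ×
       wp c e V (λ e′ V′ k′ → Inv m′ e′ V′ (k + suc k′))) →
    ∀ {m e V} → Inv m e V 0 → WP (while f c) e V Q
  while-rule {f = f} {c} {Q} Inv safe stop go {m} i = loop m i
    where
    loop : ∀ m {e V k} → Inv m e V k →
           WP (while f c) e V (λ e′ V′ k′ → Q e′ V′ (k + k′))
    loop m {e} {V} {k} i with eval f e V ≟ 0
    ... | yes z = _ , _ , _ , while≡0 (safe i) z ,
                   subst (Q e V) (sym (+-identityʳ k)) (stop i z)
    ... | no nz with go i nz
    ...   | m′ , refl , p with wp⇒WP c p
    ...     | _ , _ , k′ , r , i′ with loop m′ i′
    ...       | e″ , V″ , k″ , r′ , q = _ , _ , _ , while≢0 (safe i) nz r r′ ,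
                subst (Q e″ V″) (+-assoc k (suc k′) k″) q

-- Compilation to the word RAM

data Code : Set where
  reg# : Reg → Code
  num  : ℕ → Code
  op   : BinOp → Code → Code → Code
  ld   : Code → Code

toOp : BinOp → Op
toOp plus  = add
toOp times = mul
toOp minus = sub
toOp quot  = div
toOp modu  = rem
toOp same  = eq
toOp less  = lt

-- Registers from `τ` on form an evaluation stack: the first operand stays in `τ` while the second
-- is computed from `suc τ` on.
emit : ℕ → Code → List Instr
emit τ (reg# r)   = copy τ r ∷ []
emit τ (num k)    = const τ k ∷ []
emit τ (op o f g) = emit τ f ++ emit (suc τ) g ++ calc (toOp o) τ τ (suc τ) ∷ []
emit τ (ld f)     = emit τ f ++ load τ τ ∷ []

-- The base of the mixed radix addresses is kept in register 5.
baseReg : Reg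
baseReg = 5

lowerAtom : ∀ {d} → ℕ → Atom d → Code
lowerAtom β (var x) = reg# (β + toℕ x)
lowerAtom β (lit k) = num k

shift : Code → Code → Code
shift f g = op plus (op times f (reg# baseReg)) g

address : ∀ {d} → ℕ → ℕ → (a b c : Atom d) → Code
address β t a b c =
  shift (shift (shift (num t) (lowerAtom β a)) (lowerAtom β b)) (lowerAtom β c)

lower : ∀ {d} → ℕ → Exp d → Code
lower β (atom a)      = lowerAtom β a
lower β (bin o f g)   = op o (lower β f) (lower β g)
lower β (get t a b c) = ld (address β t a b c)

emitArgs : ∀ {d m} → ℕ → ℕ → Vec (Exp d) m → List Instr
emitArgs β τ []       = []
emitArgs β τ (f ∷ fs) = emit τ (lower β f) ++ emitArgs β (suc τ) fs

-- `β` is the register of local 0, and `ℓ` the address of the code, needed because jumps are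
-- absolute. The frame of a called body starts at `β + d`, right above the locals of the caller.
compile : ∀ {d} → ℕ → ℕ → Cmd d → List Instr
compile {d} β ℓ (x := f) =
  emit (β + d) (lower β f) ++ copy (β + toℕ x) (β + d) ∷ []
compile {d} β ℓ (put t a b c f) =
  emit (β + d) (address β t a b c) ++ emit (suc (β + d)) (lower β f) ++
  store (β + d) (suc (β + d)) ∷ []
compile β ℓ (c ⨾ c′) =
  compile β ℓ c ++ compile β (length (compile β 0 c) + ℓ) c′
compile {d} β ℓ (cond f c c′) =
  emit (β + d) (lower β f) ++ jumpz (β + d) ℓ₂ ∷
  compile β ℓ₁ c ++ jump (length (compile β 0 c′) + ℓ₂) ∷ compile β ℓ₂ c′
  where
  ℓ₁ = suc (length (emit (β + d) (lower β f)) + ℓ)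
  ℓ₂ = suc (length (compile β 0 c) + ℓ₁)
compile {d} β ℓ (while f c) =
  emit (β + d) (lower β f) ++ jumpz (β + d) (suc (length (compile β 0 c) + ℓ₁)) ∷
  compile β ℓ₁ c ++ jump ℓ ∷ []
  where
  ℓ₁ = suc (length (emit (β + d) (lower β f)) + ℓ)
compile {d} β ℓ (call x c fs) =
  emitArgs β (β + d) fs ++
  compile (β + d) (length (emitArgs β (β + d) fs) + ℓ) c ++
  copy (β + toℕ x) (β + d) ∷ []
compile β ℓ skip = []

-- Jump targets are computed from the length of code compiled at address 0; this is legitimate
-- because the address enters only the operands of jumps.
length-compile : ∀ {d} β ℓ ℓ′ (c : Cmd d) →
                 length (compile β ℓ c) ≡ length (compile β ℓ′ c)
length-compile β ℓ ℓ′ (x := f) = refl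
length-compile β ℓ ℓ′ (put t a b c f) = refl
length-compile β ℓ ℓ′ (c ⨾ c′)
  rewrite length-++ (compile β ℓ c) {compile β (length (compile β 0 c) + ℓ) c′}
        | length-++ (compile β ℓ′ c) {compile β (length (compile β 0 c) + ℓ′) c′} =
  cong₂ _+_ (length-compile β ℓ ℓ′ c) (length-compile β _ _ c′)
length-compile {d} β ℓ ℓ′ (cond f c c′) = length-++-cong E
    (cong suc (trans (length-++ (compile β _ c))
      (trans (cong₂ _+_ (length-compile β _ _ c) (cong suc (length-compile β _ _ c′)))
        (sym (length-++ (compile β _ c))))))
  where
  E = emit (β + d) (lower β f)
  length-++-cong : ∀ (xs : List Instr) {ys zs : List Instr} →
                   length ys ≡ length zs → length (xs ++ ys) ≡ length (xs ++ zs)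
  length-++-cong []       p = p
  length-++-cong (x ∷ xs) p = cong suc (length-++-cong xs p)
length-compile {d} β ℓ ℓ′ (while f c) =
  trans (length-++ E) (trans (cong (λ k → length E + suc k)
    (trans (length-++ (compile β _ c))
      (trans (cong (_+ 1) (length-compile β _ _ c)) (sym (length-++ (compile β _ c))))))
    (sym (length-++ E)))
  where E = emit (β + d) (lower β f)
length-compile {d} β ℓ ℓ′ (call x c fs) =
  trans (length-++ E) (trans (cong (length E +_)
    (trans (length-++ (compile (β + d) _ c))
      (trans (cong (_+ 1) (length-compile (β + d) _ _ c))
        (sym (length-++ (compile (β + d) _ c))))))
    (sym (length-++ E)))
  where E = emitArgs β (β + d) fs
length-compile β ℓ ℓ′ skip = refl

-- Running a command takes at most this many steps per counted loop iteration
-- (plus one).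
weight : ∀ {d} → ℕ → Cmd d → ℕ
weight β c@(_ := _)        = length (compile β 0 c)
weight β c@(put _ _ _ _ _) = length (compile β 0 c)
weight β (c ⨾ c′)          = weight β c + weight β c′
weight {d} β (cond f c c′) =
  2 + length (emit (β + d) (lower β f)) + (weight β c + weight β c′)
weight {d} β (while f c)   = 2 + length (emit (β + d) (lower β f)) + weight β c
weight {d} β (call x c fs) =
  1 + length (emitArgs β (β + d) fs) + weight (β + d) c
weight β skip              = 0

-- Code placement and partial runs

At : Program → ℕ → List Instr → Set
At P ℓ []       = ⊤
At P ℓ (i ∷ is) = fetch P ℓ ≡ just i × At P (suc ℓ) is

At-++ : ∀ {P} ℓ is {js} → At P ℓ (is ++ js) → At P ℓ is × At P (length is + ℓ) js
At-++ ℓ []       p       = tt , p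
At-++ {P} ℓ (i ∷ is) {js} (p , q) with At-++ (suc ℓ) is q
... | r , s = (p , r) , subst (λ k → At P k js) (+-suc (length is) ℓ) s

At-self : ∀ P → At P 0 P
At-self P = go [] P
  where
  fetch-++ : ∀ pre {i is} → fetch (pre ++ i ∷ is) (length pre) ≡ just i
  fetch-++ []        = refl
  fetch-++ (_ ∷ pre) = fetch-++ pre
  go : ∀ pre is → At (pre ++ is) (length pre) is
  go pre []       = tt
  go pre (i ∷ is) = fetch-++ pre ,
    subst₂ (λ Q k → At Q k is) (++-assoc pre (i ∷ []) is)
      (trans (length-++ pre) (+-comm (length pre) 1)) (go (pre ++ i ∷ []) is)

fetch-end : ∀ P → fetch P (length P) ≡ nothing
fetch-end []      = refl
fetch-end (_ ∷ P) = fetch-end P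

≡ᵇ-refl : ∀ m → (m ≡ᵇ m) ≡ true
≡ᵇ-refl zero    = refl
≡ᵇ-refl (suc m) = ≡ᵇ-refl m

≡ᵇ-≢ : ∀ {m n} → m ≢ n → (m ≡ᵇ n) ≡ false
≡ᵇ-≢ {m} {n} m≢n with m ≡ᵇ n in p
... | false = refl
... | true  = contradiction (≡ᵇ⇒≡ m n (subst T (sym p) tt)) m≢n

↦-same : ∀ (f : ℕ → ℕ) i a → (f [ i ↦ a ]) i ≡ a
↦-same f i a rewrite ≡ᵇ-refl i = refl

↦-other : ∀ (f : ℕ → ℕ) {i j} a → i ≢ j → (f [ i ↦ a ]) j ≡ f j
↦-other f a i≢j rewrite ≡ᵇ-≢ i≢j = refl

write-same : ∀ V t a b c x → write V t a b c x t a b c ≡ x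
write-same V t a b c x rewrite ≡ᵇ-refl t | ≡ᵇ-refl a | ≡ᵇ-refl b | ≡ᵇ-refl c = refl

-- `Halts` insists on leaving the program and does not compose; code fragments are described by runs
-- that may stop anywhere.
data Steps (P : Program) (w : ℕ) : State → ℕ → State → Set where
  halt : ∀ {s} → Steps P w s 0 s
  next : ∀ {s i k s′} → fetch P (pc s) ≡ just i →
         Steps P w (exec w i s) k s′ → Steps P w s (suc k) s′

Steps-trans : ∀ {P w s s′ s″ k k′} →
              Steps P w s k s′ → Steps P w s′ k′ s″ → Steps P w s (k + k′) s″
Steps-trans halt       r = r
Steps-trans (next p q) r = next p (Steps-trans q r)

Steps-halts : ∀ {P w s s′ k} → Steps P w s k s′ → fetch P (pc s′) ≡ nothing →
              Halts P w s k s′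
Steps-halts halt       p = done p
Steps-halts (next q r) p = step q (Steps-halts r p)

AgreeBelow : ℕ → (R R′ : Reg → ℕ) → Set
AgreeBelow τ R R′ = ∀ r → r < τ → R′ r ≡ R r

AgreeBelow-trans : ∀ {τ R R′ R″} →
                   AgreeBelow τ R R′ → AgreeBelow τ R′ R″ → AgreeBelow τ R R″
AgreeBelow-trans p q r r<τ = trans (q r r<τ) (p r r<τ)

AgreeBelow-≤ : ∀ {τ τ′ R R′} → τ ≤ τ′ → AgreeBelow τ′ R R′ → AgreeBelow τ R R′
AgreeBelow-≤ τ≤τ′ p r r<τ = p r (<-≤-trans r<τ τ≤τ′)

AgreeBelow-↦ : ∀ {τ} R r a → τ ≤ r → AgreeBelow τ R (R [ r ↦ a ])
AgreeBelow-↦ R r a τ≤r r′ r′<τ = ↦-other R a (λ r≡r′ →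
  <-irrefl (sym r≡r′) (<-≤-trans r′<τ τ≤r))

Below : ℕ → Code → Set
Below τ (reg# r)   = r < τ
Below τ (num k)    = ⊤
Below τ (op o f g) = Below τ f × Below τ g
Below τ (ld f)     = Below τ f

Below-suc : ∀ {τ} f → Below τ f → Below (suc τ) f
Below-suc (reg# r)   p       = m<n⇒m<1+n p
Below-suc (num k)    p       = tt
Below-suc (op o f g) (p , q) = Below-suc f p , Below-suc g q
Below-suc (ld f)     p       = Below-suc f p

module Machine (P : Program) (w : ℕ) where

  run : Code → (ℕ → ℕ) → (ℕ → ℕ) → ℕ
  run (reg# r)   R M = R r
  run (num k)    R M = truncate w k
  run (op o f g) R M = evalOp w (toOp o) (run f R M) (run g R M)
  run (ld f)     R M = M (run f R M)

  run-cong : ∀ {τ} f {R R′ M} → Below τ f → AgreeBelow τ R R′ → run f R′ M ≡ run f R M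
  run-cong (reg# r)   p       q = q r p
  run-cong (num k)    p       q = refl
  run-cong (op o f g) (p , r) q =
    cong₂ (evalOp w (toOp o)) (run-cong f p q) (run-cong g r q)
  run-cong (ld f) {M = M} p   q = cong M (run-cong f p q)

  Block : List Instr → (R M R′ M′ : ℕ → ℕ) → Set
  Block is R M R′ M′ = ∀ ℓ → At P ℓ is →
    Steps P w ⟨ ℓ , R , M ⟩ (length is) ⟨ length is + ℓ , R′ , M′ ⟩

  infixr 5 _▷_

  _▷_ : ∀ {is js R M R′ M′ R″ M″} →
        Block is R M R′ M′ → Block js R′ M′ R″ M″ → Block (is ++ js) R M R″ M″
  _▷_ {is} {js} {R} {M} {R″ = R″} {M″ = M″} p q ℓ at with At-++ ℓ is at
  ... | a , b = subst₂ (λ k ℓ′ → Steps P w ⟨ ℓ , R , M ⟩ k ⟨ ℓ′ , R″ , M″ ⟩)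
    (sym (length-++ is))
    (begin
      length js + (length is + ℓ) ≡⟨ sym (+-assoc (length js) (length is) ℓ) ⟩
      length js + length is + ℓ   ≡⟨ cong (_+ ℓ) (+-comm (length js) (length is)) ⟩
      length is + length js + ℓ   ≡⟨ cong (_+ ℓ) (sym (length-++ is)) ⟩
      length (is ++ js) + ℓ       ∎)
    (Steps-trans (p ℓ a) (q (length is + ℓ) b))
    where open ≡-Reasoning

  single : ∀ {i R M R′ M′} →
           (∀ ℓ → exec w i ⟨ ℓ , R , M ⟩ ≡ ⟨ suc ℓ , R′ , M′ ⟩) → Block (i ∷ []) R M R′ M′
  single {i} e ℓ (p , _) = next p (subst (λ s → Steps P w s 0 _) (sym (e ℓ)) halt)

  record Emitted (is : List Instr) (τ v : ℕ) (R M : ℕ → ℕ) : Set where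
    constructor emitted
    field
      {R′}   : ℕ → ℕ
      block  : Block is R M R′ M
      target : R′ τ ≡ v
      agree  : AgreeBelow τ R R′

  emit-sound : ∀ {R M} τ f → Below τ f → Emitted (emit τ f) τ (run f R M) R M
  emit-sound {R} τ (reg# r) p = emitted (single (λ ℓ → refl))
    (↦-same R τ _) (AgreeBelow-↦ R τ _ ≤-refl)
  emit-sound {R} τ (num k) p = emitted (single (λ ℓ → refl))
    (↦-same R τ _) (AgreeBelow-↦ R τ _ ≤-refl)
  emit-sound {R} {M} τ (op o f g) (p , q)
    with emit-sound {R} {M} τ f p
  ... | emitted {R₁} b₁ r₁ a₁ with emit-sound {R₁} {M} (suc τ) g (Below-suc g q)
  ... | emitted {R₂} b₂ r₂ a₂ = emitted (b₁ ▷ b₂ ▷ single (λ ℓ → refl))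
    (trans (↦-same R₂ τ _) (cong₂ (evalOp w (toOp o))
      (trans (a₂ τ (n<1+n τ)) r₁) (trans r₂ (run-cong g q a₁))))
    (AgreeBelow-trans a₁ (AgreeBelow-trans (AgreeBelow-≤ (n≤1+n τ) a₂)
      (AgreeBelow-↦ R₂ τ _ ≤-refl)))
  emit-sound {R} {M} τ (ld f) p with emit-sound {R} {M} τ f p
  ... | emitted {R₁} b r a = emitted (b ▷ single (λ ℓ → refl))
    (trans (↦-same R₁ τ _) (cong M r))
    (AgreeBelow-trans a (AgreeBelow-↦ R₁ τ _ ≤-refl))

-- Horner's scheme in base `B`. For tag 0 and indices 0, 0, `c` it is `c`, so array 0 occupies the
-- very cells in which the coloring must be stored.
encode : (B t a b c : ℕ) → ℕ
encode B t a b c = ((t * B + a) * B + b) * B + c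

digit-inj : ∀ {B x y a b} → a < B → b < B → x * B + a ≡ y * B + b → x ≡ y × a ≡ b
digit-inj {suc B′} {x} {y} {a} {b} a<B b<B p = x≡y , a≡b
  where
  B = suc B′
  rem-of : ∀ z {c} → c < B → (z * B + c) % B ≡ c
  rem-of z {c} c<B = trans (cong (_% B) (+-comm (z * B) c))
    (trans ([m+kn]%n≡m%n c z B) (m<n⇒m%n≡m c<B))
  a≡b : a ≡ b
  a≡b = trans (sym (rem-of x a<B)) (trans (cong (_% B) p) (rem-of y b<B))
  x≡y : x ≡ y
  x≡y = *-cancelʳ-≡ x y B (+-cancelʳ-≡ b (x * B) (y * B)
    (trans (cong (x * B +_) (sym a≡b)) p))

digit-< : ∀ {m B x a} → x < m → a < B → x * B + a < m * B
digit-< {m} {B} {x} {a} x<m a<B = begin-strict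
  x * B + a <⟨ +-monoʳ-< (x * B) a<B ⟩
  x * B + B ≡⟨ +-comm (x * B) B ⟩
  suc x * B ≤⟨ *-monoˡ-≤ B x<m ⟩
  m * B     ∎
  where open ≤-Reasoning

write-at : ∀ V t a b c x t′ a′ b′ c′ → write V t a b c x t′ a′ b′ c′ ≡
  (if (t ≡ᵇ t′) ∧ (a ≡ᵇ a′) ∧ (b ≡ᵇ b′) ∧ (c ≡ᵇ c′) then x else V t′ a′ b′ c′)
write-at V t a b c x t′ a′ b′ c′ with t ≡ᵇ t′
... | true  = refl
... | false = refl

bit<2 : ∀ b → bit b < 2
bit<2 true  = s≤s (s≤s z≤n)
bit<2 false = s≤s z≤n

-- Soundness of expressions and memory accesses

module Simulation (P : Program) (w B : ℕ) (2≤B : 2 ≤ B)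
                  (room : 16 * B * B * B ≤ 2 ^ w) where

  open Machine P w
  open Semantics (2 ^ w) B

  0<B : 0 < B
  0<B = <-trans (s≤s z≤n) 2≤B

  8≤W : 8 ≤ 2 ^ w
  8≤W = ≤-trans (m≤m+n 8 8) (≤-trans 16≤ room)
    where
    16≤ : 16 ≤ 16 * B * B * B
    16≤ = ≤-trans (≤-trans (m≤m*n 16 B {{nz}}) (m≤m*n (16 * B) B {{nz}}))
                  (m≤m*n (16 * B * B) B {{nz}})
      where nz = >-nonZero 0<B

  truncate-< : ∀ {a} → a < 2 ^ w → truncate w a ≡ a
  truncate-< = m<n⇒m%n≡m {{m^n≢0 2 w}}

  op-sound : ∀ o {a b} → SafeOp o a b → evalOp w (toOp o) a b ≡ apply o a b
  op-sound plus  p = truncate-< p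
  op-sound times p = truncate-< p
  op-sound minus {a} {b} (b≤a , a<W) = begin
    truncate w (a + (2 ^ w ∸ b))     ≡⟨ cong (truncate w) lemma ⟩
    truncate w (a ∸ b + 1 * 2 ^ w)   ≡⟨ [m+kn]%n≡m%n (a ∸ b) 1 (2 ^ w) {{m^n≢0 2 w}} ⟩
    truncate w (a ∸ b)               ≡⟨ truncate-< (≤-<-trans (m∸n≤m a b) a<W) ⟩
    a ∸ b                            ∎
    where
    open ≡-Reasoning
    lemma : a + (2 ^ w ∸ b) ≡ a ∸ b + 1 * 2 ^ w
    lemma = begin
      a + (2 ^ w ∸ b)           ≡⟨ sym (+-∸-assoc a (≤-trans b≤a (<⇒≤ a<W))) ⟩
      a + 2 ^ w ∸ b             ≡⟨ +-∸-comm (2 ^ w) b≤a ⟩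
      a ∸ b + 2 ^ w             ≡⟨ cong (a ∸ b +_) (sym (*-identityˡ (2 ^ w))) ⟩
      a ∸ b + 1 * 2 ^ w         ∎
  op-sound quot  {b = zero}  _ = refl
  op-sound quot  {b = suc _} _ = refl
  op-sound modu  {b = zero}  _ = refl
  op-sound modu  {b = suc _} _ = refl
  op-sound same  {a} {b} _ =
    truncate-< (≤-trans (bit<2 (a ≡ᵇ b)) (≤-trans (m≤m+n 2 6) 8≤W))
  op-sound less  {a} {b} _ =
    truncate-< (≤-trans (bit<2 (a <ᵇ b)) (≤-trans (m≤m+n 2 6) 8≤W))

  record _≈_ (M : ℕ → ℕ) (V : Mem) : Set where
    constructor represents
    field
      at : ∀ {t a b c} → t < 16 → a < B → b < B → c < B →
           M (encode B t a b c) ≡ V t a b c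
  open _≈_ public

  record Matches {d} (β : ℕ) (e : Env d) (R : Reg → ℕ) : Set where
    constructor matches
    field
      local : ∀ x → R (β + toℕ x) ≡ lookup e x
      base  : R baseReg ≡ B
  open Matches

  Matches-agree : ∀ {d β τ R R′} {e : Env d} → β + d ≤ τ → baseReg < τ →
                  AgreeBelow τ R R′ → Matches β e R → Matches β e R′
  Matches-agree {β = β} β+d≤τ 5<τ agr (matches m b) = matches
    (λ x → trans (agr _ (<-≤-trans (+-monoʳ-< β (Fin.toℕ<n x)) β+d≤τ)) (m x))
    (trans (agr _ 5<τ) b)

  Below-atom : ∀ {d β τ} (a : Atom d) → β + d ≤ τ → Below τ (lowerAtom β a)
  Below-atom {β = β} (var x) p = <-≤-trans (+-monoʳ-< β (Fin.toℕ<n x)) p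
  Below-atom (lit k) p = tt

  Below-address : ∀ {d β τ} t (a b c : Atom d) → β + d ≤ τ → baseReg < τ →
                  Below τ (address β t a b c)
  Below-address t a b c p q =
    ((((((tt , q) , Below-atom a p) , q) , Below-atom b p) , q) , Below-atom c p)

  Below-lower : ∀ {d β τ} (f : Exp d) → β + d ≤ τ → baseReg < τ → Below τ (lower β f)
  Below-lower (atom a)      p q = Below-atom a p
  Below-lower (bin o f g)   p q = Below-lower f p q , Below-lower g p q
  Below-lower (get t a b c) p q = Below-address t a b c p q

  lit-sound : ∀ {k m} → m ≤ 2 ^ w → T (k <ᵇ m) → truncate w k ≡ k
  lit-sound {k} {m} m≤W p = truncate-< (<-≤-trans (<ᵇ⇒< k m p) m≤W)

  index-< : ∀ {d} (a : Atom d) {e} → InRange a e → value a e < B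
  index-< (var x) p = p
  index-< (lit k) p = <-≤-trans (<ᵇ⇒< k 2 p) 2≤B

  index-sound : ∀ {d β R M} (a : Atom d) {e} → Matches β e R → InRange a e →
                run (lowerAtom β a) R M ≡ value a e
  index-sound (var x) m p = local m x
  index-sound (lit k) m p = lit-sound (≤-trans (m≤m+n 2 6) 8≤W) p

  shift-sound : ∀ {R M x a m} f g → R baseReg ≡ B → run f R M ≡ x → run g R M ≡ a →
                x < m → a < B → m * B ≤ 2 ^ w → run (shift f g) R M ≡ x * B + a
  shift-sound {x = x} {a} f g b refl refl x<m a<B fits
    rewrite b
          | truncate-< (≤-<-trans (m≤m+n (x * B) a) (<-≤-trans (digit-< x<m a<B) fits)) =
    truncate-< (<-≤-trans (digit-< x<m a<B) fits)

  address-sound : ∀ {d β R M} t (a b c : Atom d) {e V} → Matches β e R →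
    Safe (get t a b c) e V →
    run (address β t a b c) R M ≡ encode B t (value a e) (value b e) (value c e)
  address-sound {β = β} {M = M} t a b c {e} m (p , q , r , s) =
    shift-sound {M = M} (shift (shift (num t) A) A′) (lowerAtom β c) (base m)
      (shift-sound {M = M} (shift (num t) A) A′ (base m)
        (shift-sound {M = M} (num t) A (base m)
          (truncate-< (<-≤-trans t<16 16≤W)) (index-sound {M = M} a m q) t<16 a< 16B≤W)
        (index-sound {M = M} b m r) (digit-< t<16 a<) b< 16BB≤W)
      (index-sound {M = M} c m s) (digit-< (digit-< t<16 a<) b<) (index-< c s) room
    where
    A  = lowerAtom β a
    A′ = lowerAtom β b
    t<16 = <ᵇ⇒< t 16 p
    a< = index-< a q
    b< = index-< b r
    16BB≤W : 16 * B * B ≤ 2 ^ w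
    16BB≤W = ≤-trans (m≤m*n (16 * B * B) B {{>-nonZero 0<B}}) room
    16B≤W : 16 * B ≤ 2 ^ w
    16B≤W = ≤-trans (m≤m*n (16 * B) B {{>-nonZero 0<B}}) 16BB≤W
    16≤W : 16 ≤ 2 ^ w
    16≤W = ≤-trans (m≤m*n 16 B {{>-nonZero 0<B}}) 16B≤W

  lower-sound : ∀ {d β R M} (f : Exp d) {e V} → Matches β e R → M ≈ V → Safe f e V →
                run (lower β f) R M ≡ eval f e V
  lower-sound (atom (var x)) m v s = local m x
  lower-sound (atom (lit k)) m v s = lit-sound 8≤W s
  lower-sound {M = M} (bin o f g) m v (p , q , r) =
    trans (cong₂ (evalOp w (toOp o)) (lower-sound f m v p) (lower-sound g m v q))
          (op-sound o r)
  lower-sound {M = M} (get t a b c) {e} {V} m v s@(p , q , r , u) =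
    trans (cong M (address-sound {M = M} t a b c {V = V} m s))
          (at v (<ᵇ⇒< t 16 p) (index-< a q) (index-< b r) (index-< c u))

  -- Digits in base `B` are unique, so distinct indices in range have distinct addresses and no
  -- other entry is disturbed.
  write-sound : ∀ {M V t a b c} x → t < 16 → a < B → b < B → c < B → M ≈ V →
                (M [ encode B t a b c ↦ x ]) ≈ write V t a b c x
  write-sound {M} {V} {t} {a} {b} {c} x t< a< b< c< v = represents go
    where
    go : ∀ {t′ a′ b′ c′} → t′ < 16 → a′ < B → b′ < B → c′ < B →
         (M [ encode B t a b c ↦ x ]) (encode B t′ a′ b′ c′) ≡
         write V t a b c x t′ a′ b′ c′
    go {t′} {a′} {b′} {c′} t′< a′< b′< c′<
      with encode B t a b c ≟ encode B t′ a′ b′ c′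
    ... | yes p with digit-inj c< c′< p
    ...   | p₁ , refl with digit-inj b< b′< p₁
    ...     | p₂ , refl with digit-inj {x = t} {t′} a< a′< p₂
    ...       | refl , refl = trans (↦-same M (encode B t a b c) x) (sym (write-same V t a b c x))
    go {t′} {a′} {b′} {c′} t′< a′< b′< c′< | no p
      rewrite write-at V t a b c x t′ a′ b′ c′
      with t ≡ᵇ t′ in t≡ | a ≡ᵇ a′ in a≡ | b ≡ᵇ b′ in b≡ | c ≡ᵇ c′ in c≡
    ... | false | _     | _     | _     = trans (↦-other M x p) (at v t′< a′< b′< c′<)
    ... | true  | false | _     | _     = trans (↦-other M x p) (at v t′< a′< b′< c′<)
    ... | true  | true  | false | _     = trans (↦-other M x p) (at v t′< a′< b′< c′<)
    ... | true  | true  | true  | false = trans (↦-other M x p) (at v t′< a′< b′< c′<)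
    ... | true  | true  | true  | true  = contradiction
      (cong₂ (λ z → λ u → z * B + u)
        (cong₂ (λ z u → z * B + u)
          (cong₂ (λ z u → z * B + u) (eqv t t′ t≡) (eqv a a′ a≡)) (eqv b b′ b≡))
        (eqv c c′ c≡)) p
      where
      eqv : ∀ m n → (m ≡ᵇ n) ≡ true → m ≡ n
      eqv m n q = ≡ᵇ⇒≡ m n (subst T (sym q) tt)

  Matches-≔ : ∀ {d β} {R R′ : Reg → ℕ} {e : Env d} x {v} → Matches β e R →
              baseReg < β → AgreeBelow (β + d) R R′ →
              R′ (β + d) ≡ v →
              Matches β (e [ x ]≔ v) (R′ [ β + toℕ x ↦ R′ (β + d) ])
  Matches-≔ {d} {β} {R} {R′} {e} x {v} m 5<β agr r = matches go (trans
      (↦-other R′ _ (λ p → <-irrefl (sym p) (<-≤-trans 5<β (m≤m+n β (toℕ x)))))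
      (base m′))
    where
    m′ : Matches β e R′
    m′ = Matches-agree ≤-refl (<-≤-trans 5<β (m≤m+n β d)) agr m
    go : ∀ y → (R′ [ β + toℕ x ↦ R′ (β + d) ]) (β + toℕ y) ≡ lookup (e [ x ]≔ v) y
    go y with x Fin.≟ y
    ... | yes refl = trans (↦-same R′ (β + toℕ x) _) (trans r (sym (lookup∘update x e v)))
    ... | no x≢y = trans (↦-other R′ _ (x≢y ∘ Fin.toℕ-injective ∘ +-cancelˡ-≡ β _ _))
      (trans (local m′ y) (sym (lookup∘update′ (x≢y ∘ sym) e v)))

  record EmittedArgs {m} (is : List Instr) (τ : ℕ) (vs : Env m) (R M : ℕ → ℕ) : Set where
    constructor emitted
    field
      {R′}   : ℕ → ℕ
      block  : Block is R M R′ M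
      target : ∀ x → R′ (τ + toℕ x) ≡ lookup vs x
      agree  : AgreeBelow τ R R′

  args-sound : ∀ {d m β τ R M e V} (fs : Vec (Exp d) m) → β + d ≤ τ → baseReg < τ →
    Matches β e R → M ≈ V → Safes fs e V →
    EmittedArgs (emitArgs β τ fs) τ (evals fs e V) R M
  args-sound [] _ _ _ _ _ = emitted (λ _ _ → halt) (λ ()) (λ _ _ → refl)
  args-sound {β = β} {τ} {R} {M} (f ∷ fs) p q m v (s , ss)
    with emit-sound {R} {M} τ (lower β f) (Below-lower f p q)
  ... | emitted {R₁} b₁ r₁ a₁
    with args-sound {τ = suc τ} {R₁} fs (m≤n⇒m≤1+n p) (m<n⇒m<1+n q) (Matches-agree p q a₁ m) v ss
  ... | emitted {R₂} b₂ r₂ a₂ = emitted (b₁ ▷ b₂) target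
    (AgreeBelow-trans a₁ (AgreeBelow-≤ (n≤1+n τ) a₂))
    where
    target : ∀ x → R₂ (τ + toℕ x) ≡ _
    target zero = trans (cong R₂ (+-identityʳ τ)) (trans (a₂ τ (n<1+n τ))
      (trans r₁ (lower-sound f m v s)))
    target (suc x) = trans (cong R₂ (+-suc τ (toℕ x))) (r₂ x)

-- Soundness of compiled commands

csize : ∀ {d} → ℕ → Cmd d → ℕ
csize β c = length (compile β 0 c)

length-compile-++ : ∀ {d} β ℓ (c : Cmd d) js →
                    length (compile β ℓ c ++ js) ≡ csize β c + length js
length-compile-++ β ℓ c js =
  trans (length-++ (compile β ℓ c)) (cong (_+ length js) (length-compile β ℓ 0 c))

csize-⨾ : ∀ {d} β (c c′ : Cmd d) ℓ → csize β c′ + (csize β c + ℓ) ≡ csize β (c ⨾ c′) + ℓ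
csize-⨾ β c c′ ℓ = trans (sym (+-assoc (csize β c′) (csize β c) ℓ)) (cong (_+ ℓ)
  (trans (+-comm (csize β c′) (csize β c)) (sym (trans (length-compile-++ β 0 c _)
    (cong (csize β c +_) (length-compile β _ 0 c′))))))

private
  skip-over₁ : ∀ m n k ℓ → k + suc (n + suc (m + ℓ)) ≡ m + suc (n + suc k) + ℓ
  skip-over₁ = solve-∀

  skip-over₂ : ∀ m n ℓ → suc (n + suc (m + ℓ)) ≡ m + suc (n + 1) + ℓ
  skip-over₂ = solve-∀

  skip-over₃ : ∀ m n ℓ → suc (n + (m + ℓ)) ≡ m + (n + 1) + ℓ
  skip-over₃ = solve-∀

csize-cond : ∀ {d} β f (c c′ : Cmd d) ℓ → let m = length (emit (β + d) (lower β f)) in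
  csize β c′ + suc (csize β c + suc (m + ℓ)) ≡ csize β (cond f c c′) + ℓ
csize-cond {d} β f c c′ ℓ = trans (skip-over₁ _ (csize β c) (csize β c′) ℓ)
  (cong (_+ ℓ) (sym (trans (length-++ (emit (β + d) (lower β f)))
    (cong (λ n → length (emit (β + d) (lower β f)) + suc n)
      (trans (length-compile-++ β _ c _)
        (cong (λ n → csize β c + suc n) (length-compile β _ 0 c′)))))))

csize-while : ∀ {d} β f (c : Cmd d) ℓ → let m = length (emit (β + d) (lower β f)) in
  suc (csize β c + suc (m + ℓ)) ≡ csize β (while f c) + ℓ
csize-while {d} β f c ℓ = trans (skip-over₂ _ (csize β c) ℓ)
  (cong (_+ ℓ) (sym (trans (length-++ (emit (β + d) (lower β f)))
    (cong (λ n → length (emit (β + d) (lower β f)) + suc n)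
      (length-compile-++ β _ c _)))))

csize-call : ∀ {d m} β x (c : Cmd (suc m)) (fs : Vec (Exp d) (suc m)) ℓ →
  suc (csize (β + d) c + (length (emitArgs β (β + d) fs) + ℓ)) ≡ csize β (call x c fs) + ℓ
csize-call {d} β x c fs ℓ = trans (skip-over₃ _ (csize (β + d) c) ℓ)
  (cong (_+ ℓ) (sym (trans (length-++ (emitArgs β (β + d) fs))
    (cong (length (emitArgs β (β + d) fs) +_) (length-compile-++ (β + d) _ c _)))))

At-compile : ∀ {P d} β ℓ (c : Cmd d) {js} → At P ℓ (compile β ℓ c ++ js) →
             At P ℓ (compile β ℓ c) × At P (csize β c + ℓ) js
At-compile {P} β ℓ c {js} at with At-++ ℓ (compile β ℓ c) at
... | p , q = p , subst (λ n → At P (n + ℓ) js) (length-compile β ℓ 0 c) q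

module Correctness (P : Program) (w B : ℕ) (2≤B : 2 ≤ B)
                   (room : 16 * B * B * B ≤ 2 ^ w) where

  open Machine P w
  open Semantics (2 ^ w) B
  open Simulation P w B 2≤B room

  -- Keeping the registers below `β` protects the frame of a caller and, for the whole program, the
  -- inputs `n` and `Δ` in registers 0 and 1, which every later update reads again.
  record Simulated {d} (c : Cmd d) (β ℓ : ℕ) (e′ : Env d) (V′ : Mem) (k : ℕ)
                   (R M : ℕ → ℕ) : Set where
    constructor simulated
    field
      {R′ M′} : ℕ → ℕ
      {time}  : ℕ
      steps   : Steps P w ⟨ ℓ , R , M ⟩ time ⟨ csize β c + ℓ , R′ , M′ ⟩
      match   : Matches β e′ R′
      agree   : AgreeBelow β R R′
      memory  : M′ ≈ V′
      bounded : time ≤ weight β c * suc k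

  Steps-to : ∀ {ℓ ℓ′ s k R M} → ℓ ≡ ℓ′ →
             Steps P w s k ⟨ ℓ , R , M ⟩ → Steps P w s k ⟨ ℓ′ , R , M ⟩
  Steps-to refl r = r

  branch : ∀ {z b ℓ₁ ℓ₂ R M k s} → z ≡ b →
           Steps P w ⟨ (if b then ℓ₁ else ℓ₂) , R , M ⟩ k s →
           Steps P w ⟨ (if z then ℓ₁ else ℓ₂) , R , M ⟩ k s
  branch refl r = r

  straight : ∀ {d} β (c : Cmd d) → csize β c ≤ weight β c → csize β c ≤ weight β c * 1
  straight β c p = ≤-trans p (≤-reflexive (sym (*-identityʳ (weight β c))))

  Simulates : ∀ {d} → Cmd d → Set
  Simulates c = ∀ {β ℓ e V e′ V′ k R M} → baseReg < β →
    Exec c e V e′ V′ k → At P ℓ (compile β ℓ c) →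
    Matches β e R → M ≈ V → Simulated c β ℓ e′ V′ k R M

  simulate-:= : ∀ {d} x (f : Exp d) → Simulates (x := f)
  simulate-:= {d} x f {β} {ℓ} {R = R} {M} 5<β (assign s) at m v
    with emit-sound {R} {M} (β + d) (lower β f)
           (Below-lower f ≤-refl (<-≤-trans 5<β (m≤m+n β d)))
  ... | emitted {R₁} b r a = simulated ((b ▷ single (λ _ → refl)) ℓ at)
    (Matches-≔ x m 5<β a (trans r (lower-sound f m v s)))
    (AgreeBelow-trans (AgreeBelow-≤ (m≤m+n β d) a) (AgreeBelow-↦ R₁ _ _ (m≤m+n β (toℕ x))))
    v (straight β (x := f) ≤-refl)

  record Stored (τ : ℕ) (g f : Code) (R M : ℕ → ℕ) : Set where
    constructor stored
    field
      {R′}  : ℕ → ℕ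
      block : Block (emit τ g ++ emit (suc τ) f ++ store τ (suc τ) ∷ []) R M
                    R′ (M [ run g R M ↦ run f R M ])
      agree : AgreeBelow τ R R′

  store-sound : ∀ τ g f R M → Below τ g → Below τ f → Stored τ g f R M
  store-sound τ g f R M g< f< with emit-sound {R} {M} τ g g<
  ... | emitted {R₁} b₁ r₁ a₁ with emit-sound {R₁} {M} (suc τ) f (Below-suc f f<)
  ... | emitted {R₂} b₂ r₂ a₂ = stored
    (b₁ ▷ b₂ ▷ single (λ ℓ → cong₂ (λ i y → ⟨ suc ℓ , R₂ , M [ i ↦ y ] ⟩)
      (trans (a₂ τ (n<1+n τ)) r₁) (trans r₂ (run-cong f f< a₁))))
    (AgreeBelow-trans a₁ (AgreeBelow-≤ (n≤1+n τ) a₂))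

  simulate-put : ∀ {d} t (a b c : Atom d) f → Simulates (put t a b c f)
  simulate-put {d} t a b c f {β} {ℓ} {e} {V} {R = R} {M} 5<β (putting s@(p , q , r , u) s′) at m v =
    conclude (store-sound (β + d) (address β t a b c) (lower β f) R M
      (Below-address t a b c ≤-refl 5<β+d) (Below-lower f ≤-refl 5<β+d))
    where
    5<β+d = <-≤-trans 5<β (m≤m+n β d)
    V″ : Mem
    V″ = write V t (value a e) (value b e) (value c e) (eval f e V)
    conclude : Stored (β + d) (address β t a b c) (lower β f) R M →
               Simulated (put t a b c f) β ℓ e V″ 0 R M
    conclude (stored block agree) = simulated (block ℓ at)
      (Matches-agree ≤-refl 5<β+d agree m) (AgreeBelow-≤ (m≤m+n β d) agree)
      (subst₂ (λ i y → (M [ i ↦ y ]) ≈ V″)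
        (sym (address-sound {M = M} t a b c {V = V} m s)) (sym (lower-sound f m v s′))
        (write-sound (eval f e V) (<ᵇ⇒< t 16 p) (index-< a q) (index-< b r) (index-< c u) v))
      (straight β (put t a b c f) ≤-refl)

  simulate-⨾ : ∀ {d} {c c′ : Cmd d} → Simulates c → Simulates c′ → Simulates (c ⨾ c′)
  simulate-⨾ {c = c} {c′} sim sim′ {β} {ℓ} 5<β (seq {k = k} {k′} r r′) at m v
    with At-compile β ℓ c at
  ... | at₁ , at₂ with sim 5<β r at₁ m v
  ... | simulated {time = t₁} s₁ m₁ a₁ v₁ t₁≤ with sim′ 5<β r′ at₂ m₁ v₁
  ... | simulated {time = t₂} s₂ m₂ a₂ v₂ t₂≤ = simulated
    (Steps-to (csize-⨾ β c c′ ℓ) (Steps-trans s₁ s₂)) m₂ (AgreeBelow-trans a₁ a₂) v₂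
    (begin
      t₁ + t₂ ≤⟨ +-mono-≤ t₁≤ t₂≤ ⟩
      weight β c * suc k + weight β c′ * suc k′ ≤⟨ +-mono-≤
        (*-monoʳ-≤ (weight β c) (s≤s (m≤m+n k k′)))
        (*-monoʳ-≤ (weight β c′) (s≤s (m≤n+m k′ k))) ⟩
      weight β c * suc (k + k′) + weight β c′ * suc (k + k′)
        ≡⟨ sym (*-distribʳ-+ (suc (k + k′)) (weight β c) (weight β c′)) ⟩
      (weight β c + weight β c′) * suc (k + k′) ∎)
    where open ≤-Reasoning

  simulate-cond : ∀ {d} f {c c′ : Cmd d} → Simulates c → Simulates c′ → Simulates (cond f c c′)
  simulate-cond {d} f {c} {c′} sim sim′ {β} {ℓ} {e} {V} {k = k} {R} {M} 5<β (cond≢0 s nz r) at m v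
    with At-++ ℓ (emit (β + d) (lower β f)) at
  ... | at₁ , jz , at₂ with At-compile β _ c at₂
  ... | at₃ , jp , at₄
    with emit-sound {R} {M} (β + d) (lower β f)
           (Below-lower f ≤-refl (<-≤-trans 5<β (m≤m+n β d)))
  ... | emitted {R₁} b₁ r₁ a₁
    with sim {R = R₁} 5<β r at₃ (Matches-agree ≤-refl (<-≤-trans 5<β (m≤m+n β d)) a₁ m) v
  ... | simulated {time = t₂} s₂ m₂ a₂ v₂ t₂≤ = simulated
    (Steps-to (csize-cond β f c c′ ℓ) (Steps-trans (b₁ ℓ at₁)
      (next jz (branch (≡ᵇ-≢ (λ z → nz (trans (sym (lower-sound f m v s)) (trans (sym r₁) z))))
        (Steps-trans s₂ (next jp halt))))))
    m₂ (AgreeBelow-trans (AgreeBelow-≤ (m≤m+n β d) a₁) a₂) v₂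
    (begin
      n + suc (t₂ + 1) ≡⟨ shuffle n t₂ ⟩
      (2 + n) + t₂ ≤⟨ +-mono-≤ (m≤m*n (2 + n) (suc k)) t₂≤ ⟩
      (2 + n) * suc k + weight β c * suc k
        ≤⟨ +-monoʳ-≤ ((2 + n) * suc k) (*-monoˡ-≤ (suc k) (m≤m+n (weight β c) (weight β c′))) ⟩
      (2 + n) * suc k + (weight β c + weight β c′) * suc k
        ≡⟨ sym (*-distribʳ-+ (suc k) (2 + n) (weight β c + weight β c′)) ⟩
      (2 + n + (weight β c + weight β c′)) * suc k ∎)
    where
    open ≤-Reasoning
    n = length (emit (β + d) (lower β f))
    shuffle : ∀ n t → n + suc (t + 1) ≡ (2 + n) + t
    shuffle = solve-∀
  simulate-cond {d} f {c} {c′} sim sim′ {β} {ℓ} {e} {V} {k = k} {R} {M} 5<β (cond≡0 s z r) at m v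
    with At-++ ℓ (emit (β + d) (lower β f)) at
  ... | at₁ , jz , at₂ with At-compile β _ c at₂
  ... | at₃ , jp , at₄
    with emit-sound {R} {M} (β + d) (lower β f)
           (Below-lower f ≤-refl (<-≤-trans 5<β (m≤m+n β d)))
  ... | emitted {R₁} b₁ r₁ a₁
    with sim′ {R = R₁} 5<β r at₄ (Matches-agree ≤-refl (<-≤-trans 5<β (m≤m+n β d)) a₁ m) v
  ... | simulated {time = t₂} s₂ m₂ a₂ v₂ t₂≤ = simulated
    (Steps-to (csize-cond β f c c′ ℓ) (Steps-trans (b₁ ℓ at₁)
      (next jz (branch (cong (_≡ᵇ 0) (trans r₁ (trans (lower-sound f m v s) z))) s₂))))
    m₂ (AgreeBelow-trans (AgreeBelow-≤ (m≤m+n β d) a₁) a₂) v₂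
    (begin
      n + suc t₂ ≤⟨ n≤1+n _ ⟩
      suc (n + suc t₂) ≡⟨ shuffle n t₂ ⟩
      (2 + n) + t₂ ≤⟨ +-mono-≤ (m≤m*n (2 + n) (suc k)) t₂≤ ⟩
      (2 + n) * suc k + weight β c′ * suc k
        ≤⟨ +-monoʳ-≤ ((2 + n) * suc k) (*-monoˡ-≤ (suc k) (m≤n+m (weight β c′) (weight β c))) ⟩
      (2 + n) * suc k + (weight β c + weight β c′) * suc k
        ≡⟨ sym (*-distribʳ-+ (suc k) (2 + n) (weight β c + weight β c′)) ⟩
      (2 + n + (weight β c + weight β c′)) * suc k ∎)
    where
    open ≤-Reasoning
    n = length (emit (β + d) (lower β f))
    shuffle : ∀ n t → suc (n + suc t) ≡ (2 + n) + t
    shuffle = solve-∀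

  simulate-while : ∀ {d} f {c : Cmd d} → Simulates c → Simulates (while f c)
  simulate-while {d} f {c} sim {β} {ℓ} {R = R} {M} 5<β (while≡0 s z) at m v
    with At-++ ℓ (emit (β + d) (lower β f)) at
  ... | at₁ , jz , at₂
    with emit-sound {R} {M} (β + d) (lower β f)
           (Below-lower f ≤-refl (<-≤-trans 5<β (m≤m+n β d)))
  ... | emitted {R₁} b₁ r₁ a₁ = simulated
    (Steps-to (csize-while β f c ℓ) (Steps-trans (b₁ ℓ at₁)
      (next jz (branch (cong (_≡ᵇ 0) (trans r₁ (trans (lower-sound f m v s) z))) halt))))
    (Matches-agree ≤-refl (<-≤-trans 5<β (m≤m+n β d)) a₁ m)
    (AgreeBelow-≤ (m≤m+n β d) a₁) v
    (≤-trans (≤-trans (≤-reflexive (+-comm _ 1))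
        (≤-trans (n≤1+n _) (m≤m+n (2 + _) (weight β c))))
      (≤-reflexive (sym (*-identityʳ (weight β (while f c))))))
  simulate-while {d} f {c} sim {β} {ℓ} {k = k} {R} {M} 5<β (while≢0 {k = k₁} {k₂} s nz r r′) at m v
    with At-++ ℓ (emit (β + d) (lower β f)) at
  ... | at₁ , jz , at₂ with At-compile β _ c at₂
  ... | at₃ , jp , at₄
    with emit-sound {R} {M} (β + d) (lower β f)
           (Below-lower f ≤-refl (<-≤-trans 5<β (m≤m+n β d)))
  ... | emitted {R₁} b₁ r₁ a₁
    with sim {R = R₁} 5<β r at₃ (Matches-agree ≤-refl (<-≤-trans 5<β (m≤m+n β d)) a₁ m) v
  ... | simulated {R₂} {time = t₂} s₂ m₂ a₂ v₂ t₂≤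
    with simulate-while f sim {R = R₂} 5<β r′ at m₂ v₂
  ... | simulated {time = t₃} s₃ m₃ a₃ v₃ t₃≤ = simulated
    (Steps-trans (b₁ ℓ at₁)
      (next jz (branch (≡ᵇ-≢ (λ z → nz (trans (sym (lower-sound f m v s)) (trans (sym r₁) z))))
        (Steps-trans s₂ (next jp s₃)))))
    m₃ (AgreeBelow-trans (AgreeBelow-≤ (m≤m+n β d) a₁) (AgreeBelow-trans a₂ a₃)) v₃
    (begin
      n + suc (t₂ + suc t₃) ≡⟨ shuffle n t₂ t₃ ⟩
      (2 + n) + t₂ + t₃ ≤⟨ +-mono-≤ (+-mono-≤ (m≤m*n (2 + n) (suc k₁)) t₂≤) t₃≤ ⟩
      -- Since `suc k₁ + suc k₂ = suc (suc (k₁ + k₂))`, counting this iteration pays exactly for the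
      -- additional `suc`.
      (2 + n) * suc k₁ + weight β c * suc k₁ + W * suc k₂
        ≡⟨ factor (2 + n) (weight β c) k₁ k₂ ⟩
      W * suc (suc (k₁ + k₂)) ∎)
    where
    open ≤-Reasoning
    n = length (emit (β + d) (lower β f))
    W = 2 + n + weight β c
    shuffle : ∀ n t u → n + suc (t + suc u) ≡ (2 + n) + t + u
    shuffle = solve-∀
    factor : ∀ n w i j → n * suc i + w * suc i + (n + w) * suc j ≡ (n + w) * suc (suc (i + j))
    factor = solve-∀

  simulate-call : ∀ {d m} x {c : Cmd (suc m)} (fs : Vec (Exp d) (suc m)) → Simulates c → Simulates (call x c fs)
  simulate-call {d} x {c} fs sim {β} {ℓ} {k = k} {R} {M} 5<β (calling {e′ = e′} s r) at m v
    with At-++ ℓ (emitArgs β (β + d) fs) at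
  ... | at₁ , at₂ with At-compile (β + d) _ c at₂
  ... | at₃ , cp , _
    with args-sound fs ≤-refl (<-≤-trans 5<β (m≤m+n β d)) m v s
  ... | emitted {R₁} b₁ r₁ a₁
    with sim {R = R₁} (<-≤-trans 5<β (m≤m+n β d)) r at₃
           (matches r₁ (trans (a₁ _ (<-≤-trans 5<β (m≤m+n β d))) (Matches.base m))) v
  ... | simulated {R₂} {time = t₂} s₂ m₂ a₂ v₂ t₂≤ = simulated
    (Steps-to (csize-call β x c fs ℓ)
      (Steps-trans (b₁ ℓ at₁) (Steps-trans s₂ (next cp halt))))
    (Matches-≔ x m 5<β (AgreeBelow-trans a₁ a₂) (result-at e′ m₂))
    (AgreeBelow-trans (AgreeBelow-≤ (m≤m+n β d) (AgreeBelow-trans a₁ a₂))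
      (AgreeBelow-↦ R₂ _ _ (m≤m+n β (toℕ x))))
    v₂
    (begin
      n + (t₂ + 1) ≡⟨ shuffle n t₂ ⟩
      (1 + n) + t₂ ≤⟨ +-mono-≤ (m≤m*n (1 + n) (suc k)) t₂≤ ⟩
      (1 + n) * suc k + weight (β + d) c * suc k
        ≡⟨ sym (*-distribʳ-+ (suc k) (1 + n) (weight (β + d) c)) ⟩
      (1 + n + weight (β + d) c) * suc k ∎)
    where
    open ≤-Reasoning
    n = length (emitArgs β (β + d) fs)
    shuffle : ∀ n t → n + (t + 1) ≡ (1 + n) + t
    shuffle = solve-∀
    result-at : ∀ {β m R} (e : Env (suc m)) → Matches β e R → R β ≡ head e
    result-at {β} {R = R} (_ ∷ _) m = trans (cong R (sym (+-identityʳ β))) (Matches.local m zero)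

  simulate : ∀ {d} (c : Cmd d) → Simulates c
  simulate (x := f)        = simulate-:= x f
  simulate (put t a b c f) = simulate-put t a b c f
  simulate (c ⨾ c′)        = simulate-⨾ (simulate c) (simulate c′)
  simulate (cond f c c′)   = simulate-cond f (simulate c) (simulate c′)
  simulate (while f c)     = simulate-while f (simulate c)
  simulate (call x c fs)   = simulate-call x fs (simulate c)
  simulate skip _ skipping _ m v = simulated halt m (λ _ _ → refl) v z≤n

-- Finite sums

sum : ℕ → (ℕ → ℕ) → ℕ
sum zero    f = 0
sum (suc n) f = sum n f + f n

sum-cong : ∀ n {f g} → (∀ i → i < n → f i ≡ g i) → sum n f ≡ sum n g
sum-cong zero    p = refl
sum-cong (suc n) p = cong₂ _+_ (sum-cong n λ i i<n → p i (m<n⇒m<1+n i<n)) (p n ≤-refl)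

sum-mono : ∀ n {f g} → (∀ i → i < n → f i ≤ g i) → sum n f ≤ sum n g
sum-mono zero    p = z≤n
sum-mono (suc n) p = +-mono-≤ (sum-mono n λ i i<n → p i (m<n⇒m<1+n i<n)) (p n ≤-refl)

sum-const : ∀ n c → sum n (λ _ → c) ≡ n * c
sum-const zero    c = refl
sum-const (suc n) c = trans (cong (_+ c) (sum-const n c)) (+-comm (n * c) c)

sum-+ : ∀ n f g → sum n (λ i → f i + g i) ≡ sum n f + sum n g
sum-+ zero    f g = refl
sum-+ (suc n) f g = trans (cong (_+ (f n + g n)) (sum-+ n f g)) (swap (sum n f) (sum n g) (f n) (g n))
  where
  swap : ∀ a b c d → a + b + (c + d) ≡ a + c + (b + d)
  swap = solve-∀

-- The form without subtraction covers both growth and decrease of the `i`-th term.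
sum-change : ∀ {n i f g} → i < n → (∀ j → j < n → j ≢ i → g j ≡ f j) →
             sum n g + f i ≡ sum n f + g i
sum-change {suc n} {i} {f} {g} i<n p with i ≟ n
... | yes refl = trans (swap (sum n g) (g n) (f n)) (cong (λ z → z + f n + g n)
    (sum-cong n (λ j j<n → p j (m<n⇒m<1+n j<n) (<⇒≢ j<n))))
  where
  swap : ∀ a b c → a + b + c ≡ a + c + b
  swap = solve-∀
... | no i≢n = trans (swap (sum n g) (g n) (f i)) (trans
    (cong₂ _+_ (sum-change (≤∧≢⇒< (≤-pred i<n) i≢n) (λ j j<n → p j (m<n⇒m<1+n j<n)))
      (p n ≤-refl (i≢n ∘ sym)))
    (swap (sum n f) (g i) (f n)))
  where
  swap : ∀ a b c → a + b + c ≡ a + c + b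
  swap = solve-∀

sum-≤-const : ∀ n {f c} → (∀ i → i < n → f i ≤ c) → sum n f ≤ n * c
sum-≤-const n p = ≤-trans (sum-mono n p) (≤-reflexive (sum-const n _))

sum-≥-const : ∀ n {f c} → (∀ i → i < n → c ≤ f i) → n * c ≤ sum n f
sum-≥-const n p = ≤-trans (≤-reflexive (sym (sum-const n _))) (sum-mono n p)

sum-append : ∀ x l f → sum (x + l) f ≡ sum x f + sum l (λ q → f (x + q))
sum-append x zero    f = trans (cong (λ z → sum z f) (+-identityʳ x)) (sym (+-identityʳ _))
sum-append x (suc l) f = trans (cong (λ z → sum z f) (+-suc x l))
  (trans (cong (_+ f (x + l)) (sum-append x l f)) (+-assoc (sum x f) _ _))

least : (Q : ℕ → Set) → (∀ j → Dec (Q j)) → ∀ N → Q N →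
        ∃[ L ] L ≤ N × Q L × (∀ i → i < L → ¬ Q i)
least Q Q? N QN with Q? 0
... | yes Q0 = 0 , z≤n , Q0 , λ _ ()
least Q Q? zero    QN | no ¬Q0 = contradiction QN ¬Q0
least Q Q? (suc N) QN | no ¬Q0 with least (Q ∘ suc) (Q? ∘ suc) N QN
... | L , L≤N , QL , below = suc L , s≤s L≤N , QL ,
  λ { zero _ → ¬Q0 ; (suc i) (s≤s i<L) → below i i<L }

divℕ≡/ : ∀ a b .{{_ : NonZero b}} → a divℕ b ≡ a / b
divℕ≡/ a (suc b) = refl

modℕ≡% : ∀ a b .{{_ : NonZero b}} → a modℕ b ≡ a % b
modℕ≡% a (suc b) = refl

<ᵇ-true : ∀ {m n} → m < n → (m <ᵇ n) ≡ true
<ᵇ-true {m} {n} p with m <ᵇ n | <⇒<ᵇ p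
... | true | _ = refl

<ᵇ-false : ∀ {m n} → n ≤ m → (m <ᵇ n) ≡ false
<ᵇ-false {m} {n} p with m <ᵇ n in q
... | false = refl
... | true  = contradiction (<ᵇ⇒< m n (subst T (sym q) tt)) (≤⇒≯ p)

-- Levels

module Levels (Δ : ℕ) where

  -- The summand 2 keeps `s ≥ 2` also for small `Δ`: then quotients strictly decrease until they
  -- vanish, and `2 + s` is at most `A` and `s * s`.
  s A : ℕ
  s = 2 + ⌊log₂ Δ ⌋
  A = s * suc s

  quotient : ℕ → ℕ
  quotient zero    = Δ
  quotient (suc j) = quotient j / s

  -- Division by `s ≥ 2` lowers a positive quotient by at least one. This crude rate suffices for
  -- `L ≤ Δ`, which makes levels valid array indices.
  quotient-small : ∀ j → quotient j ≤ Δ ∸ j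
  quotient-small zero = ≤-refl
  quotient-small (suc j) with quotient j in p
  ... | zero  = z≤n
  ... | suc q = begin
    suc q / s    ≤⟨ ≤-pred (m/n<m (suc q) s (s≤s (s≤s z≤n))) ⟩
    q            ≡⟨ cong pred (sym p) ⟩
    pred (quotient j) ≤⟨ pred-mono-≤ (quotient-small j) ⟩
    pred (Δ ∸ j) ≡⟨ pred[m∸n]≡m∸[1+n] Δ j ⟩
    Δ ∸ suc j    ∎
    where open ≤-Reasoning

  private
    levels : ∃[ L ] L ≤ Δ × quotient L ≤ A × (∀ i → i < L → ¬ quotient i ≤ A)
    levels = least (λ j → quotient j ≤ A) (λ j → quotient j ≤? A) Δ
      (≤-trans (quotient-small Δ) (≤-trans (≤-reflexive (n∸n≡0 Δ)) z≤n))

  opaque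
    L : ℕ
    L = proj₁ levels

    L≤Δ : L ≤ Δ
    L≤Δ = proj₁ (proj₂ levels)

    quotient-L : quotient L ≤ A
    quotient-L = proj₁ (proj₂ (proj₂ levels))

    quotient-before : ∀ {i} → i < L → A < quotient i
    quotient-before i<L = ≰⇒> (proj₂ (proj₂ (proj₂ levels)) _ i<L)

  H : ℕ
  H = suc L

  -- Threshold 0 at `H` encodes properness: no neighbor may agree in all `H` digits.
  threshold radix place : ℕ → ℕ
  threshold j = if j <ᵇ H then quotient j else 0
  radix j = if j <ᵇ L then 2 + s else suc (quotient L)
  place zero    = 1
  place (suc j) = radix j * place j

  threshold-≤ : ∀ {j} → j ≤ L → threshold j ≡ quotient j
  threshold-≤ j≤L rewrite <ᵇ-true (s≤s j≤L) = refl

  threshold-H : threshold H ≡ 0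
  threshold-H rewrite <ᵇ-false (≤-refl {H}) = refl

  radix-< : ∀ {j} → j < L → radix j ≡ 2 + s
  radix-< j<L rewrite <ᵇ-true j<L = refl

  radix-L : radix L ≡ suc (quotient L)
  radix-L rewrite <ᵇ-false (≤-refl {L}) = refl

  radix≢0 : ∀ j → NonZero (radix j)
  radix≢0 j with j <ᵇ L
  ... | true  = _
  ... | false = _

  place≢0 : ∀ j → NonZero (place j)
  place≢0 zero    = _
  place≢0 (suc j) = m*n≢0 (radix j) (place j) {{radix≢0 j}} {{place≢0 j}}

  last-or-before : ∀ {j} → j < H → j < L ⊎ j ≡ L
  last-or-before (s≤s j≤L) = m≤n⇒m<n∨m≡n j≤L

  -- A least frequent digit is shared by `n′ ≤ n / radix j` neighbors. Before the last digit this is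
  -- at most the next quotient, as `radix j = 2 + s` exceeds `s`; at the last digit `radix L`
  -- exceeds `n`, so `n′ = 0`.
  shrink : ∀ {j n n′} → j < H → n ≤ threshold j → radix j * n′ ≤ n →
           n′ ≤ threshold (suc j) × (2 + s) * n′ ≤ n
  shrink {j} {n} {n′} j<H n≤t kn′≤n with last-or-before j<H
  ... | inj₁ j<L = ≤-trans n′≤ (≤-reflexive (sym (threshold-≤ j<L))) ,
                   subst (λ k → k * n′ ≤ n) (radix-< j<L) kn′≤n
    where
    n′s≤ : n′ * s ≤ quotient j
    n′s≤ = begin
      n′ * s       ≤⟨ *-monoʳ-≤ n′ (m≤n+m s 2) ⟩
      n′ * (2 + s) ≡⟨ *-comm n′ (2 + s) ⟩
      (2 + s) * n′ ≡⟨ cong (_* n′) (sym (radix-< j<L)) ⟩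
      radix j * n′ ≤⟨ kn′≤n ⟩
      n            ≤⟨ n≤t ⟩
      threshold j  ≡⟨ threshold-≤ (<⇒≤ j<L) ⟩
      quotient j   ∎
      where open ≤-Reasoning
    n′≤ : n′ ≤ quotient j / s
    n′≤ = subst (_≤ quotient j / s) (m*n/n≡m n′ s) (/-monoˡ-≤ s n′s≤)
  ... | inj₂ refl with n′
  ...   | zero   = z≤n , subst (_≤ n) (sym (*-zeroʳ (2 + s))) z≤n
  ...   | suc n″ = contradiction (begin-strict
    n                       ≤⟨ n≤t ⟩
    threshold L             ≡⟨ threshold-≤ ≤-refl ⟩
    quotient L              <⟨ n<1+n _ ⟩
    suc (quotient L)        ≡⟨ sym radix-L ⟩
    radix L                 ≤⟨ m≤m*n (radix L) (suc n″) ⟩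
    radix L * suc n″        ≤⟨ kn′≤n ⟩
    n                       ∎) (<-irrefl refl)
    where open ≤-Reasoning

  -- The sum S of the new counts over the deeper levels is at most x / (s + 1),
  -- and 1 / (s + 1) + 1 / A = 1 / s.
  gain : ∀ {i x S} → i < H → x ≤ threshold i → suc s * S ≤ x → (suc i ≡ H → S ≡ 0) →
         A * S + x ≤ A * suc (threshold (suc i))
  gain {i} {x} {S} i<H x≤t sS≤x last with last-or-before i<H
  ... | inj₁ i<L = begin
    s * suc s * S + x     ≡⟨ cong (_+ x) (*-assoc s (suc s) S) ⟩
    s * (suc s * S) + x   ≤⟨ +-monoˡ-≤ x (*-monoʳ-≤ s sS≤x) ⟩
    s * x + x             ≡⟨ +-comm (s * x) x ⟩
    suc s * x             ≤⟨ *-monoʳ-≤ (suc s) x≤ ⟩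
    suc s * (s * suc t′)  ≡⟨ sym (*-assoc (suc s) s (suc t′)) ⟩
    suc s * s * suc t′    ≡⟨ cong (_* suc t′) (*-comm (suc s) s) ⟩
    A * suc t′            ≡⟨ cong (λ t → A * suc t) (sym (threshold-≤ i<L)) ⟩
    A * suc (threshold (suc i)) ∎
    where
    open ≤-Reasoning
    t′ = quotient i / s
    x≤ : x ≤ s * suc t′
    x≤ = begin
      x                       ≤⟨ x≤t ⟩
      threshold i             ≡⟨ threshold-≤ (<⇒≤ i<L) ⟩
      quotient i              ≡⟨ m≡m%n+[m/n]*n (quotient i) s ⟩
      quotient i % s + t′ * s ≤⟨ +-monoˡ-≤ (t′ * s) (m%n≤n (quotient i) s) ⟩
      s + t′ * s              ≡⟨ cong (s +_) (*-comm t′ s) ⟩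
      s + s * t′              ≡⟨ sym (*-suc s t′) ⟩
      s * suc t′              ∎
  -- With one digit left `S` vanishes, and the claim becomes `x ≤ A`, the condition at which the
  -- sequence of quotients was stopped.
  ... | inj₂ refl rewrite last refl = begin
    A * 0 + x  ≡⟨ cong (_+ x) (*-zeroʳ A) ⟩
    x          ≤⟨ x≤t ⟩
    threshold L ≡⟨ threshold-≤ ≤-refl ⟩
    quotient L ≤⟨ quotient-L ⟩
    A          ≤⟨ m≤m*n A (suc (threshold H)) ⟩
    A * suc (threshold H) ∎
    where open ≤-Reasoning

  2+s≤A : 2 + s ≤ A
  2+s≤A = begin
    2 + s     ≤⟨ +-monoˡ-≤ s (m≤m+n 2 ⌊log₂ Δ ⌋) ⟩
    s + s     ≡⟨ cong (s +_) (sym (+-identityʳ s)) ⟩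
    2 * s     ≤⟨ *-monoˡ-≤ s (m≤n⇒m≤1+n (m≤m+n 2 ⌊log₂ Δ ⌋)) ⟩
    suc s * s ≡⟨ *-comm (suc s) s ⟩
    A         ∎
    where open ≤-Reasoning

  quotient≤Δ : ∀ j → quotient j ≤ Δ
  quotient≤Δ j = ≤-trans (quotient-small j) (m∸n≤m Δ j)

  -- Clearing and scanning the digit counts costs as many iterations as there are digits, however
  -- small `x` is; this bound keeps it within the fee of an insertion.
  radix≤A : ∀ j → radix j ≤ suc A
  radix≤A j with j <ᵇ L
  ... | true  = m≤n⇒m≤1+n 2+s≤A
  ... | false = s≤s quotient-L

  -- Digits are array indices. Where `2 + s` values are used, the quotient still exceeds
  -- `A ≥ 2 + s`, hence so does `Δ`.
  radix≤Δ : ∀ j → radix j ≤ suc Δ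
  radix≤Δ j with j <ᵇ L in p
  ... | true  = m≤n⇒m≤1+n (≤-trans 2+s≤A
    (≤-trans (<⇒≤ (quotient-before (<ᵇ⇒< j L (subst T (sym p) tt)))) (quotient≤Δ j)))
  ... | false = s≤s (quotient≤Δ L)

  place-mono : ∀ {i j} → i ≤′ j → place i ≤ place j
  place-mono ≤′-refl = ≤-refl
  place-mono {j = suc j} (≤′-step p) =
    ≤-trans (place-mono p) (m≤n*m (place j) (radix j) {{radix≢0 j}})

  quotient-pow : ∀ j → s ^ j * quotient j ≤ Δ
  quotient-pow zero = ≤-reflexive (+-identityʳ Δ)
  quotient-pow (suc j) = begin
    s * s ^ j * (quotient j / s)   ≡⟨ cong (_* (quotient j / s)) (*-comm s (s ^ j)) ⟩
    s ^ j * s * (quotient j / s)   ≡⟨ *-assoc (s ^ j) s _ ⟩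
    s ^ j * (s * (quotient j / s)) ≡⟨ cong (s ^ j *_) (*-comm s (quotient j / s)) ⟩
    s ^ j * (quotient j / s * s)   ≤⟨ *-monoʳ-≤ (s ^ j) (m/n*n≤m (quotient j) s) ⟩
    s ^ j * quotient j             ≤⟨ quotient-pow j ⟩
    Δ ∎
    where open ≤-Reasoning

  place-pow : ∀ j → j ≤ L → place j ≡ (2 + s) ^ j
  place-pow zero    p = refl
  place-pow (suc j) p = cong₂ _*_ (radix-< p) (place-pow j (<⇒≤ p))

  -- When L > 0, the last quotient is taken of a number exceeding A = s (s + 1).
  L≡0⊎big : L ≡ 0 ⊎ s < quotient L
  L≡0⊎big with L in p
  ... | zero  = inj₁ refl
  ... | suc j = inj₂ (begin
    suc s            ≡⟨ sym (m*n/n≡m (suc s) s) ⟩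
    suc s * s / s    ≡⟨ cong (_/ s) (*-comm (suc s) s) ⟩
    A / s            ≤⟨ /-monoˡ-≤ s (<⇒≤ (quotient-before (≤-reflexive (sym p)))) ⟩
    quotient j / s   ∎)
    where open ≤-Reasoning

  ^-*-self : ∀ m j → (m * m) ^ j ≡ m ^ j * m ^ j
  ^-*-self m zero    = refl
  ^-*-self m (suc j) = trans (cong (m * m *_) (^-*-self m j)) (swap m (m ^ j))
    where
    swap : ∀ a b → a * a * (b * b) ≡ a * b * (a * b)
    swap = solve-∀

  s^L≤ : s ^ L ≤ suc Δ
  s^L≤ with L≡0⊎big
  ... | inj₁ p = subst (λ l → s ^ l ≤ suc Δ) (sym p) (s≤s z≤n)
  ... | inj₂ p = m≤n⇒m≤1+n (≤-trans
    (m≤m*n (s ^ L) (quotient L) {{>-nonZero (≤-<-trans z≤n p)}}) (quotient-pow L))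

  -- By `2 + s ≤ s * s` the product is at most the square of `s ^ L`. A polynomial bound is enough
  -- to fit colors into words; the sharp count is `Estimates.colors-≤`.
  place-L≤ : place L ≤ suc Δ * suc Δ
  place-L≤ = begin
    place L           ≡⟨ place-pow L ≤-refl ⟩
    (2 + s) ^ L       ≤⟨ ^-monoˡ-≤ L 2+s≤s² ⟩
    (s * s) ^ L       ≡⟨ ^-*-self s L ⟩
    s ^ L * s ^ L     ≤⟨ *-mono-≤ s^L≤ s^L≤ ⟩
    suc Δ * suc Δ     ∎
    where
    open ≤-Reasoning
    2+s≤s² : 2 + s ≤ s * s
    2+s≤s² = begin
      2 + s   ≤⟨ +-monoˡ-≤ s (m≤m+n 2 ⌊log₂ Δ ⌋) ⟩
      s + s   ≡⟨ cong (s +_) (sym (+-identityʳ s)) ⟩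
      2 * s   ≤⟨ *-monoˡ-≤ s (m≤m+n 2 ⌊log₂ Δ ⌋) ⟩
      s * s   ∎

  place-H≤ : place H ≤ suc Δ * (suc Δ * suc Δ)
  place-H≤ = *-mono-≤ (radix≤Δ L) place-L≤

  place≤ : ∀ {j} → j ≤ H → place j ≤ place H
  place≤ p = place-mono (≤⇒≤′ p)

  -- Agreement in the `j` lowest digits is congruence modulo `place j`, so digits never have to be
  -- extracted. The downward search is the one that `levelOf` performs.
  level : ℕ → ℕ → ℕ → ℕ
  level zero    c d = 0
  level (suc h) c d =
    if c modℕ place (suc h) ≡ᵇ d modℕ place (suc h) then suc h else level h c d

  residue : ℕ → ℕ → ℕ
  residue c j = c modℕ place j

  residue-nest : ∀ {i j} c → i ≤ j → residue (residue c j) i ≡ residue c i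
  residue-nest {i} {j} c i≤j = begin
    residue (residue c j) i  ≡⟨ modℕ≡% _ (place i) {{place≢0 i}} ⟩
    _%_ (residue c j) (place i) {{place≢0 i}}
      ≡⟨ cong (λ z → _%_ z (place i) {{place≢0 i}}) (modℕ≡% c (place j) {{place≢0 j}}) ⟩
    _%_ (_%_ c (place j) {{place≢0 j}}) (place i) {{place≢0 i}}
      ≡⟨ m∣n⇒o%n%m≡o%m (place i) (place j) c {{place≢0 i}} {{place≢0 j}} (divides-place (≤⇒≤′ i≤j)) ⟩
    _%_ c (place i) {{place≢0 i}} ≡⟨ sym (modℕ≡% c (place i) {{place≢0 i}}) ⟩
    residue c i ∎
    where
    open ≡-Reasoning
    divides-place : ∀ {i j} → i ≤′ j → place i ∣ place j
    divides-place ≤′-refl = ∣-refl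
    divides-place {j = suc j} (≤′-step p) = ∣n⇒∣m*n (radix j) (divides-place p)

  residue-< : ∀ c j → residue c j < place j
  residue-< c j = subst (_< place j) (sym (modℕ≡% c (place j) {{place≢0 j}}))
    (m%n<n c (place j) {{place≢0 j}})

  residue-small : ∀ {c j} → c < place j → residue c j ≡ c
  residue-small {c} {j} p =
    trans (modℕ≡% c (place j) {{place≢0 j}}) (m<n⇒m%n≡m {{place≢0 j}} p)

  residue-coarser : ∀ {i j c d} → i ≤ j → residue c j ≡ residue d j → residue c i ≡ residue d i
  residue-coarser {i} {j} {c} {d} i≤j p = trans (sym (residue-nest c i≤j))
    (trans (cong (λ z → residue z i) p) (residue-nest d i≤j))

  level-≤ : ∀ h c d → level h c d ≤ h
  level-≤ zero    c d = z≤n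
  level-≤ (suc h) c d with residue c (suc h) ≡ᵇ residue d (suc h)
  ... | true  = ≤-refl
  ... | false = m≤n⇒m≤1+n (level-≤ h c d)

  level-top : ∀ h {c d} → residue c h ≡ residue d h → level h c d ≡ h
  level-top zero    p = refl
  level-top (suc h) {c} {d} p rewrite p | ≡ᵇ-refl (residue d (suc h)) = refl

  level-miss : ∀ h {c d} → residue c (suc h) ≢ residue d (suc h) →
               level (suc h) c d ≡ level h c d
  level-miss h p rewrite ≡ᵇ-≢ p = refl

  level-match : ∀ h c d → residue c (level h c d) ≡ residue d (level h c d)
  level-match zero c d = trans (modulo-1 c) (sym (modulo-1 d))
    where
    modulo-1 : ∀ c → residue c 0 ≡ 0
    modulo-1 c = n<1⇒n≡0 (residue-< c 0)
  level-match (suc h) c d with residue c (suc h) ≟ residue d (suc h)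
  ... | yes p rewrite level-top (suc h) {c} {d} p = p
  ... | no  p rewrite level-miss h {c} {d} p = level-match h c d

  level-sym : ∀ h c d → level h c d ≡ level h d c
  level-sym zero    c d = refl
  level-sym (suc h) c d with residue c (suc h) ≟ residue d (suc h)
  ... | yes p = trans (level-top (suc h) p) (sym (level-top (suc h) (sym p)))
  ... | no  p = trans (level-miss h p) (trans (level-sym h c d) (sym (level-miss h (p ∘ sym))))

  -- Summed over the neighbors, one more digit raises the total level by at most the number of those
  -- that still agree; this turns sums of levels into the sum `S` of counts.
  level-suc : ∀ h c d → level (suc h) c d ≤
              level h c d + bit (residue d (suc h) ≡ᵇ residue c (suc h))
  level-suc h c d with residue c (suc h) ≟ residue d (suc h)
  ... | yes p rewrite level-top (suc h) {c} {d} p | level-top h {c} {d} (residue-coarser (n≤1+n h) p)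
                    | p | ≡ᵇ-refl (residue d (suc h)) = ≤-reflexive (+-comm 1 h)
  ... | no  p rewrite level-miss h {c} {d} p = m≤m+n _ _

  level-cong : ∀ h {c c′} d → residue c h ≡ residue c′ h → level h c d ≡ level h c′ d
  level-cong zero    d p = refl
  level-cong (suc h) {c} {c′} d p
    rewrite p | level-cong h {c} {c′} d (residue-coarser (n≤1+n h) p) = refl

  level-mono : ∀ {h h′} c d → h ≤′ h′ → level h c d ≤ level h′ c d
  level-mono c d ≤′-refl = ≤-refl
  level-mono {h} {suc h′} c d (≤′-step p) = ≤-trans (level-mono c d p) step-≤
    where
    step-≤ : level h′ c d ≤ level (suc h′) c d
    step-≤ with residue c (suc h′) ≡ᵇ residue d (suc h′)
    ... | true  = m≤n⇒m≤1+n (level-≤ h′ c d)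
    ... | false = ≤-refl

  level-≥ : ∀ {i h c d} → i ≤ h → residue c i ≡ residue d i → i ≤ level h c d
  level-≥ {i} {h} {c} {d} i≤h p =
    subst (_≤ level h c d) (level-top i p) (level-mono c d (≤⇒≤′ i≤h))

  -- Changing a color above place i does not affect levels below i.
  level-low : ∀ {i h c c′} d → i ≤′ h → residue c′ i ≡ residue c i → level h c d < i →
              level h c′ d ≡ level h c d
  level-low {h = h} d ≤′-refl p q = level-cong h d p
  level-low {i} {suc h} {c} {c′} d (≤′-step i≤h) p q
    with residue c (suc h) ≟ residue d (suc h)
  ... | yes r = contradiction q (≤⇒≯ (subst (i ≤_) (sym (level-top (suc h) r)) (m≤n⇒m≤1+n (≤′⇒≤ i≤h))))
  ... | no  r = trans (level-miss h miss′) (trans (level-low d i≤h p low) (sym (level-miss h r)))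
    where
    low : level h c d < i
    low = subst (_< i) (level-miss h r) q
    miss′ : residue c′ (suc h) ≢ residue d (suc h)
    miss′ e = <⇒≱ low (level-≥ (≤′⇒≤ i≤h)
      (trans (sym p) (residue-coarser (m≤n⇒m≤1+n (≤′⇒≤ i≤h)) e)))

  level-H : ∀ {c d} → c < place H → d < place H → level H c d ≡ H → c ≡ d
  level-H {c} {d} c< d< p = begin
    c             ≡⟨ sym (residue-small c<) ⟩
    residue c H   ≡⟨ subst (λ h → residue c h ≡ residue d h) p (level-match H c d) ⟩
    residue d H   ≡⟨ residue-small d< ⟩
    d             ∎
    where open ≡-Reasoning

-- The algorithm

infix 6 #_ `_

#_ : ∀ {d} → ℕ → Exp d
# k = atom (lit k)

`_ : ∀ {d} → Fin d → Exp d
` x = atom (var x)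

O : ∀ {d} → Atom d
O = lit 0

-- Arrays: 0 color, 1 place, 2 threshold, 3 gathered neighbors, 4 digit counts;
-- the neighbors y of u with level (u , y) = j form the bucket (u , j), with its
-- size in 5 and its entries, from index 1 on, in 8; 6 gives the index of y in
-- its bucket at u, or 0 if y is not adjacent to u, and 7 the level of (u , y).

levelOf : Cmd 3
levelOf = while (bin same (bin same (bin modu (` 1F) (get 1 O O (var 0F)))
                                    (bin modu (` 2F) (get 1 O O (var 0F)))) (# 0))
                (0F := bin minus (` 0F) (# 1))

-- Locals: u, y, level, index, size, last entry.
removeHalf : Cmd 6
removeHalf =
    2F := get 7 O (var 0F) (var 1F)
  ⨾ 3F := get 6 O (var 0F) (var 1F)
  ⨾ 4F := get 5 O (var 0F) (var 2F)
  ⨾ 5F := get 8 (var 0F) (var 2F) (var 4F)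
  ⨾ put 8 (var 0F) (var 2F) (var 3F) (` 5F)
  ⨾ put 6 O (var 0F) (var 5F) (` 3F)
  -- This write must follow the previous one, because the last entry may be `y` itself.
  ⨾ put 6 O (var 0F) (var 1F) (# 0)
  ⨾ put 5 O (var 0F) (var 2F) (bin minus (` 4F) (# 1))

-- Locals: u, y, level, size.
insertHalf : Cmd 4
insertHalf =
    3F := bin plus (get 5 O (var 0F) (var 2F)) (# 1)
  ⨾ put 5 O (var 0F) (var 2F) (` 3F)
  ⨾ put 8 (var 0F) (var 2F) (var 3F) (` 1F)
  ⨾ put 6 O (var 0F) (var 1F) (` 3F)
  ⨾ put 7 O (var 0F) (var 1F) (` 2F)

relocate : Cmd 4
relocate =
    call 3F removeHalf (` 0F ∷ ` 1F ∷ # 0 ∷ # 0 ∷ # 0 ∷ # 0 ∷ [])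
  ⨾ call 3F insertHalf (` 0F ∷ ` 1F ∷ ` 2F ∷ # 0 ∷ [])

-- Bucket structure

bit≡0 : ∀ {b} → bit b ≡ 0 → b ≡ false
bit≡0 {false} _ = refl

bit≢0 : ∀ {b} → bit b ≢ 0 → b ≡ true
bit≢0 {true}  _ = refl
bit≢0 {false} p = contradiction refl p

same≢0 : ∀ {a b} → bit (a ≡ᵇ b) ≢ 0 → a ≡ b
same≢0 {a} {b} p = ≡ᵇ⇒≡ a b (subst T (sym (bit≢0 p)) tt)

same≡0 : ∀ {a b} → bit (a ≡ᵇ b) ≡ 0 → a ≢ b
same≡0 {a} p refl with trans (sym (bit≡0 p)) (≡ᵇ-refl a)
... | ()

differ≢0 : ∀ {a b} → bit (bit (a ≡ᵇ b) ≡ᵇ 0) ≢ 0 → a ≢ b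
differ≢0 p = same≡0 (same≢0 p)

differ≡0 : ∀ {a b} → bit (bit (a ≡ᵇ b) ≡ᵇ 0) ≡ 0 → a ≡ b
differ≡0 p = same≢0 (same≡0 p)

less≢0 : ∀ {a b} → bit (a <ᵇ b) ≢ 0 → a < b
less≢0 {a} {b} p = <ᵇ⇒< a b (subst T (sym (bit≢0 p)) tt)

less≡0 : ∀ {a b} → bit (a <ᵇ b) ≡ 0 → b ≤ a
less≡0 {a} {b} p = ≮⇒≥ (λ a<b → case trans (sym (bit≡0 p)) (<ᵇ-true a<b) of λ ())

exhausted : ∀ {A : Set} {q x} → q + 0 ≡ x → q < x → A
exhausted {q = q} refl q<x = contradiction (≤-reflexive (+-identityʳ q)) (<⇒≱ q<x)

hit₂ : ∀ {A : Set} {a b} {x y : A} → (if (a ≡ᵇ a) ∧ (b ≡ᵇ b) then x else y) ≡ x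
hit₂ {a = a} {b} rewrite ≡ᵇ-refl a | ≡ᵇ-refl b = refl

miss₂ : ∀ {A : Set} {a b p q} {x y : A} → a ≢ p ⊎ b ≢ q →
        (if (a ≡ᵇ p) ∧ (b ≡ᵇ q) then x else y) ≡ y
miss₂ (inj₁ a≢p) rewrite ≡ᵇ-≢ a≢p = refl
miss₂ {a = a} {p = p} (inj₂ b≢q) rewrite ≡ᵇ-≢ b≢q with a ≡ᵇ p
... | true  = refl
... | false = refl

hit₃ : ∀ {A : Set} {a b c} {x y : A} →
       (if (a ≡ᵇ a) ∧ (b ≡ᵇ b) ∧ (c ≡ᵇ c) then x else y) ≡ x
hit₃ {a = a} {b} {c} rewrite ≡ᵇ-refl a | ≡ᵇ-refl b | ≡ᵇ-refl c = refl

miss₃ : ∀ {A : Set} {a b c p q r} {x y : A} → a ≢ p ⊎ b ≢ q ⊎ c ≢ r →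
        (if (a ≡ᵇ p) ∧ (b ≡ᵇ q) ∧ (c ≡ᵇ r) then x else y) ≡ y
miss₃ (inj₁ a≢p) rewrite ≡ᵇ-≢ a≢p = refl
miss₃ {a = a} {p = p} (inj₂ m) with a ≡ᵇ p
... | true  = miss₂ m
... | false = refl

fin-bound : ∀ {n x} (f : ℕ → ℕ) → (∀ q → q < x → f q < n) →
            (∀ q r → q < x → r < x → f q ≡ f r → q ≡ r) → x ≤ n
fin-bound {n} {x} f f< inj = Fin.injective⇒≤ {f = g} λ {q} {r} p →
  Fin.toℕ-injective (inj _ _ (Fin.toℕ<n q) (Fin.toℕ<n r)
    (trans (sym (Fin.toℕ-fromℕ< _)) (trans (cong toℕ p) (Fin.toℕ-fromℕ< _))))
  where
  g : Fin x → Fin n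
  g q = fromℕ< (f< (toℕ q) (Fin.toℕ<n q))

len pos lev : Mem → ℕ → ℕ → ℕ
len V = V 5 0
pos V = V 6 0
lev V = V 7 0

ent : Mem → ℕ → ℕ → ℕ → ℕ
ent V = V 8

col seen : Mem → ℕ → ℕ
col V  = V 0 0 0
seen V = V 3 0 0

apart? : Mem → ℕ → ℕ → Bool
apart? V u y = pos V u y ≡ᵇ 0

-- Locals: digit, number of digits.
clearCounts : Cmd 2
clearCounts = while (bin less (` 0F) (` 1F))
  (put 4 O O (var 0F) (# 0) ⨾ 0F := bin plus (` 0F) (# 1))

-- Locals: index, number of neighbors, color so far, place, next place, and two
-- for the current neighbor.
countDigits : Cmd 7
countDigits = while (bin less (` 0F) (` 1F))
  ( 6F := get 3 O O (var 0F)
  ⨾ 5F := bin modu (get 0 O O (var 6F)) (` 4F)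
  ⨾ cond (bin same (bin modu (` 5F) (` 3F)) (` 2F))
      (5F := bin quot (` 5F) (` 3F) ⨾ put 4 O O (var 5F) (bin plus (get 4 O O (var 5F)) (# 1)))
      skip
  ⨾ 0F := bin plus (` 0F) (# 1))

-- Locals: best digit, number of digits, digit.
leastDigit : Cmd 3
leastDigit = while (bin less (` 2F) (` 1F))
  ( cond (bin less (get 4 O O (var 2F)) (get 4 O O (var 0F))) (0F := ` 2F) skip
  ⨾ 2F := bin plus (` 2F) (# 1))

-- Locals: color so far, level, number of neighbors, place, next level, next
-- place, number of digits, digit.
pickDigit : Cmd 8
pickDigit =
    4F := bin plus (` 1F) (# 1)
  ⨾ 3F := get 1 O O (var 1F)
  ⨾ 5F := get 1 O O (var 4F)
  ⨾ 6F := bin quot (` 5F) (` 3F)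
  ⨾ call 7F clearCounts (# 0 ∷ ` 6F ∷ [])
  ⨾ call 7F countDigits (# 0 ∷ ` 2F ∷ ` 0F ∷ ` 3F ∷ ` 5F ∷ # 0 ∷ # 0 ∷ [])
  ⨾ call 7F leastDigit (# 0 ∷ ` 6F ∷ # 0 ∷ [])
  ⨾ 0F := bin plus (` 0F) (bin times (` 7F) (` 3F))

-- Locals: color so far, level, last level, number of neighbors.
pickColor : Cmd 4
pickColor = while (bin less (` 1F) (` 2F))
  ( call 0F pickDigit (` 0F ∷ ` 1F ∷ ` 3F ∷ # 0 ∷ # 0 ∷ # 0 ∷ # 0 ∷ # 0 ∷ [])
  ⨾ 1F := bin plus (` 1F) (# 1))

count : ℕ → (ℕ → Bool) → ℕ
count x f = sum x (λ q → bit (f q))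

count-≤ : ∀ x f → count x f ≤ x
count-≤ x f = ≤-trans (sum-≤-const x (λ q _ → ≤-pred (bit<2 (f q)))) (≤-reflexive (*-identityʳ x))

term≤sum : ∀ {n i} f → i < n → f i ≤ sum n f
term≤sum {suc n} {i} f i<n with m≤n⇒m<n∨m≡n (≤-pred i<n)
... | inj₁ i<n′ = ≤-trans (term≤sum f i<n′) (m≤m+n (sum n f) (f n))
... | inj₂ refl = m≤n+m (f n) (sum n f)

SameExcept : ℕ → Mem → Mem → Set
SameExcept m V V′ = ∀ t → t ≢ m → V′ t ≡ V t

write-except : ∀ V m a b c x → SameExcept m V (write V m a b c x)
write-except V m a b c x t t≢m rewrite ≡ᵇ-≢ (t≢m ∘ sym) = refl

SameExcept-trans : ∀ {m V V′ V″} → SameExcept m V V′ → SameExcept m V′ V″ → SameExcept m V V″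
SameExcept-trans p q t t≢m = trans (q t t≢m) (p t t≢m)

digit-unique : ∀ {r b d p} .{{_ : NonZero p}} → b < p → r ≡ b + d * p → r % p ≡ b × r / p ≡ d
digit-unique {r} {b} {d} {p} b<p refl = r%p≡b ,
  *-cancelʳ-≡ _ d p (+-cancelˡ-≡ b _ _ (trans (cong (_+ r / p * p) (sym r%p≡b)) (sym (m≡m%n+[m/n]*n r p))))
  where
  r%p≡b : r % p ≡ b
  r%p≡b = trans ([m+kn]%n≡m%n b d p) (m<n⇒m%n≡m b<p)

-- Locals: number of neighbors so far, vertex, level, index.
gatherBucket : Cmd 4
gatherBucket = while (bin less (` 3F) (get 5 O (var 1F) (var 2F)))
  ( 3F := bin plus (` 3F) (# 1)
  ⨾ put 3 O O (var 0F) (get 8 (var 1F) (var 2F) (var 3F))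
  ⨾ 0F := bin plus (` 0F) (# 1))

-- Locals: index, vertex, last level, number of neighbors, color, neighbor, its
-- color and then its level, dummy.
relocateAll : Cmd 8
relocateAll = while (bin less (` 0F) (` 3F))
  ( 5F := get 3 O O (var 0F)
  ⨾ 6F := get 0 O O (var 5F)
  ⨾ call 6F levelOf (` 2F ∷ ` 4F ∷ ` 6F ∷ [])
  ⨾ call 7F relocate (` 1F ∷ ` 5F ∷ ` 6F ∷ # 0 ∷ [])
  ⨾ call 7F relocate (` 5F ∷ ` 1F ∷ ` 6F ∷ # 0 ∷ [])
  ⨾ 0F := bin plus (` 0F) (# 1))

-- Locals, here and below: vertex, last level, level, number of neighbors, color,
-- dummy.
gather : Cmd 6
gather =
    2F := ` 1F
  ⨾ call 3F gatherBucket (# 0 ∷ ` 0F ∷ ` 2F ∷ # 0 ∷ [])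
  ⨾ while (bin less (get 2 O O (var 2F)) (` 3F))
      ( 2F := bin minus (` 2F) (# 1)
      ⨾ call 3F gatherBucket (` 3F ∷ ` 0F ∷ ` 2F ∷ # 0 ∷ []))

recolor : Cmd 6
recolor = gather
  -- The digits below the level found are kept, so edges that were not gathered keep their levels.
  ⨾ 4F := bin modu (get 0 O O (var 0F)) (get 1 O O (var 2F))
  ⨾ call 4F pickColor (` 4F ∷ ` 2F ∷ ` 1F ∷ ` 3F ∷ [])
  ⨾ put 0 O O (var 0F) (` 4F)
  ⨾ call 5F relocateAll (# 0 ∷ ` 0F ∷ ` 1F ∷ ` 3F ∷ ` 4F ∷ # 0 ∷ # 0 ∷ # 0 ∷ [])

-- Locals: result, number whose logarithm is added.
logarithm : Cmd 2
logarithm = while (bin less (# 1) (` 1F))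
  (1F := bin quot (` 1F) (# 2) ⨾ 0F := bin plus (` 0F) (# 1))

-- Locals: level, Δ, s, A, place, threshold.
fillTables : Cmd 6
fillTables =
    put 1 O O (var 0F) (` 4F)
  ⨾ put 2 O O (var 0F) (` 5F)
  ⨾ while (bin less (` 3F) (` 5F))
      ( 0F := bin plus (` 0F) (# 1)
      ⨾ 4F := bin times (bin plus (` 2F) (# 2)) (` 4F)
      ⨾ 5F := bin quot (` 5F) (` 2F)
      ⨾ put 1 O O (var 0F) (` 4F)
      ⨾ put 2 O O (var 0F) (` 5F))
  ⨾ 0F := bin plus (` 0F) (# 1)
  ⨾ 4F := bin times (bin plus (` 5F) (# 1)) (` 4F)
  ⨾ put 1 O O (var 0F) (` 4F)
  ⨾ put 2 O O (var 0F) (# 0)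

-- Locals: result, Δ, s.
initialize : Cmd 3
initialize =
    -- The result starts at 2, the summand in `s`.
    call 2F logarithm (# 2 ∷ ` 1F ∷ [])
  ⨾ call 0F fillTables
      (# 0 ∷ ` 1F ∷ ` 2F ∷ bin times (` 2F) (bin plus (` 2F) (# 1)) ∷ # 1 ∷ ` 1F ∷ [])

/2≡⌊/2⌋ : ∀ m → m / 2 ≡ ⌊ m /2⌋
/2≡⌊/2⌋ zero          = refl
/2≡⌊/2⌋ (suc zero)    = refl
/2≡⌊/2⌋ (suc (suc m)) = trans (m/n≡1+[m∸n]/n {suc (suc m)} {2} (s≤s (s≤s z≤n))) (cong suc (/2≡⌊/2⌋ m))

n≤2^n : ∀ n → n ≤ 2 ^ n
n≤2^n zero    = z≤n
n≤2^n (suc n) = begin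
  1 + n             ≤⟨ +-mono-≤ (m^n>0 2 n) (n≤2^n n) ⟩
  2 ^ n + 2 ^ n     ≡⟨ cong (2 ^ n +_) (sym (+-identityʳ (2 ^ n))) ⟩
  2 ^ suc n         ∎
  where open ≤-Reasoning

⌊log₂⌋≤ : ∀ n → ⌊log₂ n ⌋ ≤ n
⌊log₂⌋≤ n = ≤-trans (⌊log₂⌋-mono-≤ (n≤2^n n)) (≤-reflexive (⌊log₂[2^n]⌋≡n n))

⌊log₂⌋-pos : ∀ {n} → 1 < n → 1 ≤ ⌊log₂ n ⌋
⌊log₂⌋-pos p = ≤-trans (≤-reflexive (sym (⌊log₂[2^n]⌋≡n 1))) (⌊log₂⌋-mono-≤ p)

⌊log₂⌋-zero : ∀ {n} → n ≤ 1 → ⌊log₂ n ⌋ ≡ 0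
⌊log₂⌋-zero p = n≤0⇒n≡0 (≤-trans (⌊log₂⌋-mono-≤ p) (≤-reflexive (⌊log₂[2^n]⌋≡n 0)))

-- Locals, here and below: Δ, kind of the update, its endpoints u and v, last
-- level, color of u and then level of the edge, color of v, dummy.
deletion : Cmd 8
deletion =
    call 7F removeHalf (` 2F ∷ ` 3F ∷ # 0 ∷ # 0 ∷ # 0 ∷ # 0 ∷ [])
  ⨾ call 7F removeHalf (` 3F ∷ ` 2F ∷ # 0 ∷ # 0 ∷ # 0 ∷ # 0 ∷ [])

insertion : Cmd 8
insertion =
    5F := get 0 O O (var 2F)
  ⨾ 6F := get 0 O O (var 3F)
  ⨾ call 5F levelOf (` 4F ∷ ` 5F ∷ ` 6F ∷ [])
  ⨾ call 7F insertHalf (` 2F ∷ ` 3F ∷ ` 5F ∷ # 0 ∷ [])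
  ⨾ call 7F insertHalf (` 3F ∷ ` 2F ∷ ` 5F ∷ # 0 ∷ [])
  ⨾ cond (bin same (` 5F) (` 4F))
      (call 7F recolor (` 2F ∷ ` 4F ∷ # 0 ∷ # 0 ∷ # 0 ∷ # 0 ∷ []))
      skip

maintain : Cmd 8
maintain =
    -- The tables depend on `Δ` alone; rebuilding them takes at most `s + L` iterations, below the
    -- amortized bound, and makes the first update no special case.
    call 4F initialize (# 0 ∷ ` 0F ∷ # 0 ∷ [])
  ⨾ cond (` 1F) deletion insertion

kind source target : ∀ {n} → Update n → ℕ
kind (insert _ _ _)   = 0
kind (delete _ _)     = 1
source (insert u _ _) = toℕ u
source (delete u _)   = toℕ u
target (insert _ v _) = toℕ v
target (delete _ v)   = toℕ v

-- Bucket invariant, removal and insertion of half-edges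

module Structure (n Δ W : ℕ)
  (room : 16 * (2 + n + Δ) * (2 + n + Δ) * (2 + n + Δ) ≤ W) where

  private
    B : ℕ
    B = 2 + n + Δ

  open Levels Δ
  open Semantics W B

  n<B : n < B
  n<B = s≤s (≤-trans (m≤m+n n Δ) (n≤1+n (n + Δ)))

  suc-n<B : suc n < B
  suc-n<B = s≤s (s≤s (m≤m+n n Δ))

  H<B : H < B
  H<B = s≤s (s≤s (≤-trans L≤Δ (m≤n+m Δ n)))

  B³<W : 0 < B → B * B * B < W
  B³<W p = <-≤-trans (begin-strict
    B * B * B            <⟨ m<m*n (B * B * B) 16 {{nz}} (s≤s (s≤s z≤n)) ⟩
    B * B * B * 16       ≡⟨ rearrange B ⟩
    16 * B * B * B       ∎) room
    where
    open ≤-Reasoning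
    nz : NonZero (B * B * B)
    nz = m*n≢0 (B * B) B {{m*n≢0 B B}}
    rearrange : ∀ b → b * b * b * 16 ≡ 16 * b * b * b
    rearrange = solve-∀

  small : ∀ {x} → x ≤ B → x < W
  small {x} x≤B = ≤-<-trans (≤-trans x≤B (≤-trans (m≤m*n B B) (m≤m*n (B * B) B))) (B³<W (s≤s z≤n))

  suc-small : ∀ {q x} → q < x → x ≤ B → q + 1 < W
  suc-small {q} q<x x≤B = small (≤-trans (≤-reflexive (+-comm q 1)) (≤-trans q<x x≤B))

  -- Entries and positions are inverse to each other. Since position 0 means absence, the zero
  -- memory satisfies this at the start.
  record Buckets (V : Mem) : Set where
    field
      entry : ∀ {u j i} → u < n → 1 ≤ i → i ≤ len V u j →
              ent V u j i < n × lev V u (ent V u j i) ≡ j × pos V u (ent V u j i) ≡ i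
      slot  : ∀ {u y} → u < n → y < n → pos V u y ≢ 0 →
              lev V u y ≤ H × pos V u y ≤ len V u (lev V u y) ×
              ent V u (lev V u y) (pos V u y) ≡ y

    len≤n : ∀ {u j} → u < n → len V u j ≤ n
    len≤n {u} {j} u<n = fin-bound (λ q → ent V u j (suc q))
      (λ q q< → proj₁ (entry u<n (s≤s z≤n) q<))
      λ q r q< r< p → suc-injective (trans (sym (proj₂ (proj₂ (entry u<n (s≤s z≤n) q<))))
        (trans (cong (pos V u) p) (proj₂ (proj₂ (entry u<n (s≤s z≤n) r<)))))

    pos≤n : ∀ {u y} → u < n → y < n → pos V u y ≢ 0 → pos V u y ≤ n
    pos≤n u<n y<n p = ≤-trans (proj₁ (proj₂ (slot u<n y<n p))) (len≤n u<n)
  open Buckets public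

  -- Twice the sum of the levels of all edges.
  potential : Mem → ℕ
  potential V = sum n (λ u → sum (suc H) (λ j → j * len V u j))

  -- Only the summand of the bucket `(a , j)` changes; the equation serves removal and insertion
  -- alike.
  potential-change : ∀ {V V′ a j} → a < n → j ≤ H →
    (∀ p q → p ≢ a ⊎ q ≢ j → len V′ p q ≡ len V p q) →
    potential V′ + j * len V a j ≡ potential V + j * len V′ a j
  potential-change {V} {V′} {a} {j} a<n j≤H same-len = +-cancelʳ-≡ (inner V + inner V′) _ _ (begin
    potential V′ + j * len V a j + (inner V + inner V′)
      ≡⟨ shuffle (potential V′) (j * len V a j) (inner V) (inner V′) ⟩
    (potential V′ + inner V) + (inner V′ + j * len V a j)
      ≡⟨ cong₂ _+_
           (sum-change {f = λ u → sum (suc H) (λ j → j * len V u j)} a<n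
             λ p _ p≢a → sum-cong (suc H) λ q _ → cong (q *_) (same-len p q (inj₁ p≢a)))
           (sum-change {f = λ j → j * len V a j} (s≤s j≤H)
             λ q _ q≢j → cong (q *_) (same-len a q (inj₂ q≢j))) ⟩
    (potential V + inner V′) + (inner V + j * len V′ a j)
      ≡⟨ shuffle′ (potential V) (inner V′) (inner V) (j * len V′ a j) ⟩
    potential V + j * len V′ a j + (inner V + inner V′) ∎)
    where
    open ≡-Reasoning
    inner : Mem → ℕ
    inner V = sum (suc H) (λ j → j * len V a j)
    shuffle : ∀ a b c d → a + b + (c + d) ≡ (a + c) + (d + b)
    shuffle = solve-∀
    shuffle′ : ∀ a b c d → (a + b) + (c + d) ≡ a + d + (c + b)
    shuffle′ = solve-∀

  SameBelow : ℕ → Mem → Mem → Set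
  SameBelow m V V′ = ∀ t → T (t <ᵇ m) → V′ t ≡ V t

  -- Adjacency is compared through `apart?` because the entry that fills the hole changes its
  -- position.
  record Removed (a b : ℕ) (V V′ : Mem) : Set where
    field
      buckets : Buckets V′
      gone    : pos V′ a b ≡ 0
      others  : ∀ {p q} → p < n → q < n → p ≢ a ⊎ q ≢ b → apart? V′ p q ≡ apart? V p q
      levels  : V′ 7 ≡ V 7
      low     : SameBelow 5 V V′
      paid    : potential V′ + lev V a b ≡ potential V

  record Inserted (a b j : ℕ) (V V′ : Mem) : Set where
    field
      buckets : Buckets V′
      present : pos V′ a b ≢ 0
      others  : ∀ {p q} → p < n → q < n → p ≢ a ⊎ q ≢ b → apart? V′ p q ≡ apart? V p q
      new     : lev V′ a b ≡ j
      levels  : ∀ {p q} → p ≢ a ⊎ q ≢ b → lev V′ p q ≡ lev V p q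
      low     : SameBelow 5 V V′
      paid    : potential V′ ≡ potential V + j

  removeHalf-spec : ∀ {a b x₂ x₃ x₄ x₅ V} → a < n → b < n → Buckets V → pos V a b ≢ 0 →
    WP removeHalf (a ∷ b ∷ x₂ ∷ x₃ ∷ x₄ ∷ x₅ ∷ []) V (λ e′ V′ k → Removed a b V V′ × k ≡ 0)
  removeHalf-spec {a} {b} {V = V} a<n b<n bk ab≢0 = wp⇒WP removeHalf
    ( (_ , _ , a<B , b<B) , (_ , _ , a<B , b<B) , (_ , _ , a<B , j<B) , (_ , a<B , j<B , l<B)
    , ((_ , a<B , j<B , i<B) , _)
    , ((_ , _ , a<B , <-trans z<n n<B) , _) , ((_ , _ , a<B , b<B) , _)
    , ((_ , _ , a<B , j<B) , _ , _ , 1≤l , small (<⇒≤ l<B))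
    , record { buckets = record { entry = entry′ ; slot = slot′ } ; gone = gone′
             ; others = others′ ; levels = refl ; low = low′ ; paid = paid′ } , refl)
    where
    j = lev V a b
    i = pos V a b
    l = len V a j
    z = ent V a j l
    V′ : Mem
    V′ = write (write (write (write V 8 a j i z) 6 0 a z i) 6 0 a b 0) 5 0 a j (l ∸ 1)
    a<B = <-trans a<n n<B
    b<B = <-trans b<n n<B
    ab = slot bk a<n b<n ab≢0
    j≤H = proj₁ ab
    j<B = ≤-<-trans j≤H H<B
    i≤l : i ≤ l
    i≤l = proj₁ (proj₂ ab)
    at-i : ent V a j i ≡ b
    at-i = proj₂ (proj₂ ab)
    i<B = ≤-<-trans (pos≤n bk a<n b<n ab≢0) n<B
    l<B = ≤-<-trans (len≤n bk {j = j} a<n) n<B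
    1≤l : 1 ≤ l
    1≤l = ≤-trans (n≢0⇒n>0 ab≢0) i≤l
    az = entry bk a<n 1≤l (≤-refl {l})
    z<n = proj₁ az
    lev-z : lev V a z ≡ j
    lev-z = proj₁ (proj₂ az)
    pos-z : pos V a z ≡ l
    pos-z = proj₂ (proj₂ az)

    pos-miss : ∀ {p q} → p ≢ a ⊎ (q ≢ b × q ≢ z) → pos V′ p q ≡ pos V p q
    pos-miss (inj₁ p≢a) = trans (miss₂ {b = b} (inj₁ (p≢a ∘ sym))) (miss₂ {b = z} (inj₁ (p≢a ∘ sym)))
    pos-miss (inj₂ (q≢b , q≢z)) = trans (miss₂ {a = a} {b} (inj₂ (q≢b ∘ sym))) (miss₂ {a = a} {z} (inj₂ (q≢z ∘ sym)))

    pos-at-z : z ≢ b → pos V′ a z ≡ i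
    pos-at-z z≢b = trans (miss₂ {a = a} {b} (inj₂ (z≢b ∘ sym))) (hit₂ {a = a} {z})

    gone′ : pos V′ a b ≡ 0
    gone′ = hit₂ {a = a} {b}

    len-hit : len V′ a j ≡ l ∸ 1
    len-hit = hit₂ {a = a} {j}

    len-miss : ∀ {p q} → p ≢ a ⊎ q ≢ j → len V′ p q ≡ len V p q
    len-miss (inj₁ p) = miss₂ {b = j} (inj₁ (p ∘ sym))
    len-miss (inj₂ p) = miss₂ {a = a} {j} (inj₂ (p ∘ sym))

    ent-miss : ∀ {p q r} → p ≢ a ⊎ q ≢ j ⊎ r ≢ i → ent V′ p q r ≡ ent V p q r
    ent-miss (inj₁ p) = miss₃ {b = j} {i} (inj₁ (p ∘ sym))
    ent-miss (inj₂ (inj₁ p)) = miss₃ {a = a} {j} {i} (inj₂ (inj₁ (p ∘ sym)))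
    ent-miss (inj₂ (inj₂ p)) = miss₃ {a = a} {j} {i} (inj₂ (inj₂ (p ∘ sym)))

    ent-hit : ent V′ a j i ≡ z
    ent-hit = hit₃ {a = a} {j} {i}

    Entry : ℕ → ℕ → ℕ → ℕ → Set
    Entry u j i y = y < n × lev V u y ≡ j × pos V′ u y ≡ i

    entry′ : ∀ {u j′ i′} → u < n → 1 ≤ i′ → i′ ≤ len V′ u j′ → Entry u j′ i′ (ent V′ u j′ i′)
    entry′ {u} {j′} {i′} u<n 1≤i′ i′≤ with u ≟ a | j′ ≟ j
    ... | no u≢a | _ with entry bk u<n 1≤i′ (subst (i′ ≤_) (len-miss (inj₁ u≢a)) i′≤)
    ...   | y< , y-lev , y-pos = subst (Entry u j′ i′) (sym (ent-miss (inj₁ u≢a)))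
            (y< , y-lev , trans (pos-miss (inj₁ u≢a)) y-pos)
    entry′ {u} {j′} {i′} u<n 1≤i′ i′≤ | yes refl | no j′≢j
      with entry bk u<n 1≤i′ (subst (i′ ≤_) (len-miss (inj₂ j′≢j)) i′≤)
    ...   | y< , y-lev , y-pos = subst (Entry a j′ i′) (sym (ent-miss (inj₂ (inj₁ j′≢j))))
            (y< , y-lev , trans (pos-miss (inj₂
              ( (λ y≡b → j′≢j (trans (sym y-lev) (cong (lev V a) y≡b)))
              , (λ y≡z → j′≢j (trans (sym y-lev) (trans (cong (lev V a) y≡z) lev-z)))))) y-pos)
    entry′ {u} {j′} {i′} u<n 1≤i′ i′≤ | yes refl | yes refl with i′ ≟ i
    -- The hole lies inside the shortened bucket, so it was not the last place and the entry moved
    -- into it differs from `b`.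
    ... | yes refl = subst (Entry a j i) (sym ent-hit) (z<n , lev-z , pos-at-z z≢b)
      where
      z≢b : z ≢ b
      z≢b z≡b = <⇒≢ (≤-<-trans (subst (i ≤_) len-hit i′≤) (∸-monoʳ-< {l} {1} {0} (s≤s z≤n) 1≤l))
        (trans (cong (pos V a) (sym z≡b)) pos-z)
    ... | no i′≢i with entry bk a<n 1≤i′ i′≤l
      where
      i′≤l : i′ ≤ l
      i′≤l = ≤-trans (subst (i′ ≤_) len-hit i′≤) (m∸n≤m l 1)
    ...   | y< , y-lev , y-pos = subst (Entry a j i′) (sym (ent-miss (inj₂ (inj₂ i′≢i))))
            (y< , y-lev , trans (pos-miss (inj₂
              ( (λ y≡b → i′≢i (trans (sym y-pos) (cong (pos V a) y≡b)))
              , (λ y≡z → <⇒≢ (≤-<-trans (subst (i′ ≤_) len-hit i′≤)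
                                (∸-monoʳ-< {l} {1} {0} (s≤s z≤n) 1≤l))
                    (trans (sym y-pos) (trans (cong (pos V a) y≡z) pos-z)))))) y-pos)

    Slot : ℕ → ℕ → ℕ → Set
    Slot u y i = lev V u y ≤ H × i ≤ len V′ u (lev V u y) × ent V′ u (lev V u y) i ≡ y

    slot′ : ∀ {u y} → u < n → y < n → pos V′ u y ≢ 0 → Slot u y (pos V′ u y)
    slot′ {u} {y} u<n y<n uy≢0 with u ≟ a
    ... | no u≢a with slot bk u<n y<n (λ p → uy≢0 (trans (pos-miss (inj₁ u≢a)) p))
    ...   | q , r , t = subst (Slot u y) (sym (pos-miss (inj₁ u≢a)))
            (q , subst (_ ≤_) (sym (len-miss (inj₁ u≢a))) r , trans (ent-miss (inj₁ u≢a)) t)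
    slot′ {u} {y} u<n y<n uy≢0 | yes refl with y ≟ b
    ... | yes refl = contradiction gone′ uy≢0
    ... | no y≢b with y ≟ z
    ...   | yes y≡z = subst (λ y → Slot a y (pos V′ a y)) (sym y≡z)
              (subst (Slot a z) (sym (pos-at-z z≢b))
                ( ≤-trans (≤-reflexive lev-z) j≤H
                , subst (λ k → i ≤ len V′ a k) (sym lev-z)
                    (subst (i ≤_) (sym len-hit) (∸-monoˡ-≤ 1 (≤∧≢⇒< i≤l i≢l)))
                , trans (cong (λ k → ent V′ a k i) lev-z) ent-hit))
      where
      z≢b : z ≢ b
      z≢b z≡b = y≢b (trans y≡z z≡b)
      i≢l : i ≢ l
      i≢l p = z≢b (trans (cong (ent V a j) (sym p)) at-i)
    ...   | no y≢z with slot bk a<n y<n (λ p → uy≢0 (trans (pos-miss (inj₂ (y≢b , y≢z))) p))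
    ...     | q , r , t with lev V a y ≟ j
    ...       | no l≢j = subst (Slot a y) (sym (pos-miss (inj₂ (y≢b , y≢z))))
                (q , subst (_ ≤_) (sym (len-miss (inj₂ l≢j))) r
                   , trans (ent-miss (inj₂ (inj₁ l≢j))) t)
    ...       | yes l≡j = subst (Slot a y) (sym (pos-miss (inj₂ (y≢b , y≢z))))
                ( q
                , subst (λ k → pos V a y ≤ len V′ a k) (sym l≡j)
                    (subst (pos V a y ≤_) (sym len-hit) (∸-monoˡ-≤ 1 (≤∧≢⇒<
                      (subst (λ k → pos V a y ≤ len V a k) l≡j r)
                      (λ p → y≢z (trans (sym t) (cong₂ (ent V a) l≡j p))))))
                , trans (ent-miss (inj₂ (inj₂ (λ p → y≢b
                    (trans (sym t) (trans (cong₂ (ent V a) l≡j p) at-i)))))) t)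

    others′ : ∀ {p q} → p < n → q < n → p ≢ a ⊎ q ≢ b → apart? V′ p q ≡ apart? V p q
    others′ {p} {q} p<n q<n m with p ≟ a | q ≟ z
    ... | no p≢a | _ = cong (_≡ᵇ 0) (pos-miss (inj₁ p≢a))
    ... | yes refl | no q≢z with m
    ...   | inj₁ a≢a = contradiction refl a≢a
    ...   | inj₂ q≢b = cong (_≡ᵇ 0) (pos-miss (inj₂ (q≢b , q≢z)))
    others′ {p} {q} p<n q<n m | yes refl | yes q≡z with m
    ...   | inj₁ a≢a = contradiction refl a≢a
    ...   | inj₂ q≢b = trans
              (≡ᵇ-≢ {n = 0} (subst (_≢ 0) (sym (trans (cong (pos V′ a) q≡z) (pos-at-z (q≢b ∘ trans q≡z)))) ab≢0))
              (sym (≡ᵇ-≢ {n = 0} (subst (_≢ 0) (sym (trans (cong (pos V a) q≡z) pos-z)) (m<n⇒n≢0 1≤l))))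

    low′ : SameBelow 5 V V′
    low′ 0 _ = refl
    low′ 1 _ = refl
    low′ 2 _ = refl
    low′ 3 _ = refl
    low′ 4 _ = refl

    paid′ : potential V′ + j ≡ potential V
    paid′ = +-cancelʳ-≡ (j * (l ∸ 1)) _ _ (begin
      potential V′ + j + j * (l ∸ 1)   ≡⟨ +-assoc (potential V′) j _ ⟩
      potential V′ + (j + j * (l ∸ 1)) ≡⟨ cong (potential V′ +_) (sym (*-suc j (l ∸ 1))) ⟩
      potential V′ + j * suc (l ∸ 1)   ≡⟨ cong (λ k → potential V′ + j * k) (m+[n∸m]≡n 1≤l) ⟩
      potential V′ + j * l             ≡⟨ potential-change {V} {V′} a<n j≤H (λ p q → len-miss) ⟩
      potential V + j * len V′ a j     ≡⟨ cong (λ k → potential V + j * k) len-hit ⟩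
      potential V + j * (l ∸ 1)        ∎)
      where open ≡-Reasoning

  insertHalf-spec : ∀ {a b j x V} → a < n → b < n → j ≤ H → Buckets V → pos V a b ≡ 0 →
    WP insertHalf (a ∷ b ∷ j ∷ x ∷ []) V (λ e′ V′ k → Inserted a b j V V′ × k ≡ 0)
  insertHalf-spec {a} {b} {j} {V = V} a<n b<n j≤H bk ab≡0 = wp⇒WP insertHalf
    ( ((_ , _ , a<B , j<B) , _ , small (≤-trans (≤-reflexive (+-comm (len V a j) 1)) l≤B))
    , ((_ , _ , a<B , j<B) , _) , ((_ , a<B , j<B , l<B) , _)
    , ((_ , _ , a<B , b<B) , _) , ((_ , _ , a<B , b<B) , _)
    , record { buckets = record { entry = entry′ ; slot = slot′ } ; present = present′
             ; others = λ _ _ m → cong (_≡ᵇ 0) (pos-miss m) ; new = new′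
             ; levels = lev-miss ; low = low′ ; paid = paid′ } , refl)
    where
    l = len V a j + 1
    V′ : Mem
    V′ = write (write (write (write V 5 0 a j l) 8 a j l b) 6 0 a b l) 7 0 a b j
    a<B = <-trans a<n n<B
    b<B = <-trans b<n n<B
    j<B = ≤-<-trans j≤H H<B
    l≡suc : l ≡ suc (len V a j)
    l≡suc = +-comm (len V a j) 1
    l<B : l < B
    -- The size is bounded by `n` only before the insertion, so the new index needs `suc n < B`.
    l<B = subst (_< B) (sym l≡suc) (≤-<-trans (s≤s (len≤n bk {j = j} a<n)) suc-n<B)
    l≤B = subst (_≤ B) l≡suc (<⇒≤ l<B)

    pos-hit : pos V′ a b ≡ l
    pos-hit = hit₂ {a = a} {b}

    pos-miss : ∀ {p q} → p ≢ a ⊎ q ≢ b → pos V′ p q ≡ pos V p q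
    pos-miss (inj₁ p) = miss₂ {b = b} (inj₁ (p ∘ sym))
    pos-miss (inj₂ p) = miss₂ {a = a} {b} (inj₂ (p ∘ sym))

    new′ : lev V′ a b ≡ j
    new′ = hit₂ {a = a} {b}

    lev-miss : ∀ {p q} → p ≢ a ⊎ q ≢ b → lev V′ p q ≡ lev V p q
    lev-miss (inj₁ p) = miss₂ {b = b} (inj₁ (p ∘ sym))
    lev-miss (inj₂ p) = miss₂ {a = a} {b} (inj₂ (p ∘ sym))

    len-hit : len V′ a j ≡ l
    len-hit = hit₂ {a = a} {j}

    len-miss : ∀ {p q} → p ≢ a ⊎ q ≢ j → len V′ p q ≡ len V p q
    len-miss (inj₁ p) = miss₂ {b = j} (inj₁ (p ∘ sym))
    len-miss (inj₂ p) = miss₂ {a = a} {j} (inj₂ (p ∘ sym))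

    ent-hit : ent V′ a j l ≡ b
    ent-hit = hit₃ {a = a} {j} {l}

    ent-miss : ∀ {p q r} → p ≢ a ⊎ q ≢ j ⊎ r ≢ l → ent V′ p q r ≡ ent V p q r
    ent-miss (inj₁ p) = miss₃ {b = j} {l} (inj₁ (p ∘ sym))
    ent-miss (inj₂ (inj₁ p)) = miss₃ {a = a} {j} {l} (inj₂ (inj₁ (p ∘ sym)))
    ent-miss (inj₂ (inj₂ p)) = miss₃ {a = a} {j} {l} (inj₂ (inj₂ (p ∘ sym)))

    present′ : pos V′ a b ≢ 0
    present′ p = case trans (sym l≡suc) (trans (sym pos-hit) p) of λ ()

    Entry : ℕ → ℕ → ℕ → ℕ → Set
    Entry u j i y = y < n × lev V′ u y ≡ j × pos V′ u y ≡ i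

    old-entry : ∀ {u j′ i′} → u < n → 1 ≤ i′ → i′ ≤ len V u j′ → Entry u j′ i′ (ent V u j′ i′)
    old-entry {u} {j′} {i′} u<n 1≤i′ i′≤ with entry bk u<n 1≤i′ i′≤
    ... | y< , y-lev , y-pos = y< , trans (lev-miss m) y-lev , trans (pos-miss m) y-pos
      where
      m : u ≢ a ⊎ ent V u j′ i′ ≢ b
      m with u ≟ a
      ... | no u≢a = inj₁ u≢a
      ... | yes refl = inj₂ λ y≡b → m<n⇒n≢0 1≤i′
        (trans (sym y-pos) (trans (cong (pos V a) y≡b) ab≡0))

    entry′ : ∀ {u j′ i′} → u < n → 1 ≤ i′ → i′ ≤ len V′ u j′ → Entry u j′ i′ (ent V′ u j′ i′)
    entry′ {u} {j′} {i′} u<n 1≤i′ i′≤ with u ≟ a | j′ ≟ j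
    ... | no u≢a | _ = subst (Entry u j′ i′) (sym (ent-miss (inj₁ u≢a)))
      (old-entry u<n 1≤i′ (subst (i′ ≤_) (len-miss (inj₁ u≢a)) i′≤))
    ... | yes refl | no j′≢j = subst (Entry a j′ i′) (sym (ent-miss (inj₂ (inj₁ j′≢j))))
      (old-entry a<n 1≤i′ (subst (i′ ≤_) (len-miss (inj₂ j′≢j)) i′≤))
    ... | yes refl | yes refl with i′ ≟ l
    ...   | yes refl = subst (Entry a j l) (sym ent-hit) (b<n , new′ , pos-hit)
    ...   | no i′≢l = subst (Entry a j i′) (sym (ent-miss (inj₂ (inj₂ i′≢l))))
      (old-entry a<n 1≤i′ (≤-pred (subst (i′ <_) l≡suc (≤∧≢⇒< (subst (i′ ≤_) len-hit i′≤) i′≢l))))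

    Slot : ℕ → ℕ → ℕ → ℕ → Set
    Slot u y k i = k ≤ H × i ≤ len V′ u k × ent V′ u k i ≡ y

    slot′ : ∀ {u y} → u < n → y < n → pos V′ u y ≢ 0 → Slot u y (lev V′ u y) (pos V′ u y)
    slot′ {u} {y} u<n y<n uy≢0 with u ≟ a | y ≟ b
    ... | yes refl | yes refl = subst₂ (Slot a b) (sym new′) (sym pos-hit)
      (j≤H , ≤-reflexive (sym len-hit) , ent-hit)
    ... | no u≢a | _ = subst₂ (Slot u y) (sym (lev-miss (inj₁ u≢a))) (sym (pos-miss (inj₁ u≢a)))
      (case slot bk u<n y<n (uy≢0 ∘ trans (pos-miss (inj₁ u≢a))) of λ (p , q , r) →
        p , subst (_ ≤_) (sym (len-miss (inj₁ u≢a))) q , trans (ent-miss (inj₁ u≢a)) r)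
    ... | yes refl | no y≢b = subst₂ (Slot a y) (sym (lev-miss (inj₂ y≢b))) (sym (pos-miss (inj₂ y≢b)))
      (old (slot bk a<n y<n (uy≢0 ∘ trans (pos-miss (inj₂ y≢b)))))
      where
      old : ∀ {k i} → k ≤ H × i ≤ len V a k × ent V a k i ≡ y → Slot a y k i
      old {k} {i} (p , q , r) with k ≟ j
      ... | no k≢j = p , subst (i ≤_) (sym (len-miss (inj₂ k≢j))) q ,
                     trans (ent-miss (inj₂ (inj₁ k≢j))) r
      ... | yes refl = p , subst (i ≤_) (sym len-hit) (<⇒≤ i<l) ,
                       trans (ent-miss (inj₂ (inj₂ (<⇒≢ i<l)))) r
        where
        i<l : i < l
        i<l = subst (i <_) (sym l≡suc) (s≤s q)

    low′ : SameBelow 5 V V′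
    low′ 0 _ = refl
    low′ 1 _ = refl
    low′ 2 _ = refl
    low′ 3 _ = refl
    low′ 4 _ = refl

    paid′ : potential V′ ≡ potential V + j
    paid′ = +-cancelʳ-≡ (j * len V a j) _ _ (begin
      potential V′ + j * len V a j         ≡⟨ potential-change {V} {V′} a<n j≤H (λ p q → len-miss) ⟩
      potential V + j * len V′ a j         ≡⟨ cong (λ k → potential V + j * k) (trans len-hit l≡suc) ⟩
      potential V + j * suc (len V a j)    ≡⟨ cong (potential V +_) (*-suc j (len V a j)) ⟩
      potential V + (j + j * len V a j)    ≡⟨ sym (+-assoc (potential V) j _) ⟩
      potential V + j + j * len V a j      ∎)
      where open ≡-Reasoning

  record Relocated (a b j : ℕ) (V V′ : Mem) : Set where
    field
      buckets : Buckets V′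
      same-adjacency : ∀ {p q} → p < n → q < n → apart? V′ p q ≡ apart? V p q
      new     : lev V′ a b ≡ j
      levels  : ∀ {p q} → p ≢ a ⊎ q ≢ b → lev V′ p q ≡ lev V p q
      low     : SameBelow 5 V V′
      paid    : potential V′ + lev V a b ≡ potential V + j

  relocate-spec : ∀ {a b j x V} → a < n → b < n → j ≤ H → Buckets V → pos V a b ≢ 0 →
    WP relocate (a ∷ b ∷ j ∷ x ∷ []) V (λ e′ V′ k → Relocated a b j V V′ × k ≡ 0)
  relocate-spec {a} {b} {j} {V = V} a<n b<n j≤H bk ab≢0 = wp⇒WP relocate
    ( _ , WP-map (λ { (rm , refl) → _ , WP-map (λ { (ins , refl) → combine rm ins , refl })
        (insertHalf-spec a<n b<n j≤H (Removed.buckets rm) (Removed.gone rm)) })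
        (removeHalf-spec a<n b<n bk ab≢0))
    where
    combine : ∀ {V₁ V₂} → Removed a b V V₁ → Inserted a b j V₁ V₂ → Relocated a b j V V₂
    combine {V₁} {V₂} rm ins = record
      { buckets = Inserted.buckets ins
      ; same-adjacency = stays
      ; new = Inserted.new ins
      ; levels = λ {p} {q} m → trans (Inserted.levels ins m) (cong (λ f → f 0 p q) (Removed.levels rm))
      ; low = λ t t<5 → trans (Inserted.low ins t t<5) (Removed.low rm t t<5)
      ; paid = begin
          potential V₂ + lev V a b     ≡⟨ cong (_+ lev V a b) (Inserted.paid ins) ⟩
          potential V₁ + j + lev V a b ≡⟨ swap (potential V₁) j (lev V a b) ⟩
          potential V₁ + lev V a b + j ≡⟨ cong (_+ j) (Removed.paid rm) ⟩
          potential V + j              ∎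
      }
      where
      open ≡-Reasoning
      swap : ∀ a b c → a + b + c ≡ a + c + b
      swap = solve-∀
      stays : ∀ {p q} → p < n → q < n → apart? V₂ p q ≡ apart? V p q
      stays {p} {q} p<n q<n with p ≟ a | q ≟ b
      ... | yes refl | yes refl = trans (≡ᵇ-≢ (Inserted.present ins)) (sym (≡ᵇ-≢ ab≢0))
      ... | no p≢a | _ = trans (Inserted.others ins p<n q<n (inj₁ p≢a)) (Removed.others rm p<n q<n (inj₁ p≢a))
      ... | yes _ | no q≢b = trans (Inserted.others ins p<n q<n (inj₂ q≢b)) (Removed.others rm p<n q<n (inj₂ q≢b))

  -- Tables and the level of an edge

  record Tables (V : Mem) : Set where
    field
      places     : ∀ {j} → j ≤ H → V 1 0 0 j ≡ place j
      thresholds : ∀ {j} → j ≤ H → V 2 0 0 j ≡ threshold j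
  open Tables public

  levelOf-spec : ∀ {c d V} → Tables V →
    WP levelOf (H ∷ c ∷ d ∷ []) V
      (λ e′ V′ k → head e′ ≡ level H c d × V′ ≡ V × k ≤ H)
  levelOf-spec {c} {d} {V} tb = while-rule
    (λ m e V′ k → e ≡ m ∷ c ∷ d ∷ [] × V′ ≡ V × k + m ≡ H × level H c d ≡ level m c d)
    (λ { {m} {k = k} (refl , refl , km , _) → ((_ , (_ , _ , _ , m<B k km) , _) , (_ , (_ , _ , _ , m<B k km) , _) , _) , _ })
    (λ { {m} {k = k} (refl , refl , km , p) z →
         sym (trans p (level-top m (residues m (m≤H k km) (differ≡0 z)))) , refl ,
         subst (k ≤_) km (m≤m+n k m) })
    -- All numbers are congruent modulo `place 0 = 1`, so the loop cannot pass level 0.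
    (λ { {zero} {k = k} (refl , refl , km , p) nz → contradiction
           (trans (modulo-1 c) (sym (modulo-1 d))) (differ≢0 nz)
       ; {suc m} {k = k} (refl , refl , km , p) nz → m , refl ,
           (_ , _ , s≤s z≤n , small (<⇒≤ (≤-<-trans (m≤H k km) H<B))) ,
           refl , refl , trans (cong (_+ m) (+-comm k 1)) (trans (sym (+-suc k m)) km) ,
           trans p (level-miss m (λ r → differ≢0 nz (residues⁻ (suc m) (m≤H k km) r))) })
    (refl , refl , refl , refl)
    where
    m≤H : ∀ {m} k → k + m ≡ H → m ≤ H
    m≤H {m} k p = subst (m ≤_) p (m≤n+m m k)
    m<B : ∀ {m} k → k + m ≡ H → m < B
    m<B k p = ≤-<-trans (m≤H k p) H<B
    modulo-1 : ∀ c → c modℕ V 1 0 0 0 ≡ 0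
    modulo-1 c = n<1⇒n≡0 (subst (λ P → c modℕ P < 1) (sym (places tb z≤n)) (residue-< c 0))
    residues : ∀ m → m ≤ H → c modℕ V 1 0 0 m ≡ d modℕ V 1 0 0 m → residue c m ≡ residue d m
    residues m m≤H = subst (λ P → c modℕ P ≡ d modℕ P) (places tb m≤H)
    residues⁻ : ∀ m → m ≤ H → residue c m ≡ residue d m → c modℕ V 1 0 0 m ≡ d modℕ V 1 0 0 m
    residues⁻ m m≤H = subst (λ P → c modℕ P ≡ d modℕ P) (sym (places tb m≤H))

  -- Choice of a digit

  clearCounts-spec : ∀ {k V} → k < B → WP clearCounts (0 ∷ k ∷ []) V
    (λ _ V′ t → (∀ d → d < k → V′ 4 0 0 d ≡ 0) × SameExcept 4 V V′ × t ≤ k)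
  clearCounts-spec {k} {V} k<B = while-rule
    (λ m e V′ t → ∃[ q ] e ≡ q ∷ k ∷ [] × q + m ≡ k × t ≡ q ×
       (∀ d → d < q → V′ 4 0 0 d ≡ 0) × SameExcept 4 V V′)
    (λ { (_ , refl , _) → _ })
    (λ { (q , refl , qm , refl , cleared , frame) z →
         (λ d d<k → cleared d (<-≤-trans d<k (less≡0 z))) , frame , subst (q ≤_) qm (m≤m+n q _) })
    (λ { {zero} (q , refl , qm , _) nz → exhausted qm (less≢0 nz)
       ; {suc m} {V = V′} (q , refl , qm , refl , cleared , frame) nz → m , refl ,
           ((_ , _ , _ , <-trans (less≢0 nz) k<B) , _) ,
           (_ , _ , suc-small (less≢0 nz) (<⇒≤ k<B)) ,
           q + 1 , refl , trans (+-assoc q 1 m) qm , refl , clear V′ q cleared ,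
           SameExcept-trans frame (write-except V′ 4 0 0 q 0) })
    (0 , refl , refl , refl , (λ _ ()) , (λ _ _ → refl))
    where
    clear : ∀ V′ q → (∀ d → d < q → V′ 4 0 0 d ≡ 0) →
            ∀ d → d < q + 1 → write V′ 4 0 0 q 0 4 0 0 d ≡ 0
    clear V′ q cleared d d<q with q ≟ d
    ... | yes refl = hit₂ {a = 0} {q}
    ... | no q≢d = trans (miss₂ {a = 0} {q} {0} (inj₂ q≢d))
      (cleared d (≤∧≢⇒< (≤-pred (≤-trans d<q (≤-reflexive (+-comm q 1)))) (q≢d ∘ sym)))

  leastDigit-spec : ∀ {k V} → 1 ≤ k → k < B → WP leastDigit (0 ∷ k ∷ 0 ∷ []) V
    (λ e V′ t → head e < k × (∀ d → d < k → V 4 0 0 (head e) ≤ V 4 0 0 d) × V′ ≡ V × t ≤ k)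
  leastDigit-spec {k} {V} 1≤k k<B = while-rule
    (λ m e V′ t → ∃[ b ] ∃[ q ] e ≡ b ∷ k ∷ q ∷ [] × V′ ≡ V × q + m ≡ k × t ≡ q × b < k ×
       (∀ d → d < q → V 4 0 0 b ≤ V 4 0 0 d))
    (λ { (_ , _ , refl , _) → _ })
    (λ { (b , q , refl , refl , qm , refl , b<k , best) z →
         b<k , (λ d d<k → best d (<-≤-trans d<k (less≡0 z))) , refl , subst (q ≤_) qm (m≤m+n q _) })
    (λ { {zero} (b , q , refl , refl , qm , _) nz →
           exhausted qm (less≢0 nz)
       ; {suc m} (b , q , refl , refl , qm , refl , b<k , best) nz → m , refl ,
           let q<k = less≢0 nz
               next-safe = _ , _ , suc-small q<k (<⇒≤ k<B)
               qm′ = trans (+-assoc q 1 m) qm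
           in ((_ , _ , _ , <-trans q<k k<B) , (_ , _ , _ , <-trans b<k k<B) , _) ,
           (λ c → _ , next-safe ,
              q , q + 1 , refl , refl , qm′ , refl , q<k , improved (less≢0 c) best) ,
           (λ c → next-safe , b , q + 1 , refl , refl , qm′ , refl , b<k , kept (less≡0 c) best) })
    (0 , 0 , refl , refl , refl , refl , 1≤k , λ _ ())
    where
    kept : ∀ {b q} → V 4 0 0 b ≤ V 4 0 0 q → (∀ d → d < q → V 4 0 0 b ≤ V 4 0 0 d) →
           ∀ d → d < q + 1 → V 4 0 0 b ≤ V 4 0 0 d
    kept {b} {q} le best d d<q with m≤n⇒m<n∨m≡n (≤-pred (≤-trans d<q (≤-reflexive (+-comm q 1))))
    ... | inj₁ d<q′ = best d d<q′
    ... | inj₂ refl = le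
    improved : ∀ {b q} → V 4 0 0 q < V 4 0 0 b → (∀ d → d < q → V 4 0 0 b ≤ V 4 0 0 d) →
               ∀ d → d < q + 1 → V 4 0 0 q ≤ V 4 0 0 d
    improved q<b best = kept ≤-refl (λ d d<q → ≤-trans (<⇒≤ q<b) (best d d<q))

  seenColor : Mem → ℕ → ℕ
  seenColor V q = col V (seen V q)

  matching : Mem → ℕ → ℕ → ℕ → ℕ
  matching V x j b = count x (λ q → residue (seenColor V q) j ≡ᵇ b)

  -- The sum of the counts is what averaging needs: a neighbor that agrees with `b` so far is
  -- counted under exactly one digit, since its residue modulo `place (suc j)` is uniquely
  -- `b + d * place j`.
  countDigits-spec : ∀ {x b j V} → x ≤ n → (∀ q → q < x → seen V q < n) → b < place j →
    (∀ d → d < radix j → V 4 0 0 d ≡ 0) →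
    WP countDigits (0 ∷ x ∷ b ∷ place j ∷ place (suc j) ∷ 0 ∷ 0 ∷ []) V
    (λ _ V′ t → (∀ d → d < radix j → V′ 4 0 0 d ≡ matching V x (suc j) (b + d * place j)) ×
                sum (radix j) (V′ 4 0 0) ≡ matching V x j b ×
                SameExcept 4 V V′ × t ≤ x)
  countDigits-spec {x} {b} {j} {V} x≤n seen<n b<p cleared = while-rule
    (λ m e V′ t → ∃[ q ] ∃[ r ] ∃[ y ]
       e ≡ q ∷ x ∷ b ∷ p ∷ p′ ∷ r ∷ y ∷ [] × q + m ≡ x × t ≡ q × Counted q V′)
    (λ { (_ , _ , _ , refl , _) → _ })
    (λ { (q , _ , _ , refl , qm , refl , cnt) z →
         let q≡x = ≤-antisym (subst (q ≤_) qm (m≤m+n q _)) (less≡0 z)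
         in (λ d d<k → trans (counts cnt d d<k) (cong (λ q → matching V q (suc j) _) q≡x)) ,
            trans (total cnt) (cong (λ q → matching V q j b) q≡x) ,
            frame cnt , ≤-reflexive q≡x })
    (λ { {zero} (q , _ , _ , refl , qm , _) nz →
           exhausted qm (less≢0 nz)
       ; {suc m} {V = V′} (q , _ , _ , refl , qm , refl , cnt) nz → m , refl ,
           let q<x = less≢0 nz
               qm′ = trans (+-assoc q 1 m) qm
               next-safe = _ , _ , suc-small q<x (≤-trans x≤n (<⇒≤ n<B))
           in (_ , _ , _ , <-trans (<-≤-trans q<x x≤n) n<B) ,
              (((_ , _ , _ , <-trans (neighbor<n q<x cnt) n<B)) , _ , _) ,
              _ ,
              (λ c → _ , ((_ , _ , _ , digit<B cnt) , (_ , _ , _ , digit<B cnt) , _ , count-safe q<x cnt c) ,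
                next-safe , q + 1 , _ , _ , refl , qm′ , refl , hit-case q<x cnt (same≢0 c)) ,
              (λ c → next-safe , q + 1 , _ , _ , refl , qm′ , refl , miss-case q<x cnt (same≡0 c)) })
    (0 , 0 , 0 , refl , refl , refl , record
      { counts = cleared
      ; total  = trans (sum-cong (radix j) {g = λ _ → 0} cleared)
                       (trans (sum-const (radix j) 0) (*-zeroʳ (radix j)))
      ; frame  = λ _ _ → refl })
    where
    p = place j
    p′ = place (suc j)
    instance
      p≢0 : NonZero p
      p≢0 = place≢0 j
    record Counted (q : ℕ) (V′ : Mem) : Set where
      field
        counts : ∀ d → d < radix j → V′ 4 0 0 d ≡ matching V q (suc j) (b + d * p)
        total  : sum (radix j) (V′ 4 0 0) ≡ matching V q j b
        frame  : SameExcept 4 V V′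
    open Counted

    current : Mem → ℕ → ℕ
    current V′ q = V′ 0 0 0 (V′ 3 0 0 q) modℕ p′

    neighbor<n : ∀ {q V′} → q < x → Counted q V′ → V′ 3 0 0 q < n
    neighbor<n {q} q<x cnt = subst (λ f → f 0 0 q < n) (sym (frame cnt 3 λ ())) (seen<n q q<x)

    current-≡ : ∀ {q V′} → Counted q V′ → current V′ q ≡ residue (seenColor V q) (suc j)
    current-≡ {q} cnt = cong₂ (λ f g → f 0 0 (g 0 0 q) modℕ p′) (frame cnt 0 λ ()) (frame cnt 3 λ ())

    digit<radix : ∀ {q V′} → Counted q V′ → current V′ q divℕ p < radix j
    digit<radix {q} {V′} cnt = subst (_< radix j) (sym (divℕ≡/ (current V′ q) p))
      (m<n*o⇒m/o<n (subst (_< p′) (sym (current-≡ cnt)) (residue-< (seenColor V q) (suc j))))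

    digit<B : ∀ {q V′} → Counted q V′ → current V′ q divℕ p < B
    digit<B cnt = <-≤-trans (digit<radix cnt) (≤-trans (radix≤Δ j) (s≤s (m≤n⇒m≤1+n (m≤n+m Δ n))))

    count-safe : ∀ {q V′} → q < x → Counted q V′ → bit (current V′ q modℕ p ≡ᵇ b) ≢ 0 →
                 V′ 4 0 0 (current V′ q divℕ p) + 1 < W
    count-safe {q} q<x cnt _ = small (≤-trans
      (+-monoˡ-≤ 1 (≤-trans (≤-reflexive (counts cnt _ (digit<radix cnt))) (count-≤ q _)))
      (≤-trans (≤-reflexive (+-comm q 1)) (≤-trans q<x (≤-trans x≤n (<⇒≤ n<B)))))

    low-residue : ∀ {q V′} → Counted q V′ → current V′ q modℕ p ≡ residue (seenColor V q) j
    low-residue {q} cnt = trans (cong (_modℕ p) (current-≡ cnt)) (residue-nest (seenColor V q) (n≤1+n j))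

    hit-case : ∀ {q V′} → q < x → Counted q V′ → current V′ q modℕ p ≡ b →
               let d₀ = current V′ q divℕ p in
               Counted (q + 1) (write V′ 4 0 0 d₀ (V′ 4 0 0 d₀ + 1))
    hit-case {q} {V′} q<x cnt r%p≡b = subst (λ z → Counted z V″) (+-comm 1 q) (record
      { counts = counts″
      ; total  = total″
      ; frame  = SameExcept-trans (frame cnt) (write-except V′ 4 0 0 d₀ _) })
      where
      d₀ = current V′ q divℕ p
      V″ = write V′ 4 0 0 d₀ (V′ 4 0 0 d₀ + 1)
      decomposed : residue (seenColor V q) (suc j) ≡ b + d₀ * p
      decomposed = trans (sym (current-≡ cnt)) (trans (m≡m%n+[m/n]*n (current V′ q) p)
        (cong₂ (λ u v → u + v * p) (trans (sym (modℕ≡% (current V′ q) p)) r%p≡b) (sym (divℕ≡/ (current V′ q) p))))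
      counts″ : ∀ d → d < radix j → V″ 4 0 0 d ≡ matching V (suc q) (suc j) (b + d * p)
      counts″ d d<k with d ≟ d₀
      ... | yes refl = trans (hit₂ {a = 0} {d}) (cong₂ _+_ (counts cnt d d<k)
        (sym (cong bit (trans (cong (_≡ᵇ b + d * p) decomposed) (≡ᵇ-refl (b + d * p))))))
      ... | no d≢d₀ = trans (miss₂ {a = 0} {d₀} {0} (inj₂ (d≢d₀ ∘ sym))) (trans (counts cnt d d<k)
        (sym (trans (cong (λ z → matching V q (suc j) (b + d * p) + bit z) (≡ᵇ-≢ λ e →
          d≢d₀ (*-cancelʳ-≡ d d₀ p (+-cancelˡ-≡ b _ _ (trans (sym e) decomposed)))))
          (+-identityʳ _))))
      total″ : sum (radix j) (V″ 4 0 0) ≡ matching V (suc q) j b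
      total″ = +-cancelʳ-≡ (V′ 4 0 0 d₀) _ _ (begin
        sum (radix j) (V″ 4 0 0) + V′ 4 0 0 d₀
          ≡⟨ sum-change (digit<radix cnt) (λ d _ d≢d₀ → miss₂ {a = 0} {d₀} {0} (inj₂ (d≢d₀ ∘ sym))) ⟩
        sum (radix j) (V′ 4 0 0) + V″ 4 0 0 d₀
          ≡⟨ cong₂ _+_ (total cnt) (trans (hit₂ {a = 0} {d₀}) (+-comm _ 1)) ⟩
        matching V q j b + (1 + V′ 4 0 0 d₀)
          ≡⟨ sym (+-assoc (matching V q j b) 1 _) ⟩
        matching V q j b + 1 + V′ 4 0 0 d₀
          ≡⟨ cong (λ z → matching V q j b + bit z + V′ 4 0 0 d₀)
               (sym (trans (cong (_≡ᵇ b) (trans (sym (low-residue cnt)) r%p≡b)) (≡ᵇ-refl b))) ⟩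
        matching V (suc q) j b + V′ 4 0 0 d₀ ∎)
        where open ≡-Reasoning

    miss-case : ∀ {q V′} → q < x → Counted q V′ → current V′ q modℕ p ≢ b → Counted (q + 1) V′
    miss-case {q} {V′} q<x cnt r%p≢b = subst (λ z → Counted z V′) (+-comm 1 q) (record
      { counts = λ d d<k → trans (counts cnt d d<k) (sym (trans
          (cong (λ z → matching V q (suc j) (b + d * p) + bit z) (≡ᵇ-≢ (other d))) (+-identityʳ _)))
      ; total  = trans (total cnt) (sym (trans
          (cong (λ z → matching V q j b + bit z) (≡ᵇ-≢ (r%p≢b ∘ trans (low-residue cnt)))) (+-identityʳ _)))
      ; frame  = frame cnt })
      where
      other : ∀ d → residue (seenColor V q) (suc j) ≢ b + d * p
      other d e = r%p≢b (trans (modℕ≡% (current V′ q) p)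
        (proj₁ (digit-unique {d = d} b<p (trans (current-≡ cnt) e))))

  matching-cong : ∀ V V′ x j b → V′ 0 ≡ V 0 → V′ 3 ≡ V 3 → matching V′ x j b ≡ matching V x j b
  matching-cong V V′ x j b p q =
    cong₂ (λ f g → count x (λ i → residue (f 0 0 (g 0 0 i)) j ≡ᵇ b)) p q

  place<W : ∀ {j} → j ≤ H → place j < W
  place<W j≤H = ≤-<-trans (≤-trans (place≤ j≤H) (≤-trans place-H≤ (begin
    suc Δ * (suc Δ * suc Δ) ≤⟨ *-mono-≤ Δ≤ (*-mono-≤ Δ≤ Δ≤) ⟩
    B * (B * B)             ≡⟨ sym (*-assoc B B B) ⟩
    B * B * B               ∎))) (B³<W (s≤s z≤n))
    where
    open ≤-Reasoning
    Δ≤ : suc Δ ≤ B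
    Δ≤ = s≤s (m≤n⇒m≤1+n (m≤n+m Δ n))

  radix<B : ∀ j → radix j < B
  radix<B j = s≤s (≤-trans (radix≤Δ j) (s≤s (m≤n+m Δ n)))

  record Refined (x b j : ℕ) (V : Mem) (b′ : ℕ) (V′ : Mem) (t : ℕ) : Set where
    field
      bound   : b′ < place (suc j)
      extends : residue b′ j ≡ b
      fewer   : radix j * matching V x (suc j) b′ ≤ matching V x j b
      frame   : SameExcept 4 V V′
      ticks   : t ≤ 2 * suc A + x

  -- The least count times the number of digits is at most the sum of all counts, which gives
  -- `fewer`. The ticks are one pass over the neighbors and two over the digits.
  pickDigit-spec : ∀ {x b j V} → Tables V → j < H → x ≤ n → (∀ q → q < x → seen V q < n) →
    b < place j →
    WP pickDigit (b ∷ j ∷ x ∷ 0 ∷ 0 ∷ 0 ∷ 0 ∷ 0 ∷ []) V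
      (λ e′ V′ t → Refined x b j V (head e′) V′ t)
  pickDigit-spec {x} {b} {j} {V} tb j<H x≤n seen<n b<p = wp⇒WP pickDigit
    ( (_ , _ , suc-small j<H (<⇒≤ H<B))
    , (_ , _ , _ , <-trans j<H H<B)
    , (_ , _ , _ , subst (_< B) (+-comm 1 j) (≤-<-trans j<H H<B))
    , _
    , _ , WP-args (cong (λ k → 0 ∷ k ∷ []) k≡)
            (WP-map (λ {e₁} {V₁} {t₁} (zeros , f₁ , t₁≤) →
      _ , WP-args (cong₂ (λ p p′ → 0 ∷ x ∷ b ∷ p ∷ p′ ∷ 0 ∷ 0 ∷ []) (sym p≡) (sym p′≡))
            (WP-map (λ {e₂} {V₂} {t₂} (counts , total , f₂ , t₂≤) →
      _ , WP-args (cong (λ k → 0 ∷ k ∷ 0 ∷ []) k≡)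
            (WP-map (λ {e₃} {V₃} {t₃} (m<k , best , V₃≡ , t₃≤) →
      finish f₁ t₁≤ counts total f₂ t₂≤ m<k best V₃≡ t₃≤)
            (leastDigit-spec {V = V₂} (>-nonZero⁻¹ (radix j) {{radix≢0 j}}) (radix<B j))))
            (countDigits-spec {V = V₁} x≤n
              (λ q q<x → subst (λ f → f 0 0 q < n) (sym (f₁ 3 λ ())) (seen<n q q<x)) b<p zeros)))
            (clearCounts-spec {V = V} (radix<B j))))
    where
    p≡ : V 1 0 0 j ≡ place j
    p≡ = places tb (<⇒≤ j<H)
    p′≡ : V 1 0 0 (j + 1) ≡ place (suc j)
    p′≡ = trans (cong (V 1 0 0) (+-comm j 1)) (places tb j<H)
    instance
      p≢0 : NonZero (place j)
      p≢0 = place≢0 j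
    k≡ : radix j ≡ V 1 0 0 (j + 1) divℕ V 1 0 0 j
    k≡ = sym (trans (cong₂ _divℕ_ p′≡ p≡) (trans (divℕ≡/ (place (suc j)) (place j))
           (m*n/n≡m (radix j) (place j))))
    finish : ∀ {V₁ V₂ V₃ t₁ t₂ t₃ m} →
      SameExcept 4 V V₁ → t₁ ≤ radix j →
      (∀ d → d < radix j → V₂ 4 0 0 d ≡ matching V₁ x (suc j) (b + d * place j)) →
      sum (radix j) (V₂ 4 0 0) ≡ matching V₁ x j b →
      SameExcept 4 V₁ V₂ → t₂ ≤ x → m < radix j →
      (∀ d → d < radix j → V₂ 4 0 0 m ≤ V₂ 4 0 0 d) → V₃ ≡ V₂ → t₃ ≤ radix j →
      (⊤ × (⊤ × ⊤ × m * V 1 0 0 j < W) × b + m * V 1 0 0 j < W) ×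
      Refined x b j V (b + m * V 1 0 0 j) V₃ (t₁ + (t₂ + (t₃ + 0)))
    finish {V₁} {V₂} {V₃} {t₁} {t₂} {t₃} {m} f₁ t₁≤ counts total f₂ t₂≤ m<k best refl t₃≤ =
      subst (λ p → (⊤ × (⊤ × ⊤ × m * p < W) × b + m * p < W) ×
                   Refined x b j V (b + m * p) V₃ (t₁ + (t₂ + (t₃ + 0)))) (sym p≡)
        ( (_ , (_ , _ , ≤-<-trans (m≤n+m (m * place j) b) b′<W) , b′<W)
        , record
          { bound   = b′<
          ; extends = trans (modℕ≡% _ (place j)) (proj₁ (digit-unique {d = m} b<p refl))
          ; fewer   = begin
              radix j * matching V x (suc j) b′  ≡⟨ cong (radix j *_) (sym (matching-cong V V₁ x (suc j) b′ (f₁ 0 λ ()) (f₁ 3 λ ()))) ⟩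
              radix j * matching V₁ x (suc j) b′ ≡⟨ cong (radix j *_) (sym (counts m m<k)) ⟩
              radix j * V₂ 4 0 0 m               ≤⟨ sum-≥-const (radix j) best ⟩
              sum (radix j) (V₂ 4 0 0)           ≡⟨ total ⟩
              matching V₁ x j b                  ≡⟨ matching-cong V V₁ x j b (f₁ 0 λ ()) (f₁ 3 λ ()) ⟩
              matching V x j b                   ∎
          ; frame   = SameExcept-trans f₁ f₂
          ; ticks   = begin
              t₁ + (t₂ + (t₃ + 0))           ≤⟨ +-mono-≤ (≤-trans t₁≤ (radix≤A j))
                (+-mono-≤ t₂≤ (≤-trans (≤-reflexive (+-identityʳ t₃)) (≤-trans t₃≤ (radix≤A j)))) ⟩
              suc A + (x + suc A)            ≡⟨ rearrange (suc A) x ⟩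
              2 * suc A + x                  ∎ })
      where
      open ≤-Reasoning
      b′ = b + m * place j
      b′< : b′ < place (suc j)
      b′< = subst (_< place (suc j)) (+-comm (m * place j) b) (digit-< m<k b<p)
      b′<W = <-trans b′< (place<W j<H)
      rearrange : ∀ a x → a + (x + a) ≡ 2 * a + x
      rearrange = solve-∀

  -- Choice of a color

  record Chosen (x i b₀ : ℕ) (V : Mem) (b : ℕ) (V′ : Mem) (t : ℕ) : Set where
    field
      bound   : b < place H
      extends : residue b i ≡ b₀
      proper  : ∀ q → q < x → seenColor V q < place H → seenColor V q ≢ b
      -- The bracket on the right is the lower bound `heavy` for the old levels of the same
      -- neighbors, so `x` is the guaranteed gain in units of `1 / A`.
      cheap   : A * sum x (λ q → level H b (seenColor V q)) + x ≤
                A * (x * i + suc (threshold (suc i)))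
      frame   : SameExcept 4 V V′
      ticks   : t ≤ H * suc (2 * suc A + x)

  -- S is the sum over the levels after i and up to j of the number of neighbors
  -- sharing the new color up to that level.
  record Choosing (x i b₀ : ℕ) (V : Mem) (j b : ℕ) (V′ : Mem) (t : ℕ) : Set where
    field
      S       : ℕ
      above   : i ≤ j
      bound   : b < place j
      extends : residue b i ≡ b₀
      few     : matching V x j b ≤ threshold j
      charge  : suc s * S + matching V x j b ≤ x
      total   : sum x (λ q → level j b (seenColor V q)) ≤ x * i + S
      last    : suc i ≡ H → S ≡ 0
      frame   : SameExcept 4 V V′
      ticks   : t ≤ (j ∸ i) * suc (2 * suc A + x)

  pickColor-spec : ∀ {x i b₀ V} → Tables V → i < H → x ≤ n → x ≤ threshold i →
    (∀ q → q < x → seen V q < n) → (∀ q → q < x → residue (seenColor V q) i ≡ b₀) → b₀ < place i →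
    WP pickColor (b₀ ∷ i ∷ H ∷ x ∷ []) V (λ e′ V′ t → Chosen x i b₀ V (head e′) V′ t)
  pickColor-spec {x} {i} {b₀} {V} tb i<H x≤n x≤t seen<n residues b₀< = while-rule
    (λ m e V′ t → ∃[ j ] ∃[ b ] e ≡ b ∷ j ∷ H ∷ x ∷ [] × j + m ≡ H × Choosing x i b₀ V j b V′ t)
    (λ { (_ , _ , refl , _) → _ })
    (λ { {m} (j , b , refl , jm , ch) z →
         finish (≤-antisym (subst (j ≤_) jm (m≤m+n j m)) (less≡0 z)) ch })
    (λ { {zero} (j , b , refl , jm , ch) nz →
           exhausted jm (less≢0 nz)
       ; {suc m} {V = V′} {t} (j , b , refl , jm , ch) nz → m , refl , _ ,
           WP-map (λ {e₁} {V₁} {t₁} r →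
             (_ , _ , suc-small (less≢0 nz) (<⇒≤ H<B)) ,
             j + 1 , head e₁ , refl , trans (+-assoc j 1 m) jm ,
             subst₂ (λ j t → Choosing x i b₀ V j (head e₁) V₁ t) (+-comm 1 j)
               (cong (λ k → t + suc k) (sym (+-identityʳ t₁))) (advance (less≢0 nz) ch r))
             (pickDigit-spec (tables ch) (less≢0 nz) x≤n
               (λ q q<x → subst (λ f → f 0 0 q < n) (sym (frame ch 3 λ ())) (seen<n q q<x)) (bound ch)) })
    (i , b₀ , refl , m+[n∸m]≡n (<⇒≤ i<H) , record
      { S = 0 ; above = ≤-refl ; bound = b₀< ; extends = residue-small {j = i} b₀<
      ; few = ≤-trans (count-≤ x _) x≤t
      ; charge = ≤-trans (≤-reflexive (cong (_+ matching V x i b₀) (*-zeroʳ (suc s)))) (count-≤ x _)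
      ; total = ≤-trans (sum-≤-const x (λ q _ → level-≤ i b₀ (seenColor V q))) (m≤m+n (x * i) 0)
      ; last = λ _ → refl ; frame = λ _ _ → refl ; ticks = z≤n })
    where
    open Choosing
    tables : ∀ {j b V′ t} → Choosing x i b₀ V j b V′ t → Tables V′
    tables ch = record
      { places = λ {j} p → trans (cong (λ f → f 0 0 j) (frame ch 1 λ ())) (places tb p)
      ; thresholds = λ {j} p → trans (cong (λ f → f 0 0 j) (frame ch 2 λ ())) (thresholds tb p) }

    advance : ∀ {j b V′ t b′ V₁ t₁} → j < H → Choosing x i b₀ V j b V′ t →
              Refined x b j V′ b′ V₁ t₁ → Choosing x i b₀ V (suc j) b′ V₁ (t + suc t₁)
    advance {j} {b} {V′} {t} {b′} {V₁} {t₁} j<H ch r = record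
      { S       = S ch + n′
      ; above   = m≤n⇒m≤1+n (above ch)
      ; bound   = Refined.bound r
      ; extends = trans (sym (residue-nest b′ (above ch)))
                    (trans (cong (λ c → residue c i) (Refined.extends r)) (extends ch))
      ; few     = proj₁ shrunk
      -- The next level adds `n′` to `S` and leaves `n′` as the current count: together
      -- `(s + 1) n′ + n′ = (s + 2) n′`, at most the previous count.
      ; charge  = begin
          suc s * (S ch + n′) + n′          ≡⟨ split s (S ch) n′ ⟩
          suc s * S ch + (2 + s) * n′       ≤⟨ +-monoʳ-≤ (suc s * S ch) (proj₂ shrunk) ⟩
          suc s * S ch + matching V x j b   ≤⟨ charge ch ⟩
          x                                 ∎
      ; total   = begin
          sum x (λ q → level (suc j) b′ (seenColor V q))
            ≤⟨ sum-mono x (λ q _ → level-suc j b′ (seenColor V q)) ⟩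
          sum x (λ q → level j b′ (seenColor V q) +
                       bit (residue (seenColor V q) (suc j) ≡ᵇ residue b′ (suc j)))
            ≡⟨ sum-+ x _ _ ⟩
          sum x (λ q → level j b′ (seenColor V q)) + matching V x (suc j) (residue b′ (suc j))
            ≡⟨ cong₂ _+_ (sum-cong x (λ q _ → level-cong j (seenColor V q) same-residue))
                 (cong (matching V x (suc j)) (residue-small (Refined.bound r))) ⟩
          sum x (λ q → level j b (seenColor V q)) + n′
            ≤⟨ +-monoˡ-≤ n′ (total ch) ⟩
          x * i + S ch + n′      ≡⟨ +-assoc (x * i) (S ch) n′ ⟩
          x * i + (S ch + n′)    ∎
      ; last    = λ i+1≡H → cong₂ _+_ (last ch i+1≡H) (n′≡0 i+1≡H)
      ; frame   = SameExcept-trans (frame ch) (Refined.frame r)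
      ; ticks   = begin
          t + suc t₁              ≤⟨ +-mono-≤ (ticks ch) (s≤s (Refined.ticks r)) ⟩
          (j ∸ i) * c + c         ≡⟨ +-comm ((j ∸ i) * c) c ⟩
          suc (j ∸ i) * c         ≡⟨ cong (_* c) (sym (+-∸-assoc 1 (above ch))) ⟩
          (suc j ∸ i) * c         ∎ }
      where
      open ≤-Reasoning
      c = suc (2 * suc A + x)
      n′ = matching V x (suc j) b′
      split : ∀ s S n → suc s * (S + n) + n ≡ suc s * S + (2 + s) * n
      split = solve-∀
      fewer′ : radix j * n′ ≤ matching V x j b
      fewer′ = subst₂ (λ u v → radix j * u ≤ v)
        (matching-cong V V′ x (suc j) b′ (frame ch 0 λ ()) (frame ch 3 λ ()))
        (matching-cong V V′ x j b (frame ch 0 λ ()) (frame ch 3 λ ())) (Refined.fewer r)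
      shrunk = shrink {n = matching V x j b} {n′} j<H (few ch) fewer′
      same-residue : residue b′ j ≡ residue b j
      same-residue = trans (Refined.extends r) (sym (residue-small {j = j} (bound ch)))
      -- If only one digit is to be chosen, `suc j` is `H`, where the threshold is 0.
      n′≡0 : suc i ≡ H → n′ ≡ 0
      n′≡0 p = n≤0⇒n≡0 (≤-trans (proj₁ shrunk) (≤-reflexive (trans
        (cong threshold (≤-antisym j<H (subst (_≤ suc j) p (s≤s (above ch))))) threshold-H)))

    finish : ∀ {j b V′ t} → j ≡ H → Choosing x i b₀ V j b V′ t → Chosen x i b₀ V b V′ t
    finish {b = b} {V′} {t} refl ch = record
      { bound = bound ch ; extends = extends ch ; frame = frame ch
      -- A neighbor of the chosen color would be counted at level `H`, where `few` allows none.
      ; proper = λ q q<x c< c≡b → n≮0 (begin-strict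
          0 <⟨ s≤s z≤n ⟩
          1 ≡⟨ cong bit (sym (trans (cong (_≡ᵇ b) (trans (residue-small c<) c≡b)) (≡ᵇ-refl b))) ⟩
          bit (residue (seenColor V q) H ≡ᵇ b)
            ≤⟨ term≤sum (λ q → bit (residue (seenColor V q) H ≡ᵇ b)) q<x ⟩
          matching V x H b ≤⟨ few ch ⟩
          threshold H      ≡⟨ threshold-H ⟩
          0                ∎)
      ; cheap = begin
          A * sum x (λ q → level H b (seenColor V q)) + x ≤⟨ +-monoˡ-≤ x (*-monoʳ-≤ A (total ch)) ⟩
          A * (x * i + S ch) + x           ≡⟨ cong (_+ x) (*-distribˡ-+ A (x * i) (S ch)) ⟩
          A * (x * i) + A * S ch + x       ≡⟨ +-assoc (A * (x * i)) (A * S ch) x ⟩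
          A * (x * i) + (A * S ch + x)     ≤⟨ +-monoʳ-≤ (A * (x * i))
              (gain i<H x≤t (≤-trans (m≤m+n _ _) (charge ch)) (last ch)) ⟩
          A * (x * i) + A * suc (threshold (suc i)) ≡⟨ sym (*-distribˡ-+ A (x * i) _) ⟩
          A * (x * i + suc (threshold (suc i))) ∎
      ; ticks = ≤-trans (ticks ch) (*-monoˡ-≤ (suc (2 * suc A + x)) (m∸n≤m H i)) }
      where open ≤-Reasoning

  -- Gathering the neighbors of high level

  gatherBucket-spec : ∀ {x u i V} → Buckets V → u < n → i ≤ H → x + len V u i ≤ n →
    WP gatherBucket (x ∷ u ∷ i ∷ 0 ∷ []) V
      (λ e V′ t → head e ≡ x + len V u i × SameExcept 3 V V′ ×
                  (∀ q → q < x → seen V′ q ≡ seen V q) ×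
                  (∀ q → q < len V u i → seen V′ (x + q) ≡ ent V u i (suc q)) ×
                  t ≡ len V u i)
  gatherBucket-spec {x} {u} {i} {V} bk u<n i≤H x+l≤n = while-rule
    (λ m e V′ t → ∃[ q ] e ≡ (x + q) ∷ u ∷ i ∷ q ∷ [] × q + m ≡ l × t ≡ q × Copied q V′)
    (λ { (_ , refl , _) → _ , (_ , _ , u<B , i<B) , _ })
    (λ { {V = V′} (q , refl , qm , refl , c) z →
         let q≡l = ≤-antisym (subst (q ≤_) qm (m≤m+n q _)) (subst (_≤ q) (same-len c) (less≡0 z))
         in cong (x +_) q≡l , frame c , prefix c ,
            (λ r r<l → copied c r (subst (r <_) (sym q≡l) r<l)) , q≡l })
    (λ { {zero} {V = V′} (q , refl , qm , _ , c) nz →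
           exhausted qm (subst (q <_) (same-len c) (less≢0 nz))
       ; {suc m} {V = V′} (q , refl , qm , refl , c) nz → m , refl ,
           let q<l = subst (q <_) (same-len c) (less≢0 nz)
               x+q<n = <-≤-trans (+-monoʳ-< x q<l) x+l≤n
           in (_ , _ , small (<⇒≤ (q+1<B q<l))) ,
              ((_ , _ , _ , <-trans x+q<n n<B) , (_ , u<B , i<B , q+1<B q<l)) ,
              (_ , _ , small (≤-trans (≤-reflexive (+-comm (x + q) 1)) (≤-trans x+q<n (<⇒≤ n<B)))) ,
              q + 1 , cong (λ k → k ∷ u ∷ i ∷ (q + 1) ∷ []) (+-assoc x q 1) ,
              trans (+-assoc q 1 m) qm , refl , copy-next q<l c })
    (0 , cong (λ k → k ∷ u ∷ i ∷ 0 ∷ []) (sym (+-identityʳ x)) , refl , refl ,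
     record { frame = λ _ _ → refl ; prefix = λ _ _ → refl ; copied = λ _ () })
    where
    l = len V u i
    u<B = <-trans u<n n<B
    i<B = ≤-<-trans i≤H H<B
    q+1<B : ∀ {q} → q < l → q + 1 < B
    q+1<B {q} q<l = ≤-<-trans (≤-trans (≤-reflexive (+-comm q 1))
      (≤-trans q<l (≤-trans (m≤n+m l x) x+l≤n))) n<B
    record Copied (q : ℕ) (V′ : Mem) : Set where
      field
        frame  : SameExcept 3 V V′
        prefix : ∀ r → r < x → seen V′ r ≡ seen V r
        copied : ∀ r → r < q → seen V′ (x + r) ≡ ent V u i (suc r)
    open Copied
    same-len : ∀ {q V′} → Copied q V′ → len V′ u i ≡ l
    same-len c = cong (λ f → f 0 u i) (frame c 5 λ ())
    copy-next : ∀ {q V′} → q < l → Copied q V′ →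
                Copied (q + 1) (write V′ 3 0 0 (x + q) (ent V′ u i (q + 1)))
    copy-next {q} {V′} q<l c = record
      { frame  = SameExcept-trans (frame c) (write-except V′ 3 0 0 (x + q) _)
      ; prefix = λ r r<x → trans (miss₂ {a = 0} {x + q} {0}
          (inj₂ (λ e → <⇒≢ (<-≤-trans r<x (m≤m+n x q)) (sym e)))) (prefix c r r<x)
      ; copied = new }
      where
      new : ∀ r → r < q + 1 → write V′ 3 0 0 (x + q) (ent V′ u i (q + 1)) 3 0 0 (x + r) ≡ ent V u i (suc r)
      new r r<q with m≤n⇒m<n∨m≡n (≤-pred (≤-trans r<q (≤-reflexive (+-comm q 1))))
      ... | inj₂ refl = trans (hit₂ {a = 0} {x + r})
        (trans (cong (λ f → f u i (r + 1)) (frame c 8 λ ())) (cong (ent V u i) (+-comm r 1)))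
      ... | inj₁ r<q′ = trans (miss₂ {a = 0} {x + q} {0}
        (inj₂ (λ e → <⇒≢ r<q′ (sym (+-cancelˡ-≡ x q r e))))) (copied c r r<q′)

  -- `Y` lists the neighbors of `u` of level at least `i`, each once. `heavy` records why the walk
  -- went below `suc i`: more than `threshold (suc i)` of them have level at least `suc i` and
  -- contribute one more than `i`. For `i = H` there is no such preceding test.
  record Gathered (u i x : ℕ) (V : Mem) (Y : ℕ → ℕ) : Set where
    field
      valid    : ∀ q → q < x → Y q < n × pos V u (Y q) ≢ 0 × i ≤ lev V u (Y q)
      distinct : ∀ q r → q < x → r < x → Y q ≡ Y r → q ≡ r
      complete : ∀ {y} → y < n → pos V u y ≢ 0 → i ≤ lev V u y → ∃[ q ] q < x × Y q ≡ y
      heavy    : i < H → x * i + suc (threshold (suc i)) ≤ sum x (λ q → lev V u (Y q))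

  -- No level exceeds `H`, so the walk may be thought to start above it; the bucket at `H` is then
  -- an ordinary instance of `gather-more`.
  gather-none : ∀ {u V Y} → Buckets V → u < n → Gathered u (suc H) 0 V Y
  gather-none bk u<n = record
    { valid    = λ _ ()
    ; distinct = λ _ _ ()
    ; complete = λ y<n uy≢0 H<lev → contradiction H<lev (≤⇒≯ (proj₁ (slot bk u<n y<n uy≢0)))
    ; heavy    = λ p → contradiction (n≤1+n H) (<⇒≱ p) }

  gather-more : ∀ {u i x V Y Y′} → Buckets V → u < n → (i < H → threshold (suc i) < x) →
    Gathered u (suc i) x V Y → (∀ q → q < x → Y′ q ≡ Y q) →
    (∀ q → q < len V u i → Y′ (x + q) ≡ ent V u i (suc q)) →
    Gathered u i (x + len V u i) V Y′
  gather-more {u} {i} {x} {V} {Y} {Y′} bk u<n over g old new = record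
    { valid = λ q q< → valid′ q (split q q<) ; distinct = λ q r q< r< → distinct′ (split q q<) (split r r<)
    ; complete = complete′ ; heavy = heavy′ }
    where
    open Gathered g
    l = len V u i
    split : ∀ q → q < x + l → q < x ⊎ ∃[ r ] r < l × x + r ≡ q
    split q q< with q <? x
    ... | yes q<x = inj₁ q<x
    ... | no q≮x = inj₂ (q ∸ x , +-cancelˡ-< x (q ∸ x) l (subst (_< x + l) (sym q≡) q<) , q≡)
      where q≡ = m+[n∸m]≡n (≮⇒≥ q≮x)
    new-entry : ∀ r → r < l → Y′ (x + r) < n × lev V u (Y′ (x + r)) ≡ i × pos V u (Y′ (x + r)) ≡ suc r
    new-entry r r<l = subst (λ y → y < n × lev V u y ≡ i × pos V u y ≡ suc r) (sym (new r r<l))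
      (entry bk u<n (s≤s z≤n) r<l)
    valid′ : ∀ q → q < x ⊎ (∃[ r ] r < l × x + r ≡ q) → Y′ q < n × pos V u (Y′ q) ≢ 0 × i ≤ lev V u (Y′ q)
    valid′ q (inj₁ q<x) rewrite old q q<x with valid q q<x
    ... | p , p′ , p″ = p , p′ , <⇒≤ p″
    valid′ q (inj₂ (r , r<l , refl)) with new-entry r r<l
    ... | p , p′ , p″ = p , (λ z → case trans (sym p″) z of λ ()) , ≤-reflexive (sym p′)
    mixed : ∀ {q r} → q < x → r < l → Y′ q ≢ Y′ (x + r)
    mixed {q} {r} q<x r<l e = <⇒≢ (proj₂ (proj₂ (valid q q<x)))
      (sym (trans (cong (lev V u) (trans (sym (old q q<x)) e)) (proj₁ (proj₂ (new-entry r r<l)))))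
    distinct′ : ∀ {q r} → q < x ⊎ (∃[ k ] k < l × x + k ≡ q) → r < x ⊎ (∃[ k ] k < l × x + k ≡ r) →
                Y′ q ≡ Y′ r → q ≡ r
    distinct′ {q} {r} (inj₁ q<x) (inj₁ r<x) e =
      distinct q r q<x r<x (trans (sym (old q q<x)) (trans e (old r r<x)))
    distinct′ (inj₁ q<x) (inj₂ (k , k<l , refl)) e = contradiction e (mixed q<x k<l)
    distinct′ (inj₂ (k , k<l , refl)) (inj₁ r<x) e = contradiction (sym e) (mixed r<x k<l)
    distinct′ (inj₂ (k , k<l , refl)) (inj₂ (k′ , k′<l , refl)) e = cong (x +_) (suc-injective
      (trans (sym (proj₂ (proj₂ (new-entry k k<l)))) (trans (cong (pos V u) e) (proj₂ (proj₂ (new-entry k′ k′<l))))))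
    complete′ : ∀ {y} → y < n → pos V u y ≢ 0 → i ≤ lev V u y → ∃[ q ] q < x + l × Y′ q ≡ y
    complete′ {y} y<n uy≢0 i≤ with m≤n⇒m<n∨m≡n i≤
    ... | inj₁ i< with complete y<n uy≢0 i<
    ...   | q , q<x , e = q , <-≤-trans q<x (m≤m+n x l) , trans (old q q<x) e
    complete′ {y} y<n uy≢0 i≤ | inj₂ refl with pos V u y in pos≡ | slot bk u<n y<n uy≢0
    ...   | zero  | _ = contradiction pos≡ uy≢0
    ...   | suc r | _ , r<l , e = x + r , +-monoʳ-< x r<l , trans (new r r<l) e
    heavy′ : i < H → (x + l) * i + suc (threshold (suc i)) ≤ sum (x + l) (λ q → lev V u (Y′ q))
    heavy′ i<H = begin
      (x + l) * i + suc (threshold (suc i)) ≤⟨ +-monoʳ-≤ ((x + l) * i) (over i<H) ⟩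
      (x + l) * i + x                       ≡⟨ rearrange x l i ⟩
      x * suc i + l * i
        ≤⟨ +-mono-≤
             (sum-≥-const x (λ q q<x → ≤-trans (proj₂ (proj₂ (valid q q<x)))
               (≤-reflexive (cong (lev V u) (sym (old q q<x))))))
             (sum-≥-const l (λ q q<l → ≤-reflexive (sym (proj₁ (proj₂ (new-entry q q<l)))))) ⟩
      sum x (λ q → lev V u (Y′ q)) + sum l (λ q → lev V u (Y′ (x + q)))
        ≡⟨ sym (sum-append x l (λ q → lev V u (Y′ q))) ⟩
      sum (x + l) (λ q → lev V u (Y′ q)) ∎
      where
      open ≤-Reasoning
      rearrange : ∀ x l i → (x + l) * i + x ≡ x * suc i + l * i
      rearrange = solve-∀

  gathered-≤n : ∀ {u i x V Y} → Gathered u i x V Y → x ≤ n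
  gathered-≤n {Y = Y} g = fin-bound Y (λ q q<x → proj₁ (Gathered.valid g q q<x)) (Gathered.distinct g)

  -- The bound is needed before the bucket is copied, so `gather-more` is applied to the enumeration
  -- `Y′` that copying would produce.
  gather-room : ∀ {u i x V Y} → Buckets V → u < n → (i < H → threshold (suc i) < x) →
                Gathered u (suc i) x V Y → x + len V u i ≤ n
  gather-room {u} {i} {x} {V} {Y} bk u<n over g = gathered-≤n (gather-more {Y′ = Y′} bk u<n over g
    (λ q q<x → cong (λ b → if b then Y q else ent V u i (suc (q ∸ x))) (<ᵇ-true q<x))
    (λ q _ → trans (cong (λ b → if b then Y (x + q) else ent V u i (suc (x + q ∸ x))) (<ᵇ-false (m≤m+n x q)))
                   (cong (λ k → ent V u i (suc k)) (m+n∸m≡n x q))))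
    where
    Y′ : ℕ → ℕ
    Y′ q = if q <ᵇ x then Y q else ent V u i (suc (q ∸ x))

  -- Moving the gathered edges to new buckets

  Pair : ℕ → ℕ → ℕ → ℕ → Set
  Pair u y a c = (a ≡ u × c ≡ y) ⊎ (a ≡ y × c ≡ u)

  unequal : ∀ {a b c d : ℕ} → ¬ (a ≡ c × b ≡ d) → a ≢ c ⊎ b ≢ d
  unequal {a} {b} {c} {d} p with a ≟ c
  ... | no a≢c = inj₁ a≢c
  ... | yes refl = inj₂ (λ b≡d → p (refl , b≡d))

  record Shifted (x u p : ℕ) (g : ℕ → ℕ) (V V′ : Mem) : Set where
    field
      buckets : Buckets V′
      same-adjacency : ∀ {a c} → a < n → c < n → apart? V′ a c ≡ apart? V a c
      moved   : ∀ q → q < p → lev V′ u (seen V q) ≡ g q × lev V′ (seen V q) u ≡ g q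
      rest    : ∀ a c → (∀ q → q < p → ¬ Pair u (seen V q) a c) → lev V′ a c ≡ lev V a c
      low     : SameBelow 5 V V′
      -- The factor 2 arises because each edge lies in a bucket at both of its endpoints.
      paid    : potential V′ + 2 * sum p (λ q → lev V u (seen V q)) ≡ potential V + 2 * sum p g

  apart-≢0 : ∀ {V V′ a c} → apart? V′ a c ≡ apart? V a c → pos V a c ≢ 0 → pos V′ a c ≢ 0
  apart-≢0 {V} {V′} {a} {c} e p z = case trans (sym (≡ᵇ-≢ p)) (trans (sym e) (cong (_≡ᵇ 0) z)) of λ ()

  relocateAll-spec : ∀ {x u b z₅ z₆ z₇ V} → Buckets V → Tables V → u < n → x ≤ n →
    (∀ q → q < x → seen V q < n × seen V q ≢ u × pos V u (seen V q) ≢ 0 × pos V (seen V q) u ≢ 0 ×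
                   lev V (seen V q) u ≡ lev V u (seen V q)) →
    (∀ q r → q < x → r < x → seen V q ≡ seen V r → q ≡ r) →
    WP relocateAll (0 ∷ u ∷ H ∷ x ∷ b ∷ z₅ ∷ z₆ ∷ z₇ ∷ []) V
      (λ _ V′ t → Shifted x u x (λ q → level H b (seenColor V q)) V V′ × t ≤ x * suc H)
  relocateAll-spec {x} {u} {b} {V = V} bk tb u<n x≤n nbr distinct = while-rule
    (λ m e V′ t → ∃[ p ] ∃[ z₅ ] ∃[ z₆ ] ∃[ z₇ ]
       e ≡ p ∷ u ∷ H ∷ x ∷ b ∷ z₅ ∷ z₆ ∷ z₇ ∷ [] × p + m ≡ x × t ≤ p * suc H × Shifted x u p g V V′)
    (λ { (_ , _ , _ , _ , refl , _) → _ })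
    (λ { (p , _ , _ , _ , refl , pm , t≤ , sh) z →
         let p≡x = ≤-antisym (subst (p ≤_) pm (m≤m+n p _)) (less≡0 z)
         in subst (λ p → Shifted x u p g V _) p≡x sh , subst (λ p → _ ≤ p * suc H) p≡x t≤ })
    (λ { {zero} (p , _ , _ , _ , refl , pm , _) nz →
           exhausted pm (less≢0 nz)
       ; {suc m} {V = V′} {t} (p , _ , _ , _ , refl , pm , t≤ , sh) nz → m , refl ,
           let p<x = less≢0 nz
               y≡ = same-seen sh p
               y<n = subst (_< n) (sym y≡) (proj₁ (nbr p p<x))
           in (_ , _ , _ , <-trans (<-≤-trans p<x x≤n) n<B) , (_ , _ , _ , <-trans y<n n<B) , _ ,
           WP-map (λ { {e₀} {_} {t₀} (j≡ , refl , t₀≤) →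
             let j≡g = trans j≡ (cong (λ c → level H b c) (same-color sh p))
                 j≤H = subst (_≤ H) (sym j≡) (level-≤ H b (V′ 0 0 0 (V′ 3 0 0 p)))
                 uy≢0 = subst (λ y → pos V′ u y ≢ 0) (sym y≡) (u-adj sh p<x)
                 yu≢0 = subst (λ y → pos V′ y u ≢ 0) (sym y≡) (adj-u sh p<x)
             in _ , WP-map (λ { {_} {V₁} (r₁ , refl) →
                  _ , WP-map (λ { {_} {V₂} (r₂ , refl) →
                      (_ , _ , suc-small p<x (≤-trans x≤n (<⇒≤ n<B))) ,
                      p + 1 , _ , _ , _ , refl , trans (+-assoc p 1 m) pm , time-≤ p t t₀ t≤ t₀≤ ,
                      subst (λ p → Shifted x u p g V V₂) (+-comm 1 p) (advance p<x sh
                        (subst₂ (λ y j → Relocated u y j V′ V₁) y≡ j≡g r₁)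
                        (subst₂ (λ y j → Relocated y u j V₁ V₂) y≡ j≡g r₂)) })
                    (relocate-spec {V = V₁} y<n u<n j≤H (Relocated.buckets r₁)
                      (apart-≢0 {V′} {V₁} (Relocated.same-adjacency r₁ y<n u<n) yu≢0)) })
                  (relocate-spec {V = V′} u<n y<n j≤H (Shifted.buckets sh) uy≢0) })
             (levelOf-spec {V = V′} (tables sh)) })
    (0 , _ , _ , _ , refl , refl , z≤n , record
      { buckets = bk ; same-adjacency = λ _ _ → refl ; moved = λ _ () ; rest = λ _ _ _ → refl
      ; low = λ _ _ → refl ; paid = refl })
    where
    g : ℕ → ℕ
    g q = level H b (seenColor V q)
    tables : ∀ {p V′} → Shifted x u p g V V′ → Tables V′
    tables sh = record
      { places = λ {j} p → trans (cong (λ f → f 0 0 j) (Shifted.low sh 1 _)) (places tb p)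
      ; thresholds = λ {j} p → trans (cong (λ f → f 0 0 j) (Shifted.low sh 2 _)) (thresholds tb p) }
    same-seen : ∀ {p V′} → Shifted x u p g V V′ → ∀ q → V′ 3 0 0 q ≡ seen V q
    same-seen sh q = cong (λ f → f 0 0 q) (Shifted.low sh 3 _)
    same-color : ∀ {p V′} → Shifted x u p g V V′ → ∀ q → V′ 0 0 0 (V′ 3 0 0 q) ≡ seenColor V q
    same-color sh q = cong₂ (λ f h → f 0 0 (h 0 0 q)) (Shifted.low sh 0 _) (Shifted.low sh 3 _)
    u-adj : ∀ {p q V′} → Shifted x u p g V V′ → q < x → pos V′ u (seen V q) ≢ 0
    u-adj {q = q} {V′} sh q<x with nbr q q<x
    ... | y<n , _ , uy , _ = apart-≢0 {V} {V′} (Shifted.same-adjacency sh u<n y<n) uy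
    adj-u : ∀ {p q V′} → Shifted x u p g V V′ → q < x → pos V′ (seen V q) u ≢ 0
    adj-u {q = q} {V′} sh q<x with nbr q q<x
    ... | y<n , _ , _ , yu , _ = apart-≢0 {V} {V′} (Shifted.same-adjacency sh y<n u<n) yu
    time-≤ : ∀ p t t₀ → t ≤ p * suc H → t₀ ≤ H → t + suc (t₀ + 0) ≤ (p + 1) * suc H
    time-≤ p t t₀ t≤ t₀≤ = begin
      t + suc (t₀ + 0)      ≤⟨ +-mono-≤ t≤ (s≤s (≤-trans (≤-reflexive (+-identityʳ t₀)) t₀≤)) ⟩
      p * suc H + suc H     ≡⟨ rearrange p (suc H) ⟩
      (p + 1) * suc H       ∎
      where
      open ≤-Reasoning
      rearrange : ∀ p h → p * h + h ≡ (p + 1) * h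
      rearrange = solve-∀

    advance : ∀ {p V′ V₁ V₂} → p < x → Shifted x u p g V V′ →
              Relocated u (seen V p) (g p) V′ V₁ → Relocated (seen V p) u (g p) V₁ V₂ →
              Shifted x u (suc p) g V V₂
    advance {p} {V′} {V₁} {V₂} p<x sh r₁ r₂ = record
      { buckets = R.buckets r₂
      ; same-adjacency = λ a<n c<n → trans (R.same-adjacency r₂ a<n c<n)
          (trans (R.same-adjacency r₁ a<n c<n) (Shifted.same-adjacency sh a<n c<n))
      ; moved = moved′
      ; rest = λ a c out → trans (stays (out p ≤-refl))
          (Shifted.rest sh a c (λ q q<p → out q (m<n⇒m<1+n q<p)))
      ; low = λ t p → trans (R.low r₂ t p) (trans (R.low r₁ t p) (Shifted.low sh t p))
      ; paid = paid′ }
      where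
      module R = Relocated
      y = seen V p
      y≢u : y ≢ u
      y≢u = proj₁ (proj₂ (nbr p p<x))
      stays : ∀ {a c} → ¬ Pair u y a c → lev V₂ a c ≡ lev V′ a c
      stays out = trans (R.levels r₂ (unequal (out ∘ inj₂))) (R.levels r₁ (unequal (out ∘ inj₁)))
      seen≢y : ∀ {q} → q < p → seen V q ≢ y
      seen≢y q<p e = <⇒≢ q<p (distinct _ p (<-trans q<p p<x) p<x e)
      seen≢u : ∀ {q} → q < p → seen V q ≢ u
      seen≢u {q} q<p = proj₁ (proj₂ (nbr q (<-trans q<p p<x)))
      moved′ : ∀ q → q < suc p → lev V₂ u (seen V q) ≡ g q × lev V₂ (seen V q) u ≡ g q
      moved′ q q<p with m≤n⇒m<n∨m≡n (≤-pred q<p)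
      ... | inj₂ refl = trans (R.levels r₂ (inj₁ (y≢u ∘ sym))) (R.new r₁) , R.new r₂
      ... | inj₁ q<p′ = trans (stays λ { (inj₁ (_ , e)) → seen≢y q<p′ e ; (inj₂ (_ , e)) → seen≢u q<p′ e })
                          (proj₁ (Shifted.moved sh q q<p′))
                      , trans (stays λ { (inj₁ (e , _)) → seen≢u q<p′ e ; (inj₂ (e , _)) → seen≢y q<p′ e })
                          (proj₂ (Shifted.moved sh q q<p′))
      l = lev V u y
      -- The gathered neighbors are distinct and different from `u`, so earlier moves concerned
      -- other edges.
      untouched : ∀ {a c} → Pair u y a c → lev V′ a c ≡ lev V a c
      untouched {a} {c} pr = Shifted.rest sh a c (λ q q<p pq → clash q<p pr pq)
        where
        clash : ∀ {q a c} → q < p → Pair u y a c → Pair u (seen V q) a c → ⊥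
        clash q<p (inj₁ (refl , refl)) (inj₁ (_ , e)) = seen≢y q<p (sym e)
        clash q<p (inj₁ (refl , refl)) (inj₂ (e , _)) = seen≢u q<p (sym e)
        clash q<p (inj₂ (refl , refl)) (inj₁ (_ , e)) = seen≢u q<p (sym e)
        clash q<p (inj₂ (refl , refl)) (inj₂ (e , _)) = seen≢y q<p (sym e)
      paid′ : potential V₂ + 2 * sum (suc p) (λ q → lev V u (seen V q)) ≡ potential V + 2 * sum (suc p) g
      paid′ = begin
        potential V₂ + 2 * (D + l)             ≡⟨ shuffle₁ (potential V₂) D l ⟩
        potential V₂ + l + (l + 2 * D)         ≡⟨ cong (λ k → potential V₂ + k + (l + 2 * D)) (sym l≡) ⟩
        potential V₂ + lev V₁ y u + (l + 2 * D) ≡⟨ cong (_+ (l + 2 * D)) (R.paid r₂) ⟩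
        potential V₁ + g p + (l + 2 * D)       ≡⟨ shuffle₂ (potential V₁) (g p) l (2 * D) ⟩
        potential V₁ + l + (g p + 2 * D)       ≡⟨ cong (λ k → potential V₁ + k + (g p + 2 * D)) (sym (untouched (inj₁ (refl , refl)))) ⟩
        potential V₁ + lev V′ u y + (g p + 2 * D) ≡⟨ cong (_+ (g p + 2 * D)) (R.paid r₁) ⟩
        potential V′ + g p + (g p + 2 * D)     ≡⟨ shuffle₃ (potential V′) (g p) (2 * D) ⟩
        potential V′ + 2 * D + 2 * g p         ≡⟨ cong (_+ 2 * g p) (Shifted.paid sh) ⟩
        potential V + 2 * sum p g + 2 * g p    ≡⟨ shuffle₄ (potential V) (sum p g) (g p) ⟩
        potential V + 2 * (sum p g + g p)      ∎
        where
        open ≡-Reasoning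
        D = sum p (λ q → lev V u (seen V q))
        l≡ : lev V₁ y u ≡ l
        l≡ = trans (R.levels r₁ (inj₁ y≢u)) (trans (untouched (inj₂ (refl , refl)))
               (proj₂ (proj₂ (proj₂ (proj₂ (nbr p p<x))))))
        shuffle₁ : ∀ a d l → a + 2 * (d + l) ≡ a + l + (l + 2 * d)
        shuffle₁ = solve-∀
        shuffle₂ : ∀ a b c d → a + b + (c + d) ≡ a + c + (b + d)
        shuffle₂ = solve-∀
        shuffle₃ : ∀ a b d → a + b + (b + d) ≡ a + d + 2 * b
        shuffle₃ = solve-∀
        shuffle₄ : ∀ a b c → a + 2 * b + 2 * c ≡ a + 2 * (b + c)
        shuffle₄ = solve-∀

  Buckets-cong : ∀ {V V′} → V′ 5 ≡ V 5 → V′ 6 ≡ V 6 → V′ 7 ≡ V 7 → V′ 8 ≡ V 8 →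
                 Buckets V → Buckets V′
  Buckets-cong {V} {V′} p₅ p₆ p₇ p₈ bk = record { entry = entry′ ; slot = slot′ }
    where
    entry′ : ∀ {u j i} → u < n → 1 ≤ i → i ≤ len V′ u j →
             ent V′ u j i < n × lev V′ u (ent V′ u j i) ≡ j × pos V′ u (ent V′ u j i) ≡ i
    entry′ rewrite p₅ | p₆ | p₇ | p₈ = entry bk
    slot′ : ∀ {u y} → u < n → y < n → pos V′ u y ≢ 0 →
            lev V′ u y ≤ H × pos V′ u y ≤ len V′ u (lev V′ u y) ×
            ent V′ u (lev V′ u y) (pos V′ u y) ≡ y
    slot′ rewrite p₅ | p₆ | p₇ | p₈ = slot bk

  Buckets-except : ∀ {m V V′} → m < 5 → SameExcept m V V′ → Buckets V → Buckets V′
  Buckets-except {m} m<5 f = Buckets-cong (f 5 (away m<5 (m≤m+n 5 0))) (f 6 (away m<5 (m≤m+n 5 1)))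
                                      (f 7 (away m<5 (m≤m+n 5 2))) (f 8 (away m<5 (m≤m+n 5 3)))
    where
    away : ∀ {t} → m < 5 → 5 ≤ t → t ≢ m
    away m<5 5≤t refl = <⇒≱ m<5 5≤t

  Tables-except : ∀ {m V V′} → 2 < m ⊎ m ≡ 0 → SameExcept m V V′ → Tables V → Tables V′
  Tables-except {m} 2<m f tb = record
    { places     = λ {j} p → trans (cong (λ g → g 0 0 j) (f 1 (away 2<m (s≤s z≤n) (s≤s (s≤s z≤n))))) (places tb p)
    ; thresholds = λ {j} p → trans (cong (λ g → g 0 0 j) (f 2 (away 2<m (s≤s z≤n) (s≤s (s≤s (s≤s z≤n)))))) (thresholds tb p) }
    where
    away : ∀ {t} → 2 < m ⊎ m ≡ 0 → 1 ≤ t → t < 3 → t ≢ m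
    away (inj₁ 2<m)  _ t<3 refl = <⇒≱ t<3 2<m
    away (inj₂ refl) 1≤t _ refl = n≮0 1≤t

  -- Degree bound and search for the level

  -- Injective enumerations are the form in which `Gathered` supplies neighbors, so the bound
  -- applies without counting the size of a neighborhood.
  DegreeBound : Mem → ℕ → Set
  DegreeBound V u = ∀ x (Y : ℕ → ℕ) → (∀ q → q < x → Y q < n × pos V u (Y q) ≢ 0) →
                    (∀ q r → q < x → r < x → Y q ≡ Y r → q ≡ r) → x ≤ Δ

  gathered-≤Δ : ∀ {u i x V Y} → DegreeBound V u → Gathered u i x V Y → x ≤ Δ
  gathered-≤Δ {x = x} {Y = Y} deg g = deg x Y
    (λ q q<x → proj₁ (Gathered.valid g q q<x) , proj₁ (proj₂ (Gathered.valid g q q<x)))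
    (Gathered.distinct g)

  -- The walk stops by level 0, where the threshold is `Δ` and `deg` applies. It does not stop at
  -- `H`, where the threshold is 0 while `v` has been gathered. Each neighbor is copied once and
  -- each level visited at most once.
  gather-spec : ∀ {u v z₂ z₃ z₄ z₅ V} → Buckets V → Tables V → DegreeBound V u → u < n → v < n →
    pos V u v ≢ 0 → lev V u v ≡ H →
    WP gather (u ∷ H ∷ z₂ ∷ z₃ ∷ z₄ ∷ z₅ ∷ []) V
      (λ e V′ t → ∃[ i ] ∃[ x ] e ≡ u ∷ H ∷ i ∷ x ∷ z₄ ∷ z₅ ∷ [] × i < H × x ≤ threshold i ×
                  Gathered u i x V (seen V′) × SameExcept 3 V V′ × t ≤ H + x)
  gather-spec {u} {v} {z₄ = z₄} {z₅} {V} bk tb deg u<n v<n uv≢0 lev≡H = wp⇒WP gather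
    ( _ , _
    , WP-map (λ { {e₀} {V₀} {t₀} (x₀≡ , f₀ , _ , new₀ , t₀≡) →
      let x₀ = head e₀
          g₀ = subst (λ x → Gathered u H x V (seen V₀)) (sym x₀≡)
                 (gather-more {x = 0} {Y = seen V} {seen V₀} bk u<n
                   (λ p → contradiction p (<-irrefl refl)) (gather-none bk u<n) (λ _ ()) new₀)
      in while-rule
        (λ m e V′ t → ∃[ x ] e ≡ u ∷ H ∷ m ∷ x ∷ z₄ ∷ z₅ ∷ [] × m ≤ H × x₀ ≤ x ×
           -- `x₀` is the size of the bucket at `H`, whose copying precedes this loop and is added
           -- to the time at the end.
           Gathered u m x V (seen V′) × SameExcept 3 V V′ × t + m + x₀ ≤ H + x)
        (λ { (x , refl , m≤H , _) → (_ , _ , _ , ≤-<-trans m≤H H<B) , _ })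
        (λ { {i} {V = V′} {t} (x , refl , i≤H , _ , g , f , t≤) z →
          let x≤t = subst (x ≤_) (thresholds (Tables-except (inj₁ (s≤s (s≤s (s≤s z≤n)))) f tb) i≤H) (less≡0 z)
          in i , x , refl , below-H i≤H x≤t g , x≤t , g , f ,
             (begin
               t₀ + t           ≤⟨ +-monoˡ-≤ t (≤-reflexive (trans t₀≡ (sym x₀≡))) ⟩
               x₀ + t           ≡⟨ +-comm x₀ t ⟩
               t + x₀           ≤⟨ +-monoˡ-≤ x₀ (m≤m+n t i) ⟩
               t + i + x₀       ≤⟨ t≤ ⟩
               H + x            ∎) })
        (λ { {zero} {V = V′} (x , refl , _ , _ , g , f , _) nz → contradiction
               (subst (_< x) (thresholds (Tables-except (inj₁ (s≤s (s≤s (s≤s z≤n)))) f tb) z≤n) (less≢0 nz))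
               (≤⇒≯ (gathered-≤Δ deg g))
           ; {suc i} {V = V′} {t} (x , refl , i<H , x₀≤x , g , f , t≤) nz → i , refl ,
             let over = λ (_ : i < H) → subst (_< x)
                   (thresholds (Tables-except (inj₁ (s≤s (s≤s (s≤s z≤n)))) f tb) i<H) (less≢0 nz)
                 len≡ = cong (λ h → h 0 u i) (f 5 λ ())
             in (_ , _ , s≤s z≤n , small (<⇒≤ (≤-<-trans i<H H<B))) , _ ,
                WP-map (λ { {e₁} {V₁} {t₁} (x₁≡ , f₁ , old , new , t₁≡) →
                    let x₁≡′ = trans x₁≡ (cong (x +_) len≡) in
                    head e₁ , refl , <⇒≤ i<H ,
                    ≤-trans x₀≤x (subst (x ≤_) (sym x₁≡) (m≤m+n x _)) ,
                    subst (λ x → Gathered u i x V (seen V₁)) (sym x₁≡′)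
                      (gather-more {Y = seen V′} {seen V₁} bk u<n over g old
                        (λ q q<l → trans (new q (subst (q <_) (sym len≡) q<l))
                                         (cong (λ h → h u i (suc q)) (f 8 λ ())))) ,
                    SameExcept-trans f f₁ ,
                    (begin
                      t + suc t₁ + i + x₀  ≡⟨ rearrange t t₁ i x₀ ⟩
                      t + suc i + x₀ + t₁  ≤⟨ +-mono-≤ t≤ (≤-reflexive t₁≡) ⟩
                      H + x + len V′ u i   ≡⟨ +-assoc H x _ ⟩
                      H + (x + len V′ u i) ≡⟨ cong (H +_) (sym x₁≡) ⟩
                      H + head e₁          ∎) })
                  (gatherBucket-spec {x} {u} {i} {V′} (Buckets-except (s≤s (s≤s (s≤s (s≤s z≤n)))) f bk) u<n (<⇒≤ i<H)
                    (subst (λ l → x + l ≤ n) (sym len≡) (gather-room bk u<n over g))) })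
        (x₀ , refl , ≤-refl , ≤-refl , g₀ , f₀ , ≤-refl) })
      (gatherBucket-spec {0} {u} {H} {V} bk u<n ≤-refl
        (gather-room {Y = seen V} bk u<n (λ p → contradiction p (<-irrefl refl)) (gather-none bk u<n))))
    where
    open ≤-Reasoning
    rearrange : ∀ a b c d → a + suc b + c + d ≡ a + suc c + d + b
    rearrange = solve-∀
    below-H : ∀ {i x Y} → i ≤ H → x ≤ threshold i → Gathered u i x V Y → i < H
    below-H {i} {x} i≤H x≤t g = ≤∧≢⇒< i≤H λ { refl →
      case Gathered.complete g v<n uv≢0 (≤-reflexive (sym lev≡H)) of λ (q , q<x , _) →
      n≮0 (<-≤-trans q<x (≤-trans x≤t (≤-reflexive threshold-H))) }

  -- Recoloring a vertex

  -- Properness is kept apart, since this invariant must also hold between the insertion of a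
  -- monochromatic edge and the recoloring.
  record Maintained (V : Mem) : Set where
    field
      buckets     : Buckets V
      colors<     : ∀ {a} → a < n → col V a < place H
      symmetric   : ∀ {a c} → a < n → c < n → apart? V a c ≡ apart? V c a
      irreflexive : ∀ {a} → a < n → pos V a a ≡ 0
      consistent  : ∀ {a c} → a < n → c < n → pos V a c ≢ 0 → lev V a c ≡ level H (col V a) (col V c)

    flip≢0 : ∀ {a c} → a < n → c < n → pos V a c ≢ 0 → pos V c a ≢ 0
    flip≢0 {a} {c} a<n c<n p z =
      case trans (sym (≡ᵇ-≢ p)) (trans (symmetric a<n c<n) (cong (_≡ᵇ 0) z)) of λ ()

    lev-sym : ∀ {a c} → a < n → c < n → pos V a c ≢ 0 → lev V c a ≡ lev V a c
    lev-sym {a} {c} a<n c<n p = trans (consistent c<n a<n (flip≢0 a<n c<n p))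
      (trans (level-sym H (col V c) (col V a)) (sym (consistent a<n c<n p)))

  record Recolored (V V′ : Mem) (t : ℕ) : Set where
    field
      maintained     : Maintained V′
      same-adjacency : ∀ {a c} → a < n → c < n → apart? V′ a c ≡ apart? V a c
      proper         : ∀ {a c} → a < n → c < n → pos V′ a c ≢ 0 → lev V′ a c ≢ H
      tables         : Tables V′
      paid           : t + 2 * H * A * potential V′ ≤ 2 * H * A * potential V + H * (4 + 2 * A)

  -- The potential drops by `2 * (D - F)` with `A * (D - F) ≥ x`. Weighted by `2 * H * A` this
  -- releases `4 * H * x`, enough for the `2 * x + 2 * H * x` iterations that depend on `x`, as
  -- `H ≥ 1`. What remains is `H` for the walk and `3 + 2 * A` for each of up to `H` digits.
  charge : ∀ {x D F p p′ t} → A * F + x ≤ A * D → p′ + 2 * D ≡ p + 2 * F →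
           t ≤ (H + x) + H * suc (2 * suc A + x) + x * suc H →
           t + 2 * H * A * p′ ≤ 2 * H * A * p + H * (4 + 2 * A)
  charge {x} {D} {F} {p} {p′} {t} cheap shifted t≤ = +-cancelʳ-≤ (4 * H * (A * D)) _ _ (begin
    t + 2 * H * A * p′ + 4 * H * (A * D)
      ≤⟨ +-monoˡ-≤ (4 * H * (A * D)) (+-monoˡ-≤ (2 * H * A * p′) t≤) ⟩
    (H + x) + H * suc (2 * suc A + x) + x * suc H + 2 * H * A * p′ + 4 * H * (A * D)
      ≡⟨ rearrange₁ H x A p′ D ⟩
    2 * x + (2 * H * x + (H * (4 + 2 * A) + 2 * H * A * (p′ + 2 * D)))
      ≤⟨ +-monoˡ-≤ _ (subst (_≤ 2 * H * x) (cong (_* x) (*-identityʳ 2)) (*-monoˡ-≤ x (*-monoʳ-≤ 2 (s≤s (z≤n {L}))))) ⟩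
    2 * H * x + (2 * H * x + (H * (4 + 2 * A) + 2 * H * A * (p′ + 2 * D)))
      ≡⟨ cong (λ k → 2 * H * x + (2 * H * x + (H * (4 + 2 * A) + 2 * H * A * k))) shifted ⟩
    2 * H * x + (2 * H * x + (H * (4 + 2 * A) + 2 * H * A * (p + 2 * F)))
      ≡⟨ rearrange₂ H x A p F ⟩
    2 * H * A * p + H * (4 + 2 * A) + 4 * H * (A * F + x)
      ≤⟨ +-monoʳ-≤ (2 * H * A * p + H * (4 + 2 * A)) (*-monoʳ-≤ (4 * H) cheap) ⟩
    2 * H * A * p + H * (4 + 2 * A) + 4 * H * (A * D) ∎)
    where
    open ≤-Reasoning
    rearrange₁ : ∀ h x a p d → (h + x) + h * suc (2 * suc a + x) + x * suc h + 2 * h * a * p + 4 * h * (a * d) ≡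
                 2 * x + (2 * h * x + (h * (4 + 2 * a) + 2 * h * a * (p + 2 * d)))
    rearrange₁ = solve-∀
    rearrange₂ : ∀ h x a p f → 2 * h * x + (2 * h * x + (h * (4 + 2 * a) + 2 * h * a * (p + 2 * f))) ≡
                 2 * h * a * p + h * (4 + 2 * a) + 4 * h * (a * f + x)
    rearrange₂ = solve-∀

  -- After the change, gathered edges are proper by the choice of color, the other edges at `u` keep
  -- a level below `i < H`, and edges away from `u` are untouched; among the latter, `only` excludes
  -- level `H`.
  recolor-spec : ∀ {u v z₂ z₃ z₄ z₅ V} → Maintained V → Tables V → DegreeBound V u → u < n → v < n →
    pos V u v ≢ 0 → lev V u v ≡ H →
    (∀ {a c} → a < n → c < n → pos V a c ≢ 0 → lev V a c ≡ H → Pair u v a c) →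
    WP recolor (u ∷ H ∷ z₂ ∷ z₃ ∷ z₄ ∷ z₅ ∷ []) V (λ _ V′ t → Recolored V V′ t)
  recolor-spec {u} {v} {V = V} mt tb deg u<n v<n uv≢0 lev≡H only = WP-⨾
    (WP-map (λ { {_} {V₁} {t₁} (i , x , refl , i<H , x≤t , g , f₁ , t₁≤) →
      let open After i x i<H x≤t V₁ t₁ g f₁ t₁≤ in wp⇒WP (recolor-rest)
        ( ((_ , _ , _ , u<B) , (_ , _ , _ , <-trans i<H H<B) , _)
        , _
        , WP-args (cong (λ b → b ∷ i ∷ H ∷ x ∷ []) (sym b₀≡)) (WP-map (λ {e₂} {V₂} {t₂} ch →
          ((_ , _ , _ , u<B) , _) , _ , WP-map (λ {e₃} {V₃} {t₃} (sh , t₃≤) → finish ch sh t₃≤)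
            (relocateAll-spec (buckets₂ ch) (tables₂ ch) u<n x≤n (neighbors ch) (distinct₂ ch)))
          (pickColor-spec {V = V₁} tables₁ i<H x≤n x≤t seen<n residues (residue-< (col V u) i)))) })
      (gather-spec M.buckets tb deg u<n v<n uv≢0 lev≡H))
    where
    module M = Maintained mt
    u<B = <-trans u<n n<B
    recolor-rest : Cmd 6
    recolor-rest =
        4F := bin modu (get 0 O O (var 0F)) (get 1 O O (var 2F))
      ⨾ call 4F pickColor (` 4F ∷ ` 2F ∷ ` 1F ∷ ` 3F ∷ [])
      ⨾ put 0 O O (var 0F) (` 4F)
      ⨾ call 5F relocateAll (# 0 ∷ ` 0F ∷ ` 1F ∷ ` 3F ∷ ` 4F ∷ # 0 ∷ # 0 ∷ # 0 ∷ [])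

    module After (i x : ℕ) (i<H : i < H) (x≤t : x ≤ threshold i) (V₁ : Mem) (t₁ : ℕ)
                 (g : Gathered u i x V (seen V₁)) (f₁ : SameExcept 3 V V₁) (t₁≤ : t₁ ≤ H + x) where
      open Gathered g

      Y : ℕ → ℕ
      Y = seen V₁

      tables₁ : Tables V₁
      tables₁ = Tables-except (inj₁ (s≤s (s≤s (s≤s z≤n)))) f₁ tb

      x≤n : x ≤ n
      x≤n = gathered-≤n g

      seen<n : ∀ q → q < x → Y q < n
      seen<n q q<x = proj₁ (valid q q<x)

      col₁ : ∀ a → col V₁ a ≡ col V a
      col₁ a = cong (λ f → f 0 0 a) (f₁ 0 λ ())

      b₀≡ : V₁ 0 0 0 u modℕ V₁ 1 0 0 i ≡ residue (col V u) i
      b₀≡ = cong₂ _modℕ_ (col₁ u) (places tables₁ (<⇒≤ i<H))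

      residues : ∀ q → q < x → residue (seenColor V₁ q) i ≡ residue (col V u) i
      residues q q<x with valid q q<x
      -- `consistent` ties the stored level to the colors, so a level of at least `i` means equal
      -- residues modulo `place i`.
      ... | y<n , uy , i≤ = trans (cong (λ c → residue c i) (col₁ (Y q))) (sym
        (residue-coarser (subst (i ≤_) (M.consistent u<n y<n uy) i≤) (level-match H (col V u) (col V (Y q)))))

      Y≢u : ∀ q → q < x → Y q ≢ u
      Y≢u q q<x e with valid q q<x
      ... | _ , uy , _ = uy (trans (cong (pos V u) e) (M.irreflexive u<n))

      module _ {b : ℕ} {V₂ : Mem} {t₂ : ℕ} (ch : Chosen x i (residue (col V u) i) V₁ b V₂ t₂) where
        private module C = Chosen ch

        V₃ : Mem
        V₃ = write V₂ 0 0 0 u b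

        since₁ : ∀ t → t ≢ 0 → t ≢ 3 → t ≢ 4 → V₃ t ≡ V t
        since₁ t ≢0 ≢3 ≢4 = trans (write-except V₂ 0 0 0 u b t ≢0) (trans (C.frame t ≢4) (f₁ t ≢3))

        buckets₂ : Buckets V₃
        buckets₂ = Buckets-cong (since₁ 5 (λ ()) (λ ()) λ ()) (since₁ 6 (λ ()) (λ ()) λ ())
          (since₁ 7 (λ ()) (λ ()) λ ()) (since₁ 8 (λ ()) (λ ()) λ ()) M.buckets

        tables₂ : Tables V₃
        tables₂ = Tables-except (inj₂ refl) (write-except V₂ 0 0 0 u b)
          (Tables-except (inj₁ (s≤s (s≤s (s≤s z≤n)))) C.frame tables₁)

        seen₃ : ∀ q → seen V₃ q ≡ Y q
        seen₃ q = cong (λ f → f 0 0 q) (C.frame 3 λ ())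

        pos₃ : V₃ 6 ≡ V 6
        pos₃ = since₁ 6 (λ ()) (λ ()) λ ()

        lev₃ : V₃ 7 ≡ V 7
        lev₃ = since₁ 7 (λ ()) (λ ()) λ ()

        col-u : col V₃ u ≡ b
        col-u = hit₂ {a = 0} {u}

        col₃ : ∀ {a} → a ≢ u → col V₃ a ≡ col V a
        col₃ {a} a≢u = trans (miss₂ {a = 0} {u} {0} (inj₂ (a≢u ∘ sym)))
          (trans (cong (λ f → f 0 0 a) (C.frame 0 λ ())) (col₁ a))

        neighbors : ∀ q → q < x → seen V₃ q < n × seen V₃ q ≢ u × pos V₃ u (seen V₃ q) ≢ 0 ×
          pos V₃ (seen V₃ q) u ≢ 0 × lev V₃ (seen V₃ q) u ≡ lev V₃ u (seen V₃ q)
        neighbors q q<x rewrite pos₃ | lev₃ | seen₃ q with valid q q<x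
        ... | y<n , uy , _ = y<n , Y≢u q q<x , uy , M.flip≢0 u<n y<n uy , M.lev-sym u<n y<n uy

        distinct₂ : ∀ q r → q < x → r < x → seen V₃ q ≡ seen V₃ r → q ≡ r
        distinct₂ q r q<x r<x e = distinct q r q<x r<x (trans (sym (seen₃ q)) (trans e (seen₃ r)))

        color-seen : ∀ {q} → q < x → seenColor V₃ q ≡ col V (Y q)
        color-seen {q} q<x = trans (cong (col V₃) (seen₃ q)) (col₃ (Y≢u q q<x))

        module Done {V₄ : Mem} {t₃ : ℕ} (sh : Shifted x u x (λ q → level H b (seenColor V₃ q)) V₃ V₄)
                    (t₃≤ : t₃ ≤ x * suc H) where
          private module S = Shifted sh

          same-adjacency′ : ∀ {a c} → a < n → c < n → apart? V₄ a c ≡ apart? V a c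
          same-adjacency′ {a} {c} a<n c<n =
            trans (S.same-adjacency a<n c<n) (cong (λ f → f 0 a c ≡ᵇ 0) pos₃)

          back≢0 : ∀ {a c} → a < n → c < n → pos V₄ a c ≢ 0 → pos V a c ≢ 0
          back≢0 {a} {c} a<n c<n = apart-≢0 {V₄} {V} (sym (same-adjacency′ a<n c<n))

          col₄-u : col V₄ u ≡ b
          col₄-u = trans (cong (λ f → f 0 0 u) (S.low 0 _)) col-u

          col₄ : ∀ {a} → a ≢ u → col V₄ a ≡ col V a
          col₄ {a} a≢u = trans (cong (λ f → f 0 0 a) (S.low 0 _)) (col₃ a≢u)

          Y-pair : ∀ {q a c} → Pair u (seen V₃ q) a c → Pair u (Y q) a c
          Y-pair {q} {a} {c} = subst (λ y → Pair u y a c) (seen₃ q)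

          rest′ : ∀ a c → (∀ q → q < x → ¬ Pair u (Y q) a c) → lev V₄ a c ≡ lev V a c
          rest′ a c out = trans (S.rest a c (λ q q<x → out q q<x ∘ Y-pair))
                                (cong (λ f → f 0 a c) lev₃)

          -- A neighbor of level at least `i` is among the gathered ones by `complete` and has been
          -- moved; for one of lower level `level-low` applies, since the new color extends the same
          -- `i` digits.
          star : ∀ {c} → c < n → pos V u c ≢ 0 →
                 lev V₄ u c ≡ level H b (col V c) × lev V₄ c u ≡ level H b (col V c) ×
                 (lev V₄ u c ≢ H)
          star {c} c<n uc≢0 with i ≤? lev V u c
          ... | yes i≤ with complete c<n uc≢0 i≤
          ...   | q , q<x , refl = at-u , at-c , λ e → C.proper q q<x
                    (subst (_< place H) (sym (col₁ (Y q))) (M.colors< c<n))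
                    (trans (col₁ (Y q)) (sym (level-H C.bound (M.colors< c<n) (trans (sym at-u) e))))
            where
            at-u : lev V₄ u c ≡ level H b (col V c)
            at-u = trans (cong (lev V₄ u) (sym (seen₃ q))) (trans (proj₁ (S.moved q q<x))
              (cong (level H b) (color-seen q<x)))
            at-c : lev V₄ c u ≡ level H b (col V c)
            at-c = trans (cong (λ y → lev V₄ y u) (sym (seen₃ q))) (trans (proj₂ (S.moved q q<x))
              (cong (level H b) (color-seen q<x)))
          star {c} c<n uc≢0 | no i≰ =
            trans (rest′ u c out-u) old ,
            trans (rest′ c u out-c) (trans (M.lev-sym u<n c<n uc≢0) old) ,
            λ e → <⇒≢ (<-trans (≰⇒> i≰) i<H) (trans (sym (rest′ u c out-u)) e)
            where
            old : lev V u c ≡ level H b (col V c)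
            old = trans (M.consistent u<n c<n uc≢0) (sym (level-low (col V c) (≤⇒≤′ (<⇒≤ i<H))
              C.extends (subst (_< i) (M.consistent u<n c<n uc≢0) (≰⇒> i≰))))
            not-Y : ∀ q → q < x → c ≢ Y q
            not-Y q q<x refl = i≰ (proj₂ (proj₂ (valid q q<x)))
            c≢u : c ≢ u
            c≢u refl = uc≢0 (M.irreflexive u<n)
            out-u : ∀ q → q < x → ¬ Pair u (Y q) u c
            out-u q q<x (inj₁ (_ , e)) = not-Y q q<x e
            out-u q q<x (inj₂ (_ , e)) = c≢u e
            out-c : ∀ q → q < x → ¬ Pair u (Y q) c u
            out-c q q<x (inj₁ (e , _)) = c≢u e
            out-c q q<x (inj₂ (e , _)) = not-Y q q<x e

          elsewhere : ∀ {a c} → a ≢ u → c ≢ u → lev V₄ a c ≡ lev V a c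
          elsewhere {a} {c} a≢u c≢u = rest′ a c λ
            { q q<x (inj₁ (e , _)) → a≢u e ; q q<x (inj₂ (_ , e)) → c≢u e }

          maintained′ : Maintained V₄
          maintained′ = record
            { buckets = S.buckets
            ; colors< = λ {a} a<n → colors<′ a a<n
            ; symmetric = λ a<n c<n → trans (same-adjacency′ a<n c<n)
                (trans (M.symmetric a<n c<n) (sym (same-adjacency′ c<n a<n)))
            ; irreflexive = λ {a} a<n → ≡ᵇ⇒≡ (pos V₄ a a) 0 (subst T (sym (trans (same-adjacency′ a<n a<n)
                (cong (_≡ᵇ 0) (M.irreflexive a<n)))) tt)
            ; consistent = consistent′ }
            where
            colors<′ : ∀ a → a < n → col V₄ a < place H
            colors<′ a a<n with a ≟ u
            ... | yes refl = subst (_< place H) (sym col₄-u) C.bound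
            ... | no a≢u = subst (_< place H) (sym (col₄ a≢u)) (M.colors< a<n)
            consistent′ : ∀ {a c} → a < n → c < n → pos V₄ a c ≢ 0 →
                          lev V₄ a c ≡ level H (col V₄ a) (col V₄ c)
            consistent′ {a} {c} a<n c<n ac≢0 with a ≟ u | c ≟ u
            ... | yes refl | yes refl = contradiction (M.irreflexive u<n) (back≢0 u<n u<n ac≢0)
            ... | yes refl | no c≢u = trans (proj₁ (star c<n (back≢0 u<n c<n ac≢0)))
              (sym (cong₂ (level H) col₄-u (col₄ c≢u)))
            ... | no a≢u | yes refl = trans
              (proj₁ (proj₂ (star a<n (M.flip≢0 a<n u<n (back≢0 a<n u<n ac≢0)))))
              (trans (level-sym H b (col V a)) (sym (cong₂ (level H) (col₄ a≢u) col₄-u)))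
            ... | no a≢u | no c≢u = trans (elsewhere a≢u c≢u)
              (trans (M.consistent a<n c<n (back≢0 a<n c<n ac≢0))
                (sym (cong₂ (level H) (col₄ a≢u) (col₄ c≢u))))

          proper′ : ∀ {a c} → a < n → c < n → pos V₄ a c ≢ 0 → lev V₄ a c ≢ H
          proper′ {a} {c} a<n c<n ac≢0 e with a ≟ u | c ≟ u
          ... | yes refl | _ = proj₂ (proj₂ (star c<n (back≢0 u<n c<n ac≢0))) e
          ... | no a≢u | yes refl = proj₂ (proj₂ st) (trans (proj₁ st) (trans (sym (proj₁ (proj₂ st))) e))
            where st = star a<n (M.flip≢0 a<n u<n (back≢0 a<n u<n ac≢0))
          ... | no a≢u | no c≢u with only a<n c<n (back≢0 a<n c<n ac≢0) (trans (sym (elsewhere a≢u c≢u)) e)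
          ...   | inj₁ (a≡u , _) = a≢u a≡u
          ...   | inj₂ (_ , c≡u) = c≢u c≡u

          paid′ : t₁ + (t₂ + (0 + t₃)) + 2 * H * A * potential V₄ ≤ 2 * H * A * potential V + H * (4 + 2 * A)
          paid′ = charge {x} {D} {F} {potential V} {potential V₄} cheap′ shifted (begin
            t₁ + (t₂ + (0 + t₃))     ≡⟨ sym (+-assoc t₁ t₂ t₃) ⟩
            t₁ + t₂ + t₃             ≤⟨ +-mono-≤ (+-mono-≤ t₁≤ C.ticks) t₃≤ ⟩
            (H + x) + H * suc (2 * suc A + x) + x * suc H ∎)
            where
            open ≤-Reasoning
            D = sum x (λ q → lev V u (Y q))
            F = sum x (λ q → level H b (seenColor V₁ q))
            cheap′ : A * F + x ≤ A * D
            cheap′ = ≤-trans C.cheap (*-monoʳ-≤ A (heavy i<H))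
            potential≡ : potential V₃ ≡ potential V
            potential≡ = cong (λ f → sum n (λ u → sum (suc H) (λ j → j * f 0 u j)))
              (since₁ 5 (λ ()) (λ ()) λ ())
            shifted : potential V₄ + 2 * D ≡ potential V + 2 * F
            shifted = trans (cong (λ k → potential V₄ + 2 * k) (sum-cong x (λ q _ →
                cong₂ (λ f y → f 0 u y) (sym lev₃) (sym (seen₃ q)))))
              (trans S.paid (cong₂ (λ k l → k + 2 * l) potential≡ (sum-cong x (λ q q<x →
                cong (level H b) (trans (color-seen q<x) (sym (col₁ (Y q))))))))

        finish : ∀ {V₄ t₃} → Shifted x u x (λ q → level H b (seenColor V₃ q)) V₃ V₄ → t₃ ≤ x * suc H →
                 Recolored V V₄ (t₁ + (t₂ + (0 + t₃)))
        finish sh t₃≤ = record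
          { maintained = maintained′ ; same-adjacency = same-adjacency′ ; proper = proper′
          ; tables = record
              { places = λ {j} p → trans (cong (λ f → f 0 0 j) (Shifted.low sh 1 _)) (places tables₂ p)
              ; thresholds = λ {j} p → trans (cong (λ f → f 0 0 j) (Shifted.low sh 2 _)) (thresholds tables₂ p) }
          ; paid = paid′ }
          where open Done sh t₃≤

  -- Computing the logarithm and the tables

  s≤B : s ≤ B
  s≤B = +-mono-≤ (m≤m+n 2 n) (⌊log₂⌋≤ Δ)

  A<W : s * (s + 1) < W
  A<W = ≤-<-trans (begin
    s * (s + 1) ≤⟨ *-mono-≤ s≤B (+-mono-≤ s≤B (s≤s z≤n)) ⟩
    B * (B + B) ≡⟨ cong (B *_) (cong (B +_) (sym (+-identityʳ B))) ⟩
    B * (2 * B) ≤⟨ *-monoʳ-≤ B (*-monoˡ-≤ B (m≤m+n 2 (n + Δ))) ⟩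
    B * (B * B) ≡⟨ sym (*-assoc B B B) ⟩
    B * B * B   ∎) (B³<W (s≤s z≤n))
    where open ≤-Reasoning

  logarithm-spec : ∀ {V} → WP logarithm (2 ∷ Δ ∷ []) V
    (λ e V′ t → head e ≡ s × V′ ≡ V × t ≤ s)
  logarithm-spec {V} = while-rule
    (λ m e V′ t → ∃[ r ] ∃[ x ] e ≡ r ∷ x ∷ [] × V′ ≡ V × ⌊log₂ x ⌋ ≡ m × r + m ≡ s × t + m ≤ s)
    (λ { (_ , _ , refl , _) → _ })
    (λ { {m} {k = t} (r , x , refl , refl , xm , rm , tm) z →
         trans (sym (+-identityʳ r)) (trans (cong (r +_) (trans (sym (⌊log₂⌋-zero (less≡0 {1} {x} z))) xm)) rm) ,
         refl , ≤-trans (m≤m+n t m) tm })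
    (λ { {zero} (r , x , refl , refl , xm , rm , tm) nz →
           contradiction (⌊log₂⌋-pos (less≢0 {1} {x} nz)) (subst (λ l → ¬ 1 ≤ l) (sym xm) λ ())
       ; {suc m} {k = t} (r , x , refl , refl , xm , rm , tm) nz → m , refl , _ ,
           (_ , _ , small (≤-trans (+-monoʳ-≤ r (s≤s z≤n)) (≤-trans (≤-reflexive rm) s≤B))) ,
           r + 1 , x / 2 , refl , refl ,
           trans (cong ⌊log₂_⌋ (/2≡⌊/2⌋ x)) (trans (⌊log₂⌊n/2⌋⌋≡⌊log₂n⌋∸1 x) (cong (_∸ 1) xm)) ,
           trans (+-assoc r 1 m) rm , subst (_≤ s) (sym (+-assoc t 1 m)) tm })
    (2 , Δ , refl , refl , refl , refl , m≤n+m ⌊log₂ Δ ⌋ 2)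

  SameOutsideTables : Mem → Mem → Set
  SameOutsideTables V V′ = ∀ t → t ≢ 1 → t ≢ 2 → V′ t ≡ V t

  record TablesTo (i : ℕ) (V V′ : Mem) : Set where
    field
      places-to     : ∀ {j} → j ≤ i → V′ 1 0 0 j ≡ place j
      thresholds-to : ∀ {j} → j ≤ i → V′ 2 0 0 j ≡ threshold j
      outside       : SameOutsideTables V V′

  extend-tables : ∀ {i V V′ p t} → p ≡ place i → t ≡ threshold i →
    (∀ {j} → j < i → V′ 1 0 0 j ≡ place j) → (∀ {j} → j < i → V′ 2 0 0 j ≡ threshold j) →
    SameOutsideTables V V′ → TablesTo i V (write (write V′ 1 0 0 i p) 2 0 0 i t)
  extend-tables {i} {V} {V′} {p} {t} p≡ t≡ ps ts out = record
    { places-to     = λ j≤i → new ps p≡ j≤i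
    ; thresholds-to = λ j≤i → new ts t≡ j≤i
    ; outside = λ k k≢1 k≢2 → trans (write-except (write V′ 1 0 0 i p) 2 0 0 i t k k≢2)
        (trans (write-except V′ 1 0 0 i p k k≢1) (out k k≢1 k≢2)) }
    where
    new : ∀ {f g : ℕ → ℕ} {y j} → (∀ {j} → j < i → f j ≡ g j) → y ≡ g i → j ≤ i →
          (if (i ≡ᵇ j) then y else f j) ≡ g j
    new {j = j} old y≡ j≤i with m≤n⇒m<n∨m≡n j≤i
    ... | inj₁ j<i rewrite ≡ᵇ-≢ (<⇒≢ j<i ∘ sym) = old j<i
    ... | inj₂ refl rewrite ≡ᵇ-refl j = y≡

  -- The loop runs while the quotient exceeds `A`, so it stops exactly at the least index `L`; the
  -- last digit and the threshold 0 are appended outside of it.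
  fillTables-spec : ∀ {V} → WP fillTables (0 ∷ Δ ∷ s ∷ s * (s + 1) ∷ 1 ∷ Δ ∷ []) V
    (λ e V′ t → head e ≡ H × Tables V′ × SameOutsideTables V V′ × t ≤ L)
  fillTables-spec {V} = wp⇒WP fillTables
    ( ((_ , _ , _ , s≤s z≤n) , _) , ((_ , _ , _ , s≤s z≤n) , _)
    , while-rule
        (λ m e V′ t → ∃[ i ] ∃[ p ] ∃[ q ] e ≡ i ∷ Δ ∷ s ∷ A′ ∷ p ∷ q ∷ [] ×
           p ≡ place i × q ≡ quotient i × i + m ≡ L × t ≡ i × TablesTo i V V′)
        (λ { (_ , _ , _ , refl , _) → _ })
        (λ { {m} {V = V′} (i , p , q , refl , p≡ , q≡ , im , refl , ts) z →
          let i≡L = at-L (subst (i ≤_) im (m≤m+n i m)) (subst (_≤ A) q≡ (subst (q ≤_) A′≡A (less≡0 z)))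
              p≡′ = last-place i≡L p≡ q≡
          in (_ , _ , small (<⇒≤ (index<B (≤-reflexive i≡L)))) ,
             ((_ , _ , ≤-<-trans (m≤m*n (q + 1) p {{subst NonZero (sym p≡) (place≢0 i)}}) (next-place< (≤-reflexive i≡L) p≡′))
               , _ , next-place< (≤-reflexive i≡L) p≡′) ,
             ((_ , _ , _ , index<B (≤-reflexive i≡L)) , _) , ((_ , _ , _ , index<B (≤-reflexive i≡L)) , _) ,
             trans (+-comm i 1) (cong suc i≡L) ,
             complete (trans (+-comm i 1) (cong suc i≡L)) (next-table (<-+1 i) p≡′
               (sym (trans (cong threshold (trans (+-comm i 1) (cong suc i≡L))) threshold-H)) ts) ,
             TablesTo.outside (next-table (<-+1 i) p≡′
               (sym (trans (cong threshold (trans (+-comm i 1) (cong suc i≡L))) threshold-H)) ts) ,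
             ≤-reflexive (trans (+-identityʳ i) i≡L) })
        (λ { {zero} (i , p , q , refl , _ , q≡ , im , _) nz → contradiction
               (subst₂ _<_ A′≡A (trans q≡ (cong quotient (trans (sym (+-identityʳ i)) im))) (less≢0 nz))
               (≤⇒≯ quotient-L)
           ; {suc m} {V = V′} (i , p , q , refl , p≡ , q≡ , im , refl , ts) nz → m , refl ,
               let i<L = subst (i <_) im (m<m+n i (s≤s z≤n))
                   p≡′ = middle-place i<L p≡
                   q≡′ = trans (cong (_/ s) q≡) (sym (cong quotient (+-comm i 1)))
               in (_ , _ , small (<⇒≤ (index<B (<⇒≤ i<L)))) ,
                  ((_ , _ , ≤-<-trans (m≤m*n (s + 2) p {{subst NonZero (sym p≡) (place≢0 i)}}) (next-place< (<⇒≤ i<L) p≡′))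
                    , _ , next-place< (<⇒≤ i<L) p≡′) , _ ,
                  ((_ , _ , _ , index<B (<⇒≤ i<L)) , _) , ((_ , _ , _ , index<B (<⇒≤ i<L)) , _) ,
                  i + 1 , _ , _ , refl , p≡′ , q≡′ , trans (+-assoc i 1 m) im , refl ,
                  next-table (<-+1 i) p≡′ (trans q≡′ (sym (threshold-≤ (subst (_≤ L) (+-comm 1 i) i<L)))) ts })
        {m = L}
        (0 , 1 , Δ , refl , refl , refl , refl , refl , record
          { places-to = λ { z≤n → refl } ; thresholds-to = λ { z≤n → refl }
          ; outside = λ t t≢1 t≢2 → trans (write-except (write V 1 0 0 0 1) 2 0 0 0 Δ t t≢2)
                                          (write-except V 1 0 0 0 1 t t≢1) }))
    where
    A′ = s * (s + 1)
    A′≡A : A′ ≡ A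
    A′≡A = cong (s *_) (+-comm s 1)
    index<B : ∀ {i} → i ≤ L → i + 1 < B
    index<B {i} i≤L = subst (_< B) (+-comm 1 i) (≤-<-trans (s≤s i≤L) H<B)
    <-+1 : ∀ i {j} → j < i + 1 → j ≤ i
    <-+1 i {j} p = ≤-pred (subst (j <_) (+-comm i 1) p)
    at-L : ∀ {i} → i ≤ L → quotient i ≤ A → i ≡ L
    at-L i≤L q≤ with m≤n⇒m<n∨m≡n i≤L
    ... | inj₁ i<L = contradiction (quotient-before i<L) (≤⇒≯ q≤)
    ... | inj₂ i≡L = i≡L
    next-place< : ∀ {i k} → i ≤ L → k ≡ place (i + 1) → k < W
    next-place< {i} i≤L refl = place<W (subst (_≤ H) (+-comm 1 i) (s≤s i≤L))
    middle-place : ∀ {i p} → i < L → p ≡ place i → (s + 2) * p ≡ place (i + 1)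
    middle-place {i} i<L refl = trans (cong (_* place i) (trans (+-comm s 2) (sym (radix-< i<L))))
      (cong place (+-comm 1 i))
    last-place : ∀ {i p q} → i ≡ L → p ≡ place i → q ≡ quotient i → (q + 1) * p ≡ place (i + 1)
    last-place {i} refl refl refl = trans (cong (_* place i) (trans (+-comm (quotient i) 1) (sym radix-L)))
      (cong place (+-comm 1 i))
    next-table : ∀ {i V′ p t} → (∀ {j} → j < i + 1 → j ≤ i) → p ≡ place (i + 1) → t ≡ threshold (i + 1) →
      TablesTo i V V′ → TablesTo (i + 1) V (write (write V′ 1 0 0 (i + 1) p) 2 0 0 (i + 1) t)
    next-table lower p≡ t≡ ts = extend-tables p≡ t≡
      (λ j< → TablesTo.places-to ts (lower j<)) (λ j< → TablesTo.thresholds-to ts (lower j<))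
      (TablesTo.outside ts)
    complete : ∀ {h V′} → h ≡ H → TablesTo h V V′ → Tables V′
    complete refl ts = record { places = TablesTo.places-to ts ; thresholds = TablesTo.thresholds-to ts }

  initialize-spec : ∀ {z V} → WP initialize (0 ∷ Δ ∷ z ∷ []) V
    (λ e V′ t → head e ≡ H × Tables V′ × SameOutsideTables V V′ × t ≤ s + L)
  initialize-spec {V = V} = wp⇒WP initialize
    ( _ , WP-map (λ { {e₀} {_} {t₀} (s≡ , refl , t₀≤) →
        subst (λ s′ → wp (call 0F fillTables (# 0 ∷ ` 1F ∷ ` 2F ∷ bin times (` 2F) (bin plus (` 2F) (# 1)) ∷ # 1 ∷ ` 1F ∷ []))
                 (0 ∷ Δ ∷ s′ ∷ []) V (λ e V′ t → head e ≡ H × Tables V′ × SameOutsideTables V V′ × t₀ + t ≤ s + L))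
          (sym s≡)
          ( (_ , _ , _ , (_ , (_ , _ , ≤-<-trans (m≤n*m (s + 1) s) A<W) , A<W) , _)
          , WP-map (λ { (h≡ , tb , out , t≤) → h≡ , tb , out , +-mono-≤ t₀≤ t≤ }) fillTables-spec) })
        logarithm-spec)

  -- Deletion and insertion of an edge

  Proper : Mem → Set
  Proper V = ∀ {a c} → a < n → c < n → pos V a c ≢ 0 → lev V a c ≢ H

  record Edited (u v : ℕ) (b : Bool) (V V′ : Mem) : Set where
    field
      on  : ∀ {a c} → a < n → c < n → Pair u v a c → apart? V′ a c ≡ b
      off : ∀ {a c} → a < n → c < n → ¬ Pair u v a c → apart? V′ a c ≡ apart? V a c

  pair? : ∀ u v a c → Dec (Pair u v a c)
  pair? u v a c = ((a ≟ u) ×-dec (c ≟ v)) ⊎-dec ((a ≟ v) ×-dec (c ≟ u))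

  pair-flip : ∀ {u v a c} → Pair u v a c → Pair u v c a
  pair-flip (inj₁ (p , q)) = inj₂ (q , p)
  pair-flip (inj₂ (p , q)) = inj₁ (q , p)

  apart⇒≡0 : ∀ {V a c} → apart? V a c ≡ true → pos V a c ≡ 0
  apart⇒≡0 {V} {a} {c} p = ≡ᵇ⇒≡ (pos V a c) 0 (subst T (sym p) tt)

  ≡0⇒apart : ∀ {V a c} → pos V a c ≡ 0 → apart? V a c ≡ true
  ≡0⇒apart p = cong (_≡ᵇ 0) p

  edited-symmetric : ∀ {u v b V V′} → Maintained V → Edited u v b V V′ →
    ∀ {a c} → a < n → c < n → apart? V′ a c ≡ apart? V′ c a
  edited-symmetric {u} {v} mt ed {a} {c} a<n c<n with pair? u v a c
  ... | yes p = trans (Edited.on ed a<n c<n p) (sym (Edited.on ed c<n a<n (pair-flip p)))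
  ... | no ¬p = trans (Edited.off ed a<n c<n ¬p) (trans (Maintained.symmetric mt a<n c<n)
    (sym (Edited.off ed c<n a<n (¬p ∘ pair-flip))))

  edited-irreflexive : ∀ {u v b V V′} → u ≢ v → Maintained V → Edited u v b V V′ →
    ∀ {a} → a < n → pos V′ a a ≡ 0
  edited-irreflexive {u} {v} {V = V} {V′} u≢v mt ed {a} a<n = apart⇒≡0 {V′}
    (trans (Edited.off ed a<n a<n out) (≡0⇒apart {V} (Maintained.irreflexive mt a<n)))
    where
    out : ¬ Pair u v a a
    out (inj₁ (refl , e)) = u≢v e
    out (inj₂ (refl , e)) = u≢v (sym e)

  Maintained-cong : ∀ {V V′} → (∀ t → t ≢ 1 → t ≢ 2 → V′ t ≡ V t) → Maintained V → Maintained V′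
  Maintained-cong {V} {V′} f mt = record
    { buckets = Buckets-cong (f 5 (λ ()) λ ()) (f 6 (λ ()) λ ()) (f 7 (λ ()) λ ()) (f 8 (λ ()) λ ()) M.buckets
    ; colors< = colors<′ ; symmetric = symmetric′ ; irreflexive = irreflexive′ ; consistent = consistent′ }
    where
    module M = Maintained mt
    p₀ = f 0 (λ ()) (λ ())
    p₆ = f 6 (λ ()) (λ ())
    p₇ = f 7 (λ ()) (λ ())
    colors<′ : ∀ {a} → a < n → col V′ a < place H
    colors<′ rewrite p₀ = M.colors<
    symmetric′ : ∀ {a c} → a < n → c < n → apart? V′ a c ≡ apart? V′ c a
    symmetric′ rewrite p₆ = M.symmetric
    irreflexive′ : ∀ {a} → a < n → pos V′ a a ≡ 0
    irreflexive′ rewrite p₆ = M.irreflexive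
    consistent′ : ∀ {a c} → a < n → c < n → pos V′ a c ≢ 0 → lev V′ a c ≡ level H (col V′ a) (col V′ c)
    consistent′ rewrite p₀ | p₆ | p₇ = M.consistent

  Proper-cong : ∀ {V V′} → V′ 6 ≡ V 6 → V′ 7 ≡ V 7 → Proper V → Proper V′
  Proper-cong {V} {V′} p₆ p₇ pr {a} {c} a<n c<n ≢0 e =
    pr a<n c<n (λ z → ≢0 (trans (cong (λ f → f 0 a c) p₆) z)) (trans (sym (cong (λ f → f 0 a c) p₇)) e)

  potential-cong : ∀ {V V′} → V′ 5 ≡ V 5 → potential V′ ≡ potential V
  potential-cong p = cong (λ f → sum n (λ u → sum (suc H) (λ j → j * f 0 u j))) p

  deletion-spec : ∀ {u v z₀ z₁ z₄ z₅ z₆ z₇ V} → Maintained V → Proper V →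
    u < n → v < n → u ≢ v → pos V u v ≢ 0 →
    WP deletion (z₀ ∷ z₁ ∷ u ∷ v ∷ z₄ ∷ z₅ ∷ z₆ ∷ z₇ ∷ []) V
      (λ _ V′ t → Maintained V′ × Proper V′ × Edited u v true V V′ ×
                  potential V′ ≤ potential V × t ≡ 0)
  deletion-spec {u} {v} {V = V} mt pr u<n v<n u≢v uv≢0 = wp⇒WP deletion
    ( _ , WP-map (λ { {_} {V₁} (r₁ , refl) → _ , WP-map (λ { {_} {V₂} (r₂ , refl) → finish r₁ r₂ })
          (removeHalf-spec {V = V₁} v<n u<n (Removed.buckets r₁)
            (apart-≢0 {V} {V₁} (Removed.others r₁ v<n u<n (inj₁ (u≢v ∘ sym))) (M.flip≢0 u<n v<n uv≢0))) })
        (removeHalf-spec {V = V} u<n v<n M.buckets uv≢0))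
    where
    module M = Maintained mt
    finish : ∀ {V₁ V₂} → Removed u v V V₁ → Removed v u V₁ V₂ →
             Maintained V₂ × Proper V₂ × Edited u v true V V₂ × potential V₂ ≤ potential V × 0 ≡ 0
    finish {V₁} {V₂} r₁ r₂ = record
      { buckets = Removed.buckets r₂
      ; colors< = λ {a} a<n → subst (_< place H) (sym (same-col a)) (M.colors< a<n)
      ; symmetric = edited-symmetric mt ed
      ; irreflexive = edited-irreflexive u≢v mt ed
      ; consistent = λ {a} {c} a<n c<n ac → trans (same-lev a c)
          (trans (M.consistent a<n c<n (back a<n c<n ac)) (sym (cong₂ (level H) (same-col a) (same-col c)))) }
      , (λ {a} {c} a<n c<n ac e → pr a<n c<n (back a<n c<n ac) (trans (sym (same-lev a c)) e))
      , ed
      , ≤-trans (m≤m+n (potential V₂) _) (≤-trans (≤-reflexive (Removed.paid r₂))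
          (≤-trans (m≤m+n (potential V₁) _) (≤-reflexive (Removed.paid r₁))))
      , refl
      where
      ed : Edited u v true V V₂
      ed = record { on = on′ ; off = λ a<n c<n out → trans
             (Removed.others r₂ a<n c<n (unequal (out ∘ inj₂))) (Removed.others r₁ a<n c<n (unequal (out ∘ inj₁))) }
        where
        on′ : ∀ {a c} → a < n → c < n → Pair u v a c → apart? V₂ a c ≡ true
        on′ a<n c<n (inj₁ (refl , refl)) = trans (Removed.others r₂ a<n c<n (inj₁ u≢v))
          (≡0⇒apart {V₁} (Removed.gone r₁))
        on′ a<n c<n (inj₂ (refl , refl)) = ≡0⇒apart {V₂} (Removed.gone r₂)
      same-col : ∀ a → col V₂ a ≡ col V a
      same-col a = trans (cong (λ f → f 0 0 a) (Removed.low r₂ 0 _)) (cong (λ f → f 0 0 a) (Removed.low r₁ 0 _))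
      same-lev : ∀ a c → lev V₂ a c ≡ lev V a c
      same-lev a c = trans (cong (λ f → f 0 a c) (Removed.levels r₂)) (cong (λ f → f 0 a c) (Removed.levels r₁))
      back : ∀ {a c} → a < n → c < n → pos V₂ a c ≢ 0 → pos V a c ≢ 0
      back {a} {c} a<n c<n ac with pair? u v a c
      ... | yes p = contradiction (apart⇒≡0 {V₂} (Edited.on ed a<n c<n p)) ac
      ... | no ¬p = apart-≢0 {V₂} {V} (sym (Edited.off ed a<n c<n ¬p)) ac

  -- `H` pays for computing the level of the new edge, `2 * H * A * (2 * H)` for the potential it
  -- brings at both endpoints, `H * (4 + 2 * A)` for the part of a recoloring that `charge` leaves
  -- over, and `s + L` for the tables.
  insertionCost updateCost : ℕ
  insertionCost = H + (2 * H * A * (2 * H) + H * (4 + 2 * A))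
  updateCost = s + L + insertionCost

  -- `deg` is asked of the memory with the new edge, because recoloring takes place there. As all
  -- older edges are proper, the new one is then the only edge of level `H`.
  insertion-spec : ∀ {u v z₀ z₁ z₅ z₆ z₇ V} → Maintained V → Proper V → Tables V →
    u < n → v < n → u ≢ v → pos V u v ≡ 0 →
    (∀ {V′} → Edited u v false V V′ → DegreeBound V′ u) →
    WP insertion (z₀ ∷ z₁ ∷ u ∷ v ∷ H ∷ z₅ ∷ z₆ ∷ z₇ ∷ []) V
      (λ _ V′ t → Maintained V′ × Proper V′ × Edited u v false V V′ ×
                  t + 2 * H * A * potential V′ ≤ 2 * H * A * potential V + insertionCost)
  insertion-spec {u} {v} {V = V} mt pr tb u<n v<n u≢v uv≡0 deg = wp⇒WP insertion
    ( (_ , _ , _ , <-trans u<n n<B) , (_ , _ , _ , <-trans v<n n<B) , _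
    , WP-map (λ { {e₀} {_} {t₀} (j≡ , refl , t₀≤) → _
    , WP-map (λ { {_} {V₁} (i₁ , refl) → _
    , WP-map (λ { {_} {V₂} (i₂ , refl) → _
        , (λ c → _ , WP-map (λ rc → recolored t₀≤ (subst (λ j → Inserted u v j V V₁) j≡ i₁)
                                  (subst (λ j → Inserted v u j V₁ V₂) j≡ i₂) rc)
                     (recolor-linked (subst (λ j → Inserted u v j V V₁) j≡ i₁)
                                  (subst (λ j → Inserted v u j V₁ V₂) j≡ i₂) (trans (sym j≡) (same≢0 c))))
        , (λ c → kept t₀≤ (subst (λ j → Inserted u v j V V₁) j≡ i₁)
                   (subst (λ j → Inserted v u j V₁ V₂) j≡ i₂) (same≡0 c ∘ trans j≡)) })
      (insertHalf-spec {V = V₁} v<n u<n (subst (_≤ H) (sym j≡) j≤H) (Inserted.buckets i₁) (flip-gone i₁)) })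
      (insertHalf-spec {V = V} u<n v<n (subst (_≤ H) (sym j≡) j≤H) M.buckets uv≡0) })
      (levelOf-spec {V = V} tb))
    where
    module M = Maintained mt
    j = level H (col V u) (col V v)
    j≤H : j ≤ H
    j≤H = level-≤ H (col V u) (col V v)
    vu≡0 : pos V v u ≡ 0
    vu≡0 = apart⇒≡0 {V} (trans (M.symmetric v<n u<n) (≡0⇒apart {V} uv≡0))
    flip-gone : ∀ {j V₁} → Inserted u v j V V₁ → pos V₁ v u ≡ 0
    flip-gone {V₁ = V₁} i₁ = apart⇒≡0 {V₁} (trans (Inserted.others i₁ v<n u<n (inj₁ (u≢v ∘ sym))) (≡0⇒apart {V} vu≡0))

    module Linked {V₁ V₂ : Mem} (i₁ : Inserted u v j V V₁) (i₂ : Inserted v u j V₁ V₂) where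
      ed : Edited u v false V V₂
      ed = record { on = on′ ; off = λ a<n c<n out → trans
             (Inserted.others i₂ a<n c<n (unequal (out ∘ inj₂))) (Inserted.others i₁ a<n c<n (unequal (out ∘ inj₁))) }
        where
        on′ : ∀ {a c} → a < n → c < n → Pair u v a c → apart? V₂ a c ≡ false
        on′ a<n c<n (inj₁ (refl , refl)) = trans (Inserted.others i₂ a<n c<n (inj₁ u≢v)) (≡ᵇ-≢ (Inserted.present i₁))
        on′ a<n c<n (inj₂ (refl , refl)) = ≡ᵇ-≢ (Inserted.present i₂)
      same-col : ∀ a → col V₂ a ≡ col V a
      same-col a = trans (cong (λ f → f 0 0 a) (Inserted.low i₂ 0 _)) (cong (λ f → f 0 0 a) (Inserted.low i₁ 0 _))
      lev-on : ∀ {a c} → Pair u v a c → lev V₂ a c ≡ j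
      lev-on (inj₁ (refl , refl)) = trans (Inserted.levels i₂ (inj₁ u≢v)) (Inserted.new i₁)
      lev-on (inj₂ (refl , refl)) = Inserted.new i₂
      lev-off : ∀ {a c} → ¬ Pair u v a c → lev V₂ a c ≡ lev V a c
      lev-off out = trans (Inserted.levels i₂ (unequal (out ∘ inj₂))) (Inserted.levels i₁ (unequal (out ∘ inj₁)))
      back : ∀ {a c} → a < n → c < n → ¬ Pair u v a c → pos V₂ a c ≢ 0 → pos V a c ≢ 0
      back a<n c<n out = apart-≢0 {V₂} {V} (sym (Edited.off ed a<n c<n out))
      uv≢0 : pos V₂ u v ≢ 0
      uv≢0 z = case trans (sym (Edited.on ed u<n v<n (inj₁ (refl , refl)))) (≡0⇒apart {V₂} z) of λ ()
      maintained : Maintained V₂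
      maintained = record
        { buckets = Inserted.buckets i₂
        ; colors< = λ {a} a<n → subst (_< place H) (sym (same-col a)) (M.colors< a<n)
        ; symmetric = edited-symmetric mt ed
        ; irreflexive = edited-irreflexive u≢v mt ed
        ; consistent = consistent′ }
        where
        consistent′ : ∀ {a c} → a < n → c < n → pos V₂ a c ≢ 0 → lev V₂ a c ≡ level H (col V₂ a) (col V₂ c)
        consistent′ {a} {c} a<n c<n ac rewrite same-col a | same-col c with pair? u v a c
        ... | yes (inj₁ (refl , refl)) = lev-on (inj₁ (refl , refl))
        ... | yes (inj₂ (refl , refl)) = trans (lev-on (inj₂ (refl , refl))) (level-sym H (col V u) (col V v))
        ... | no out = trans (lev-off out) (M.consistent a<n c<n (back a<n c<n out ac))
      grown : potential V₂ ≡ potential V + (j + j)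
      grown = trans (Inserted.paid i₂) (trans (cong (_+ j) (Inserted.paid i₁)) (+-assoc (potential V) j j))
      potential-≤ : 2 * H * A * potential V₂ ≤ 2 * H * A * potential V + 2 * H * A * (2 * H)
      potential-≤ = begin
        2 * H * A * potential V₂ ≡⟨ cong (2 * H * A *_) grown ⟩
        2 * H * A * (potential V + (j + j)) ≤⟨ *-monoʳ-≤ (2 * H * A) (+-monoʳ-≤ (potential V)
          (≤-trans (+-mono-≤ j≤H j≤H) (≤-reflexive (cong (H +_) (sym (+-identityʳ H)))))) ⟩
        2 * H * A * (potential V + 2 * H) ≡⟨ *-distribˡ-+ (2 * H * A) (potential V) (2 * H) ⟩
        2 * H * A * potential V + 2 * H * A * (2 * H) ∎
        where open ≤-Reasoning

    Result : Mem → ℕ → Set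
    Result V′ t = Maintained V′ × Proper V′ × Edited u v false V V′ ×
                  t + 2 * H * A * potential V′ ≤ 2 * H * A * potential V + insertionCost

    recolor-linked : ∀ {V₁ V₂} → Inserted u v j V V₁ → Inserted v u j V₁ V₂ → j ≡ H →
      WP recolor (u ∷ H ∷ 0 ∷ 0 ∷ 0 ∷ 0 ∷ []) V₂ (λ _ V₃ t → Recolored V₂ V₃ t)
    recolor-linked {V₁} {V₂} i₁ i₂ j≡H = recolor-spec K.maintained
      (record { places = λ {j} p → trans (cong (λ f → f 0 0 j) (trans (Inserted.low i₂ 1 _) (Inserted.low i₁ 1 _))) (places tb p)
              ; thresholds = λ {j} p → trans (cong (λ f → f 0 0 j) (trans (Inserted.low i₂ 2 _) (Inserted.low i₁ 2 _))) (thresholds tb p) })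
      (deg K.ed) u<n v<n K.uv≢0 (trans (K.lev-on (inj₁ (refl , refl))) j≡H) only
      where
      module K = Linked i₁ i₂
      only : ∀ {a c} → a < n → c < n → pos V₂ a c ≢ 0 → lev V₂ a c ≡ H → Pair u v a c
      only {a} {c} a<n c<n ac e with pair? u v a c
      ... | yes p = p
      ... | no out = contradiction (trans (sym (K.lev-off out)) e) (pr a<n c<n (K.back a<n c<n out ac))

    recolored : ∀ {t₀ V₁ V₂ V₃ t₃} → t₀ ≤ H → Inserted u v j V V₁ → Inserted v u j V₁ V₂ →
                Recolored V₂ V₃ t₃ → Result V₃ (t₀ + t₃)
    recolored {t₀} {V₁} {V₂} {V₃} {t₃} t₀≤ i₁ i₂ rc = R.maintained , R.proper
      , record { on = λ a<n c<n p → trans (R.same-adjacency a<n c<n) (Edited.on K.ed a<n c<n p)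
               ; off = λ a<n c<n p → trans (R.same-adjacency a<n c<n) (Edited.off K.ed a<n c<n p) }
      , (begin
          t₀ + t₃ + 2 * H * A * potential V₃     ≡⟨ +-assoc t₀ t₃ _ ⟩
          t₀ + (t₃ + 2 * H * A * potential V₃)   ≤⟨ +-mono-≤ t₀≤ R.paid ⟩
          H + (2 * H * A * potential V₂ + H * (4 + 2 * A))
            ≤⟨ +-monoʳ-≤ H (+-monoˡ-≤ (H * (4 + 2 * A)) K.potential-≤) ⟩
          H + (2 * H * A * potential V + 2 * H * A * (2 * H) + H * (4 + 2 * A))
            ≡⟨ rearrange H (2 * H * A * potential V) _ _ ⟩
          2 * H * A * potential V + insertionCost ∎)
      where
      open ≤-Reasoning
      module K = Linked i₁ i₂
      module R = Recolored rc
      rearrange : ∀ a b c d → a + (b + c + d) ≡ b + (a + (c + d))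
      rearrange = solve-∀

    kept : ∀ {t₀ V₁ V₂} → t₀ ≤ H → Inserted u v j V V₁ → Inserted v u j V₁ V₂ → j ≢ H →
           Result V₂ (t₀ + 0)
    kept {t₀} {V₁} {V₂} t₀≤ i₁ i₂ j≢H = K.maintained , proper′ , K.ed
      , (begin
          t₀ + 0 + 2 * H * A * potential V₂ ≤⟨ +-mono-≤ (≤-trans (≤-reflexive (+-identityʳ t₀)) t₀≤) K.potential-≤ ⟩
          H + (2 * H * A * potential V + 2 * H * A * (2 * H))
            ≡⟨ rearrange H (2 * H * A * potential V) _ ⟩
          2 * H * A * potential V + (H + 2 * H * A * (2 * H))
            ≤⟨ +-monoʳ-≤ (2 * H * A * potential V) (+-monoʳ-≤ H (m≤m+n _ (H * (4 + 2 * A)))) ⟩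
          2 * H * A * potential V + insertionCost ∎)
      where
      open ≤-Reasoning
      module K = Linked i₁ i₂
      rearrange : ∀ a b c → a + (b + c) ≡ b + (a + c)
      rearrange = solve-∀
      proper′ : Proper V₂
      proper′ {a} {c} a<n c<n ac e with pair? u v a c
      ... | yes p = j≢H (trans (sym (K.lev-on p)) e)
      ... | no out = pr a<n c<n (K.back a<n c<n out ac) (trans (sym (K.lev-off out)) e)

  -- Graphs and their representation in memory

  record Represents (G : Graph n) (V : Mem) : Set where
    field
      maintained : Maintained V
      proper     : Proper V
      linked     : ∀ {x y} → Adj G x y → pos V (toℕ x) (toℕ y) ≢ 0
      adjacent   : ∀ {x y} → pos V (toℕ x) (toℕ y) ≢ 0 → Adj G x y

  degree-bound : ∀ (G : Graph n) u {x} (f : Fin x → Fin n) → (∀ q → Adj G u (f q)) →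
                 (∀ {q r} → f q ≡ f r → q ≡ r) → x ≤ degree G u
  degree-bound G u {x} f adj inj = Fin.injective⇒≤ {f = index ∘ member} λ {q} {r} e → inj (begin
    f q                                     ≡⟨ lookup-index (member q) ⟩
    List.lookup neighbors (index (member q)) ≡⟨ cong (List.lookup neighbors) e ⟩
    List.lookup neighbors (index (member r)) ≡⟨ sym (lookup-index (member r)) ⟩
    f r                                     ∎)
    where
    open ≡-Reasoning
    neighbors = List.filter (adj? G u) (List.allFin n)
    member : ∀ q → f q ∈ neighbors
    member q = ∈-filter⁺ (adj? G u) (∈-allFin (f q)) (adj q)

  adjacency-bound : ∀ {G : Graph n} {V} (u : Fin n) → MaxDegree≤ Δ G →
    (∀ {y} → pos V (toℕ u) (toℕ y) ≢ 0 → Adj G u y) → DegreeBound V (toℕ u)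
  adjacency-bound {G} {V} u md adj x Y valid inj = ≤-trans
    (degree-bound G u f (λ q → adj (subst (λ y → pos V (toℕ u) y ≢ 0) (sym (Fin.toℕ-fromℕ< _))
      (proj₂ (valid (toℕ q) (Fin.toℕ<n q)))))
      λ {q} {r} e → Fin.toℕ-injective (inj _ _ (Fin.toℕ<n q) (Fin.toℕ<n r)
        (trans (sym (Fin.toℕ-fromℕ< _)) (trans (cong toℕ e) (Fin.toℕ-fromℕ< _)))))
    (md u)
    where
    f : Fin x → Fin n
    f q = fromℕ< (proj₁ (valid (toℕ q) (Fin.toℕ<n q)))

  pair⇒same : ∀ {u v x y : Fin n} → Pair (toℕ u) (toℕ v) (toℕ x) (toℕ y) → SamePair u v x y
  pair⇒same (inj₁ (p , q)) = inj₁ (Fin.toℕ-injective p , Fin.toℕ-injective q)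
  pair⇒same (inj₂ (p , q)) = inj₂ (Fin.toℕ-injective p , Fin.toℕ-injective q)

  same⇒pair : ∀ {u v x y : Fin n} → SamePair u v x y → Pair (toℕ u) (toℕ v) (toℕ x) (toℕ y)
  same⇒pair (inj₁ (refl , refl)) = inj₁ (refl , refl)
  same⇒pair (inj₂ (refl , refl)) = inj₂ (refl , refl)

  maintain-spec : ∀ {G V} (x : Update n) → Represents G V → Legal G x → MaxDegree≤ Δ (update x G) →
    WP maintain (Δ ∷ kind x ∷ source x ∷ target x ∷ 0 ∷ 0 ∷ 0 ∷ 0 ∷ []) V
      (λ _ V′ t → Represents (update x G) V′ ×
                  t + 2 * H * A * potential V′ ≤ 2 * H * A * potential V + updateCost)
  maintain-spec {G} {V} x good legal md = wp⇒WP maintain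
    ( _ , WP-map (λ { {e₀} {V₀} {t₀} (h≡ , tb , out , t₀≤) → after x legal md h≡ tb out t₀≤ }) (initialize-spec {0} {V}))
    where
    module I = Represents good
    Target : Update n → ℕ → Post 8
    Target x t₀ _ V′ t = Represents (update x G) V′ ×
      t₀ + t + 2 * H * A * potential V′ ≤ 2 * H * A * potential V + updateCost
    after : ∀ (x : Update n) → Legal G x → MaxDegree≤ Δ (update x G) →
      ∀ {h V₀ t₀} → h ≡ H → Tables V₀ → SameOutsideTables V V₀ → t₀ ≤ s + L →
      wp (cond (` 1F) deletion insertion)
        (Δ ∷ kind x ∷ source x ∷ target x ∷ h ∷ 0 ∷ 0 ∷ 0 ∷ []) V₀
        (Target x t₀)
    after x legal md {V₀ = V₀} {t₀} refl tb out t₀≤ = by-kind x legal md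
      where
      mt₀ : Maintained V₀
      mt₀ = Maintained-cong out I.maintained
      pr₀ : Proper V₀
      pr₀ = Proper-cong {V} {V₀} (out 6 (λ ()) λ ()) (out 7 (λ ()) λ ()) I.proper
      same-pos : ∀ a c → pos V₀ a c ≡ pos V a c
      same-pos a c = cong (λ f → f 0 a c) (out 6 (λ ()) λ ())
      linked₀ : ∀ {x y} → Adj G x y → pos V₀ (toℕ x) (toℕ y) ≢ 0
      linked₀ adj z = I.linked adj (trans (sym (same-pos _ _)) z)
      adjacent₀ : ∀ {x y} → pos V₀ (toℕ x) (toℕ y) ≢ 0 → Adj G x y
      adjacent₀ p = I.adjacent (λ z → p (trans (same-pos _ _) z))
      potential₀ : potential V₀ ≡ potential V
      potential₀ = potential-cong {V} {V₀} (out 5 (λ ()) λ ())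
      kept : ∀ {u v b V′ x y} → Edited u v b V₀ V′ → ¬ Pair u v (toℕ x) (toℕ y) →
             apart? V′ (toℕ x) (toℕ y) ≡ apart? V₀ (toℕ x) (toℕ y)
      kept {x = x} {y} ed = Edited.off ed (Fin.toℕ<n x) (Fin.toℕ<n y)
      by-kind : ∀ x → Legal G x → MaxDegree≤ Δ (update x G) →
        wp (cond (` 1F) deletion insertion)
          (Δ ∷ kind x ∷ source x ∷ target x ∷ H ∷ 0 ∷ 0 ∷ 0 ∷ []) V₀
          (Target x t₀)
      by-kind (delete u v) legal md = _ , (λ _ → WP⇒wp deletion {Q = Target (delete u v) t₀}
          (WP-map (λ { {V′ = V′} (mt′ , pr′ , ed , p≤ , refl) → represents′ {V′} mt′ pr′ ed , budget {V′} p≤ })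
            (deletion-spec {z₀ = Δ} {1} {H} {0} {0} {0} {V = V₀} mt₀ pr₀ (Fin.toℕ<n u) (Fin.toℕ<n v) (u≢v ∘ Fin.toℕ-injective) (linked₀ legal))))
        , λ ()
        where
        u≢v : u ≢ v
        u≢v refl = irrefl G legal
        represents′ : ∀ {V′} → Maintained V′ → Proper V′ → Edited (toℕ u) (toℕ v) true V₀ V′ →
                Represents (update (delete u v) G) V′
        represents′ {V′} mt′ pr′ ed = record
          { maintained = mt′ ; proper = pr′
          ; linked = λ (adj , out) → apart-≢0 {V₀} {V′} (kept ed (out ∘ pair⇒same)) (linked₀ adj)
          ; adjacent = adjacent′ }
          where
          adjacent′ : ∀ {x y} → pos V′ (toℕ x) (toℕ y) ≢ 0 → Adj G x y × ¬ SamePair u v x y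
          adjacent′ {x} {y} xy with pair? (toℕ u) (toℕ v) (toℕ x) (toℕ y)
          ... | yes p = contradiction (apart⇒≡0 {V′} (Edited.on ed (Fin.toℕ<n x) (Fin.toℕ<n y) p)) xy
          ... | no ¬p = adjacent₀ (apart-≢0 {V′} {V₀} (sym (kept ed ¬p)) xy) , ¬p ∘ same⇒pair
        budget : ∀ {V′} → potential V′ ≤ potential V₀ →
                 t₀ + 0 + 2 * H * A * potential V′ ≤ 2 * H * A * potential V + updateCost
        budget {V′} p≤ = begin
          t₀ + 0 + 2 * H * A * potential V′ ≤⟨ +-mono-≤ (≤-trans (≤-reflexive (+-identityʳ t₀)) t₀≤)
            (*-monoʳ-≤ (2 * H * A) (≤-trans p≤ (≤-reflexive potential₀))) ⟩
          s + L + 2 * H * A * potential V   ≡⟨ +-comm (s + L) _ ⟩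
          2 * H * A * potential V + (s + L) ≤⟨ +-monoʳ-≤ (2 * H * A * potential V) (m≤m+n (s + L) insertionCost) ⟩
          2 * H * A * potential V + updateCost ∎
          where open ≤-Reasoning
      by-kind (insert u v u≢v) legal md = _ , (λ nz → contradiction refl nz) , λ _ → WP⇒wp insertion {Q = Target (insert u v u≢v) t₀}
          (WP-map (λ { {V′ = V′} {t} (mt′ , pr′ , ed , p≤) → represents′ {V′} mt′ pr′ ed , budget {V′} t p≤ })
            (insertion-spec {z₀ = Δ} {0} {0} {0} {0} {V = V₀} mt₀ pr₀ tb (Fin.toℕ<n u) (Fin.toℕ<n v) (u≢v ∘ Fin.toℕ-injective) uv≡0
              (λ {V′} ed → adjacency-bound {update (insert u v u≢v) G} {V′} u md (adjacent′ ed))))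
        where
        uv≡0 : pos V₀ (toℕ u) (toℕ v) ≡ 0
        uv≡0 with pos V₀ (toℕ u) (toℕ v) ≟ 0
        ... | yes p = p
        ... | no ¬p = contradiction (adjacent₀ ¬p) legal
        adjacent′ : ∀ {V′} → Edited (toℕ u) (toℕ v) false V₀ V′ →
                    ∀ {x y} → pos V′ (toℕ x) (toℕ y) ≢ 0 → Adj G x y ⊎ SamePair u v x y
        adjacent′ {V′} ed {x} {y} xy with pair? (toℕ u) (toℕ v) (toℕ x) (toℕ y)
        ... | yes p = inj₂ (pair⇒same p)
        ... | no ¬p = inj₁ (adjacent₀ (apart-≢0 {V′} {V₀} (sym (kept ed ¬p)) xy))
        represents′ : ∀ {V′} → Maintained V′ → Proper V′ → Edited (toℕ u) (toℕ v) false V₀ V′ →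
                Represents (update (insert u v u≢v) G) V′
        represents′ {V′} mt′ pr′ ed = record
          { maintained = mt′ ; proper = pr′ ; linked = linked′ ; adjacent = adjacent′ ed }
          where
          linked′ : ∀ {x y} → Adj G x y ⊎ SamePair u v x y → pos V′ (toℕ x) (toℕ y) ≢ 0
          linked′ {x} {y} adj with pair? (toℕ u) (toℕ v) (toℕ x) (toℕ y) | adj
          ... | yes p | _ = λ z → case trans (sym (Edited.on ed (Fin.toℕ<n x) (Fin.toℕ<n y) p)) (≡0⇒apart {V′} z) of λ ()
          ... | no ¬p | inj₁ a = apart-≢0 {V₀} {V′} (kept ed ¬p) (linked₀ a)
          ... | no ¬p | inj₂ p = contradiction (same⇒pair p) ¬p
        budget : ∀ {V′} t → t + 2 * H * A * potential V′ ≤ 2 * H * A * potential V₀ + insertionCost →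
                 t₀ + t + 2 * H * A * potential V′ ≤ 2 * H * A * potential V + updateCost
        budget {V′} t p≤ = begin
          t₀ + t + 2 * H * A * potential V′   ≡⟨ +-assoc t₀ t _ ⟩
          t₀ + (t + 2 * H * A * potential V′) ≤⟨ +-mono-≤ t₀≤ p≤ ⟩
          s + L + (2 * H * A * potential V₀ + insertionCost)
            ≡⟨ cong (λ p → s + L + (2 * H * A * p + insertionCost)) potential₀ ⟩
          s + L + (2 * H * A * potential V + insertionCost)
            ≡⟨ rearrange (s + L) (2 * H * A * potential V) insertionCost ⟩
          2 * H * A * potential V + updateCost ∎
          where
          open ≤-Reasoning
          rearrange : ∀ a b c → a + (b + c) ≡ b + (a + c)
          rearrange = solve-∀

-- The machine program

-- Register 5 receives the base `2 + n + Δ`, and the frame from register 6 on receives `Δ` and the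
-- announced update. Registers 10 to 13 are cleared because they may hold values from an earlier
-- update.
prelude : List Instr
prelude =
    const 5 2 ∷ calc add 5 5 0 ∷ calc add 5 5 1
  ∷ copy 6 1 ∷ copy 7 2 ∷ copy 8 3 ∷ copy 9 4
  ∷ const 10 0 ∷ const 11 0 ∷ const 12 0 ∷ const 13 0 ∷ []

opaque
  programFor : Cmd 8 → Program
  programFor c = prelude ++ compile 6 11 c

  rateFor : Cmd 8 → ℕ
  rateFor c = 11 + weight 6 c

n≤2^⌈log₂n⌉ : ∀ n → n ≤ 2 ^ ⌈log₂ n ⌉
n≤2^⌈log₂n⌉ = <-rec _ go
  where
  go : ∀ n → (∀ {m} → m < n → m ≤ 2 ^ ⌈log₂ m ⌉) → n ≤ 2 ^ ⌈log₂ n ⌉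
  go 0 rec = z≤n
  go 1 rec = m^n>0 2 ⌈log₂ 1 ⌉
  go n@(suc (suc m)) rec = begin
    n                                ≡⟨ sym (⌊n/2⌋+⌈n/2⌉≡n n) ⟩
    ⌊ n /2⌋ + ⌈ n /2⌉                ≤⟨ +-monoˡ-≤ ⌈ n /2⌉ (⌊n/2⌋≤⌈n/2⌉ n) ⟩
    ⌈ n /2⌉ + ⌈ n /2⌉                ≡⟨ cong (⌈ n /2⌉ +_) (sym (+-identityʳ ⌈ n /2⌉)) ⟩
    2 * ⌈ n /2⌉                      ≤⟨ *-monoʳ-≤ 2 (rec (⌈n/2⌉<n m)) ⟩
    2 * 2 ^ ⌈log₂ ⌈ n /2⌉ ⌉          ≡⟨ cong (λ k → 2 ^ suc k) (⌈log₂⌈n/2⌉⌉≡⌈log₂n⌉∸1 n) ⟩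
    2 ^ suc (⌈log₂ n ⌉ ∸ 1)          ≡⟨ cong (2 ^_) (m+[n∸m]≡n
      (≤-trans (≤-reflexive (sym (⌈log₂2^n⌉≡n 1))) (⌈log₂⌉-mono-≤ {2} {n} (s≤s (s≤s z≤n))))) ⟩
    2 ^ ⌈log₂ n ⌉                    ∎
    where open ≤-Reasoning

-- The origin of the word size factor 7: `16 ≤ B ^ 4` turns the room for 16 three-dimensional arrays
-- into `B ^ 7`.
seven-words : ∀ {B l} → 2 ≤ B → B ≤ 2 ^ l → 16 * B * B * B ≤ 2 ^ (7 * l)
seven-words {B} {l} 2≤B B≤ = begin
  16 * B * B * B                     ≤⟨ *-monoˡ-≤ B (*-monoˡ-≤ B (*-monoˡ-≤ B 16≤)) ⟩
  B * B * B * B * B * B * B          ≡⟨ seventh B ⟩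
  B ^ 7                              ≤⟨ ^-monoˡ-≤ 7 B≤ ⟩
  (2 ^ l) ^ 7                        ≡⟨ ^-*-assoc 2 l 7 ⟩
  2 ^ (l * 7)                        ≡⟨ cong (2 ^_) (*-comm l 7) ⟩
  2 ^ (7 * l)                        ∎
  where
  open ≤-Reasoning
  16≤ : 16 ≤ B * B * B * B
  16≤ = *-mono-≤ (*-mono-≤ (*-mono-≤ 2≤B 2≤B) 2≤B) 2≤B
  seventh : ∀ b → b * b * b * b * b * b * b ≡ b * (b * (b * (b * (b * (b * (b * 1))))))
  seventh = solve-∀

opaque
  word-room : ∀ n Δ → 16 * (2 + n + Δ) * (2 + n + Δ) * (2 + n + Δ) ≤ 2 ^ wordSize 7 n Δ
  word-room n Δ = seven-words {l = ⌈log₂ 2 + n + Δ ⌉} (s≤s (s≤s z≤n)) (n≤2^⌈log₂n⌉ (2 + n + Δ))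

-- Running the program on one announced update

module Loader (c : Cmd 8) (n Δ w B : ℕ) (B≡ : 2 + n + Δ ≡ B) (2≤B : 2 ≤ B)
              (room : 16 * B * B * B ≤ 2 ^ w) where

  open Semantics (2 ^ w) B
  open Simulation (programFor c) w B 2≤B room using (_≈_; represents; at; Matches; matches; truncate-<) public
  open Correctness (programFor c) w B 2≤B room using (simulate; simulated)

  record Ready (V : Mem) (st : State) : Set where
    constructor ready
    field
      reg-n  : reg st 0 ≡ n
      reg-Δ  : reg st 1 ≡ Δ
      memory : mem st ≈ V

  truncate-0 : truncate w 0 ≡ 0
  truncate-0 = truncate-< (m^n>0 2 w)

  B<W : B < 2 ^ w
  B<W = <-≤-trans (begin-strict
    B                <⟨ m<m*n B 16 {{B≢0}} (s≤s (s≤s z≤n)) ⟩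
    B * 16           ≡⟨ *-comm B 16 ⟩
    16 * B           ≤⟨ m≤m*n (16 * B) B {{B≢0}} ⟩
    16 * B * B       ≤⟨ m≤m*n (16 * B * B) B {{B≢0}} ⟩
    16 * B * B * B   ∎) room
    where
    open ≤-Reasoning
    B≢0 = >-nonZero (<-≤-trans (s≤s z≤n) 2≤B)

  after-prelude : (Reg → ℕ) → Reg → ℕ
  after-prelude R = (((R₇ [ 10 ↦ truncate w 0 ]) [ 11 ↦ truncate w 0 ]) [ 12 ↦ truncate w 0 ]) [ 13 ↦ truncate w 0 ]
    where
    R₁ = R [ 5 ↦ truncate w 2 ]
    R₂ = R₁ [ 5 ↦ truncate w (R₁ 5 + R₁ 0) ]
    R₃ = R₂ [ 5 ↦ truncate w (R₂ 5 + R₂ 1) ]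
    R₄ = R₃ [ 6 ↦ R₃ 1 ]
    R₅ = R₄ [ 7 ↦ R₄ 2 ]
    R₆ = R₅ [ 8 ↦ R₅ 3 ]
    R₇ = R₆ [ 9 ↦ R₆ 4 ]

  opaque
    unfolding programFor rateFor

    prelude-steps : ∀ R M → Steps (programFor c) w ⟨ 0 , R , M ⟩ 11 ⟨ 11 , after-prelude R , M ⟩
    prelude-steps R M = next refl (next refl (next refl (next refl (next refl (next refl
      (next refl (next refl (next refl (next refl (next refl halt))))))))))

    body-at : At (programFor c) 11 (compile 6 11 c)
    body-at = proj₂ (At-++ 0 prelude (At-self (programFor c)))

    end-of-program : fetch (programFor c) (csize 6 c + 11) ≡ nothing
    end-of-program = trans (cong (fetch (programFor c))
      (trans (+-comm (csize 6 c) 11) (cong (11 +_) (length-compile 6 0 11 c))))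
      (fetch-end (programFor c))

    rate-covers : ∀ {t k} → t ≤ weight 6 c * suc k → 11 + t ≤ rateFor c * suc k
    rate-covers {t} {k} t≤ = begin
      11 + t                           ≤⟨ +-mono-≤ (m≤m*n 11 (suc k)) t≤ ⟩
      11 * suc k + weight 6 c * suc k  ≡⟨ sym (*-distribʳ-+ (suc k) 11 (weight 6 c)) ⟩
      (11 + weight 6 c) * suc k        ∎
      where open ≤-Reasoning

  prelude-matches : ∀ {R k u v} → R 0 ≡ n → R 1 ≡ Δ → R 2 ≡ k → R 3 ≡ u → R 4 ≡ v →
    Matches 6 (Δ ∷ k ∷ u ∷ v ∷ 0 ∷ 0 ∷ 0 ∷ 0 ∷ []) (after-prelude R)
  prelude-matches {R} n≡ Δ≡ k≡ u≡ v≡ = matches local base-sum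
    where
    local : ∀ x → after-prelude R (6 + toℕ x) ≡ lookup (Δ ∷ _ ∷ _ ∷ _ ∷ 0 ∷ 0 ∷ 0 ∷ 0 ∷ []) x
    local 0F = Δ≡
    local 1F = k≡
    local 2F = u≡
    local 3F = v≡
    local 4F = truncate-0
    local 5F = truncate-0
    local 6F = truncate-0
    local 7F = truncate-0
    2+n≤B : 2 + n ≤ B
    2+n≤B = subst (2 + n ≤_) B≡ (m≤m+n (2 + n) Δ)
    base-sum : truncate w (truncate w (truncate w 2 + R 0) + R 1) ≡ B
    base-sum rewrite n≡ | Δ≡ | truncate-< {2} (≤-<-trans 2≤B B<W)
                   | truncate-< {2 + n} (≤-<-trans 2+n≤B B<W) | B≡ = truncate-< B<W

  announced : Update n → State → State
  announced x st = ⟨ 0 , ((reg st [ 2 ↦ kind x ]) [ 3 ↦ source x ]) [ 4 ↦ target x ] , mem st ⟩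

  announce-≡ : ∀ x st → announced x st ≡ announce x st
  announce-≡ (insert u v _) st = refl
  announce-≡ (delete u v)   st = refl

  record Loaded (x : Update n) (V′ : Mem) (k : ℕ) (st : State) : Set where
    constructor loaded
    field
      {time}  : ℕ
      {st′}   : State
      halts   : Halts (programFor c) w (announce x st) time st′
      isReady : Ready V′ st′
      bounded : time ≤ rateFor c * suc k

  load-and-run : ∀ {x V e′ V′ k st} → Ready V st →
    Exec c (Δ ∷ kind x ∷ source x ∷ target x ∷ 0 ∷ 0 ∷ 0 ∷ 0 ∷ []) V e′ V′ k →
    Loaded x V′ k st
  load-and-run {x} {V} {e′} {V′} {k} {st} (ready n≡ Δ≡ m≈) ex
    with simulate c {6} {11} {R = after-prelude (reg (announced x st))} {mem st} ≤-refl ex body-at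
           (prelude-matches {reg (announced x st)} n≡ Δ≡ refl refl refl) m≈
  ... | simulated {R′} {M′} {t} steps _ agree m≈′ t≤ = loaded
    (subst (λ st₀ → Halts (programFor c) w st₀ (11 + t) ⟨ csize 6 c + 11 , R′ , M′ ⟩) (announce-≡ x st)
      (Steps-halts (Steps-trans (prelude-steps (reg (announced x st)) (mem st)) steps) end-of-program))
    (ready (trans (agree 0 (s≤s z≤n)) n≡) (trans (agree 1 (s≤s (s≤s z≤n))) Δ≡) m≈′)
    (rate-covers t≤)

program : Program
program = programFor maintain

rate : ℕ
rate = rateFor maintain

-- A run with `k` counted iterations takes at most `rate * suc k` machine steps; hence the `suc`
-- around the amortized number of iterations.
colors timeBound : ℕ → ℕ
colors Δ = Levels.place Δ (Levels.H Δ)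
timeBound Δ = rate * suc (s + L + (H + (2 * H * A * (2 * H) + H * (4 + 2 * A))))
  where open Levels Δ

-- Amortization over a sequence of updates

module Dynamic (n Δ : ℕ) where

  w = wordSize 7 n Δ
  B = 2 + n + Δ

  room : 16 * B * B * B ≤ 2 ^ w
  room = word-room n Δ

  open Loader maintain n Δ w B refl (s≤s (s≤s z≤n)) room
  open Levels Δ
  open Semantics (2 ^ w) B
  open Structure n Δ (2 ^ w) room

  scaled : Mem → ℕ
  scaled V = 2 * H * A * potential V

  record Updated (x : Update n) (G : Graph n) (V : Mem) (st : State) : Set₁ where
    constructor updated
    field
      {time}   : ℕ
      {st′}    : State
      {memory} : Mem
      halts    : Halts program w (announce x st) time st′
      good     : Represents (update x G) memory
      isReady  : Ready memory st′
      paid     : time + rate * scaled memory ≤ rate * scaled V + rate * suc updateCost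

  one-update : ∀ {G V st} (x : Update n) → Legal G x → MaxDegree≤ Δ (update x G) →
    Represents G V → Ready V st → Updated x G V st
  one-update {G} {V} {st} x legal md good rd = execute (maintain-spec x good legal md)
    where
    finish : ∀ {V′ k} → Represents (update x G) V′ → k + scaled V′ ≤ scaled V + updateCost →
             Loaded x V′ k st → Updated x G V st
    finish {V′} {k} represents′ paid (loaded {t} h rd′ t≤) = updated h represents′ rd′ (begin
      t + rate * scaled V′               ≤⟨ +-monoˡ-≤ (rate * scaled V′) t≤ ⟩
      rate * suc k + rate * scaled V′    ≡⟨ sym (*-distribˡ-+ rate (suc k) (scaled V′)) ⟩
      rate * suc (k + scaled V′)         ≤⟨ *-monoʳ-≤ rate (s≤s paid) ⟩
      rate * suc (scaled V + updateCost) ≡⟨ cong (rate *_) (sym (+-suc (scaled V) updateCost)) ⟩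
      rate * (scaled V + suc updateCost) ≡⟨ *-distribˡ-+ rate (scaled V) (suc updateCost) ⟩
      rate * scaled V + rate * suc updateCost ∎)
      where open ≤-Reasoning
    execute : WP maintain (Δ ∷ kind x ∷ source x ∷ target x ∷ 0 ∷ 0 ∷ 0 ∷ 0 ∷ []) V
                (λ _ V′ t → Represents (update x G) V′ × t + scaled V′ ≤ scaled V + updateCost) →
              Updated x G V st
    execute (_ , V′ , k , ex , represents′ , paid) = finish {V′} {k} represents′ paid (load-and-run {x} rd ex)

  record Finished (xs : List (Update n)) (G : Graph n) (V : Mem) (st : State) : Set₁ where
    constructor finished
    field
      {time}   : ℕ
      {st′}    : State
      {memory} : Mem
      runs     : Run program w st xs time st′
      good     : Represents (updates xs G) memory
      isReady  : Ready memory st′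
      paid     : time + rate * scaled memory ≤ rate * scaled V + rate * suc updateCost * length xs

  -- The sum telescopes: intermediate potentials cancel and only the first and the last one remain.
  all-updates : ∀ {G V st} xs → Admissible Δ G xs → Represents G V → Ready V st → Finished xs G V st
  all-updates [] _ good rd = finished [] good rd (m≤m+n _ _)
  all-updates {G} {V} {st} (x ∷ xs) (legal , md , adm) good rd =
    continue (one-update {G} {V} {st} x legal md good rd)
    where
    c = rate * suc updateCost
    append : (u : Updated x G V st) →
             Finished xs (update x G) (Updated.memory u) (Updated.st′ u) → Finished (x ∷ xs) G V st
    append (updated {t₁} {_} {V₁} h _ _ paid₁) (finished {t₂} {_} {V₂} r good₂ rd₂ paid₂) =
      finished (h ∷ r) good₂ rd₂ (begin
        t₁ + t₂ + rate * scaled V₂              ≡⟨ +-assoc t₁ t₂ _ ⟩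
        t₁ + (t₂ + rate * scaled V₂)            ≤⟨ +-monoʳ-≤ t₁ paid₂ ⟩
        t₁ + (rate * scaled V₁ + c * length xs) ≡⟨ sym (+-assoc t₁ _ _) ⟩
        t₁ + rate * scaled V₁ + c * length xs   ≤⟨ +-monoˡ-≤ (c * length xs) paid₁ ⟩
        rate * scaled V + c + c * length xs     ≡⟨ +-assoc (rate * scaled V) c _ ⟩
        rate * scaled V + (c + c * length xs)   ≡⟨ cong (rate * scaled V +_) (sym (*-suc c (length xs))) ⟩
        rate * scaled V + c * suc (length xs)   ∎)
      where open ≤-Reasoning
    continue : Updated x G V st → Finished (x ∷ xs) G V st
    continue u = append u (all-updates xs adm (Updated.good u) (Updated.isReady u))

  blank : Mem
  blank _ _ _ _ = 0

  represents-blank : Represents (edgeless n) blank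
  represents-blank = record
    { maintained = record
      { buckets = record
        { entry = λ _ 1≤i i≤0 → contradiction (≤-trans 1≤i i≤0) λ ()
        ; slot  = λ _ _ p → contradiction refl p }
      ; colors< = λ _ → >-nonZero⁻¹ (place H) {{place≢0 H}}
      ; symmetric = λ _ _ → refl ; irreflexive = λ _ → refl
      ; consistent = λ _ _ p → contradiction refl p }
    ; proper = λ _ _ p → contradiction refl p
    ; linked = λ () ; adjacent = λ p → contradiction refl p }

  potential-blank : potential blank ≡ 0
  potential-blank = trans (sum-cong n (λ _ _ → trans (sum-cong (suc H) (λ j _ → *-zeroʳ j)) (all-zero (suc H))))
                          (all-zero n)
    where
    all-zero : ∀ m → sum m (λ _ → 0) ≡ 0
    all-zero m = trans (sum-const m 0) (*-zeroʳ m)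

  maintains : ∀ xs → Admissible Δ (edgeless n) xs → ∃[ T ] ∃[ st ]
    Run program w (initial n Δ) xs T st ×
    ProperColoring (updates xs (edgeless n)) (colors Δ) (coloring st) ×
    T ≤ timeBound Δ * length xs
  maintains xs adm = conclude (all-updates {edgeless n} {blank} {initial n Δ} xs adm represents-blank
                                (ready refl refl (represents λ _ _ _ _ → refl)))
    where
    conclude : Finished xs (edgeless n) blank (initial n Δ) → ∃[ T ] ∃[ st ]
      Run program w (initial n Δ) xs T st ×
      ProperColoring (updates xs (edgeless n)) (colors Δ) (coloring st) ×
      T ≤ timeBound Δ * length xs
    conclude (finished {T} {st} {V} r good (ready _ _ m≈) paid) = T , st , r , (bounded , distinct) , (begin
      T                            ≤⟨ m≤m+n T _ ⟩
      T + rate * scaled V          ≤⟨ paid ⟩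
      -- The potential starts at 0, so the amortized bound holds without an additive term.
      rate * scaled blank + rate * suc updateCost * length xs
        ≡⟨ cong (_+ rate * suc updateCost * length xs) (trans (cong (rate *_)
             (trans (cong (2 * H * A *_) potential-blank) (*-zeroʳ (2 * H * A)))) (*-zeroʳ rate)) ⟩
      rate * suc updateCost * length xs ∎)
      where
      open ≤-Reasoning
      module I = Represents good
      module M = Maintained I.maintained
      toℕ<B : ∀ (x : Fin n) → toℕ x < B
      toℕ<B x = <-trans (Fin.toℕ<n x) n<B
      color-of : ∀ x → coloring st x ≡ col V (toℕ x)
      color-of x = at m≈ {0} {0} {0} {toℕ x} (s≤s z≤n) (s≤s z≤n) (s≤s z≤n) (toℕ<B x)
      bounded : ∀ x → coloring st x < place H
      bounded x = subst (_< place H) (sym (color-of x)) (M.colors< (Fin.toℕ<n x))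
      distinct : ∀ x y → Adj (updates xs (edgeless n)) x y → coloring st x ≢ coloring st y
      distinct x y adj e = I.proper (Fin.toℕ<n x) (Fin.toℕ<n y) (I.linked adj)
        (trans (M.consistent (Fin.toℕ<n x) (Fin.toℕ<n y) (I.linked adj))
          (level-top H (cong (λ c → residue c H) (trans (sym (color-of x)) (trans e (color-of y))))))

maintains-coloring : MaintainsColoring program 7 colors timeBound
maintains-coloring n Δ = Dynamic.maintains n Δ

-- Asymptotics

-- `suc (pred n)` is `n` except at 0, where the left side is 1.
2^⌊log₂n⌋≤ : ∀ n → 2 ^ ⌊log₂ n ⌋ ≤ suc (pred n)
2^⌊log₂n⌋≤ = <-rec _ go
  where
  go : ∀ n → (∀ {m} → m < n → 2 ^ ⌊log₂ m ⌋ ≤ suc (pred m)) → 2 ^ ⌊log₂ n ⌋ ≤ suc (pred n)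
  go 0 rec = ≤-reflexive (cong (2 ^_) (⌊log₂⌋-zero {0} z≤n))
  go 1 rec = ≤-reflexive (cong (2 ^_) (⌊log₂⌋-zero {1} ≤-refl))
  go n@(suc (suc m)) rec = begin
    2 ^ ⌊log₂ n ⌋                  ≡⟨ cong (2 ^_) (sym (m+[n∸m]≡n (⌊log₂⌋-pos {n} (s≤s (s≤s z≤n))))) ⟩
    2 ^ suc (⌊log₂ n ⌋ ∸ 1)        ≡⟨ cong (λ k → 2 ^ suc k) (sym (⌊log₂⌊n/2⌋⌋≡⌊log₂n⌋∸1 n)) ⟩
    2 * 2 ^ ⌊log₂ ⌊ n /2⌋ ⌋        ≤⟨ *-monoʳ-≤ 2 (rec (⌊n/2⌋<n (suc m))) ⟩
    2 * ⌊ n /2⌋                    ≡⟨ cong (⌊ n /2⌋ +_) (+-identityʳ ⌊ n /2⌋) ⟩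
    ⌊ n /2⌋ + ⌊ n /2⌋              ≤⟨ +-monoʳ-≤ ⌊ n /2⌋ (⌊n/2⌋≤⌈n/2⌉ n) ⟩
    ⌊ n /2⌋ + ⌈ n /2⌉              ≡⟨ ⌊n/2⌋+⌈n/2⌉≡n n ⟩
    n                              ∎
    where open ≤-Reasoning

-- Bounds in terms of iterated logarithms

module Estimates (Δ : ℕ) where

  open Levels Δ

  ℓ a : ℕ
  ℓ = ⌊log₂ Δ ⌋
  a = ⌊log₂ ℓ ⌋

  a≤ℓ : a ≤ ℓ
  a≤ℓ = ⌊log₂⌋≤ ℓ

  2^a≤s : 2 ^ a ≤ s
  2^a≤s = ≤-trans (2^⌊log₂n⌋≤ ℓ) (s≤s (≤-trans (pred[n]≤n {ℓ}) (n≤1+n ℓ)))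

  -- When `L > 0`, the last quotient is positive and `s ^ L ≤ Δ`; with `2 ^ a ≤ s` this gives `L` at
  -- most about `log Δ / log log Δ`.
  a*L≤ℓ : a * L ≤ ℓ
  a*L≤ℓ with L≡0⊎big
  ... | inj₁ p = ≤-trans (≤-reflexive (trans (cong (a *_) p) (*-zeroʳ a))) z≤n
  ... | inj₂ s<q = begin
    a * L                   ≡⟨ sym (⌊log₂[2^n]⌋≡n (a * L)) ⟩
    ⌊log₂ 2 ^ (a * L) ⌋     ≤⟨ ⌊log₂⌋-mono-≤ (begin
      2 ^ (a * L)           ≡⟨ sym (^-*-assoc 2 a L) ⟩
      (2 ^ a) ^ L           ≤⟨ ^-monoˡ-≤ L 2^a≤s ⟩
      s ^ L                 ≤⟨ m≤m*n (s ^ L) (quotient L) {{>-nonZero (≤-<-trans z≤n s<q)}} ⟩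
      s ^ L * quotient L    ≤⟨ quotient-pow L ⟩
      Δ                     ∎) ⟩
    ⌊log₂ Δ ⌋               ∎
    where open ≤-Reasoning

  -- Bernoulli's inequality `(1 - 2 / (2 + s)) ^ j ≥ 1 - 2 * j / (2 + s)` with denominators cleared.
  bernoulli : ∀ j → (2 + s) ^ j * (2 + s) ≤ s ^ j * (2 + s) + 2 * j * (2 + s) ^ j
  bernoulli zero = m≤m+n _ 0
  bernoulli (suc j) = begin
    N * N ^ j * N                              ≡⟨ *-assoc N (N ^ j) N ⟩
    N * (N ^ j * N)                            ≤⟨ *-monoʳ-≤ N (bernoulli j) ⟩
    N * (s ^ j * N + 2 * j * N ^ j)            ≡⟨ expand s (s ^ j) j (N ^ j) ⟩
    s * s ^ j * N + 2 * (s ^ j * N) + 2 * j * (N * N ^ j)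
      ≤⟨ +-monoˡ-≤ (2 * j * (N * N ^ j)) (+-monoʳ-≤ (s * s ^ j * N) (*-monoʳ-≤ 2
           (≤-trans (*-monoˡ-≤ N (^-monoˡ-≤ j (m≤n+m s 2))) (≤-reflexive (*-comm (N ^ j) N))))) ⟩
    s * s ^ j * N + 2 * (N * N ^ j) + 2 * j * (N * N ^ j)
      ≡⟨ collect (s * s ^ j * N) (N * N ^ j) j ⟩
    s * s ^ j * N + 2 * suc j * (N * N ^ j)    ∎
    where
    open ≤-Reasoning
    N = 2 + s
    expand : ∀ s p j q → (2 + s) * (p * (2 + s) + 2 * j * q) ≡
             s * p * (2 + s) + 2 * (p * (2 + s)) + 2 * j * ((2 + s) * q)
    expand = solve-∀
    collect : ∀ x y j → x + 2 * y + 2 * j * y ≡ x + 2 * suc j * y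
    collect = solve-∀

  -- From L / s ≤ 1 / a, (1 + 2 / s) ^ L is at most 1 / (1 - 2 / a).
  power-≤ : ∀ M → 3 * M + 2 ≤ a → 3 * M * (2 + s) ^ L ≤ (3 * M + 2) * s ^ L
  power-≤ M q≤a = *-cancelʳ-≤ _ _ N (+-cancelʳ-≤ (2 * (N ^ L * N)) _ _ (begin
    3 * M * N ^ L * N + 2 * (N ^ L * N)   ≡⟨ collect M (N ^ L) N ⟩
    q * (N ^ L * N)                       ≤⟨ *-monoʳ-≤ q (bernoulli L) ⟩
    q * (s ^ L * N + 2 * L * N ^ L)       ≡⟨ expand q (s ^ L) N L (N ^ L) ⟩
    q * s ^ L * N + 2 * (N ^ L * (q * L)) ≤⟨ +-monoʳ-≤ (q * s ^ L * N) (*-monoʳ-≤ 2 (*-monoʳ-≤ (N ^ L)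
      (≤-trans (*-monoˡ-≤ L q≤a) (≤-trans a*L≤ℓ (m≤n+m ℓ 4))))) ⟩
    q * s ^ L * N + 2 * (N ^ L * N)       ∎))
    where
    open ≤-Reasoning
    N = 2 + s
    q = 3 * M + 2
    collect : ∀ m p n → 3 * m * p * n + 2 * (p * n) ≡ (3 * m + 2) * (p * n)
    collect = solve-∀
    expand : ∀ q p n l r → q * (p * n + 2 * l * r) ≡ q * p * n + 2 * (r * (q * l))
    expand = solve-∀

  -- `power-≤` bounds `((2 + s) / s) ^ L` by `(3 * M + 2) / (3 * M)`, and the extra value of the
  -- last digit costs at most a factor `(s + 1) / s`, as `s < quotient L`. Since `3 * M + 2 ≤ s`,
  -- the product is at most `(M + 1) / M`. For `L = 0` there are `suc Δ` colors, and `M ≤ Δ`.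
  colors-≤ : ∀ M → 3 * M + 2 ≤ a → M * place H ≤ suc M * Δ
  colors-≤ M q≤a with L≡0⊎big
  ... | inj₁ p = begin
    M * place H            ≡⟨ cong (M *_) (cong₂ _*_ (trans radix-L (cong (suc ∘ quotient) p)) (cong place p)) ⟩
    M * (suc Δ * 1)        ≡⟨ rearrange M Δ ⟩
    M + M * Δ              ≤⟨ +-monoˡ-≤ (M * Δ) M≤Δ ⟩
    suc M * Δ              ∎
    where
    open ≤-Reasoning
    rearrange : ∀ m d → m * (suc d * 1) ≡ m + m * d
    rearrange = solve-∀
    M≤Δ : M ≤ Δ
    M≤Δ = ≤-trans (≤-trans (m≤n*m M 3) (m≤m+n (3 * M) 2)) (≤-trans q≤a (≤-trans a≤ℓ (⌊log₂⌋≤ Δ)))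
  ... | inj₂ s<t = *-cancelˡ-≤ (3 * s) (begin
    3 * s * (M * place H)                ≡⟨ cong (λ c → 3 * s * (M * c)) (cong₂ _*_ radix-L (place-pow L ≤-refl)) ⟩
    3 * s * (M * (suc t * (2 + s) ^ L))  ≡⟨ rearrange₁ s M t ((2 + s) ^ L) ⟩
    3 * M * (2 + s) ^ L * (s * suc t)    ≤⟨ *-mono-≤ (power-≤ M q≤a) (≤-trans (≤-reflexive (*-suc s t))
                                              (+-monoˡ-≤ (s * t) (<⇒≤ s<t))) ⟩
    q * s ^ L * (suc s * t)              ≡⟨ rearrange₂ q (s ^ L) s t ⟩
    (q + q * s) * (s ^ L * t)            ≤⟨ *-mono-≤ (+-monoˡ-≤ (q * s) (≤-trans q≤a (≤-trans a≤ℓ (m≤n+m ℓ 2)))) (quotient-pow L) ⟩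
    (s + q * s) * Δ                      ≡⟨ rearrange₃ s M Δ ⟩
    3 * s * (suc M * Δ)                  ∎)
    where
    open ≤-Reasoning
    t = quotient L
    q = 3 * M + 2
    rearrange₁ : ∀ s m t p → 3 * s * (m * (suc t * p)) ≡ 3 * m * p * (s * suc t)
    rearrange₁ = solve-∀
    rearrange₂ : ∀ q p s t → q * p * (suc s * t) ≡ (q + q * s) * (p * t)
    rearrange₂ = solve-∀
    rearrange₃ : ∀ s m d → (s + (3 * m + 2) * s) * d ≡ 3 * s * (suc m * d)
    rearrange₃ = solve-∀

  -- Each term is compared with `X = H * H * A`: four single ones, `4 * X` for the potential of a
  -- new edge, `4 * H` and `2 * (H * A)`, in all 14.
  cost-≤ : suc (s + L + (H + (2 * H * A * (2 * H) + H * (4 + 2 * A)))) ≤ 14 * (H * H * A)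
  cost-≤ = begin
    suc (s + L + (H + (2 * H * A * (2 * H) + H * (4 + 2 * A))))
      ≤⟨ +-mono-≤ 1≤X (+-mono-≤ (+-mono-≤ s≤X L≤X) (+-mono-≤ H≤X (≤-reflexive refl))) ⟩
    X + (X + X + (X + (2 * H * A * (2 * H) + H * (4 + 2 * A))))
      ≡⟨ collect X H A ⟩
    4 * X + 4 * (H * H * A) + (4 * H + 2 * (H * A))
      ≤⟨ +-monoʳ-≤ (4 * X + 4 * X) (+-mono-≤ (*-monoʳ-≤ 4 H≤X) (*-monoʳ-≤ 2 HA≤X)) ⟩
    4 * X + 4 * X + (4 * X + 2 * X)   ≡⟨ total X ⟩
    14 * X                            ∎
    where
    open ≤-Reasoning
    X = H * H * A
    instance
      A≢0 : NonZero A
      A≢0 = >-nonZero (s≤s z≤n)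
    HA≤X : H * A ≤ X
    HA≤X = *-monoˡ-≤ A (m≤m*n H H)
    H≤X : H ≤ X
    H≤X = ≤-trans (m≤m*n H A) HA≤X
    L≤X : L ≤ X
    L≤X = ≤-trans (n≤1+n L) H≤X
    s≤X : s ≤ X
    s≤X = ≤-trans (m≤m*n s (suc s)) (≤-trans (m≤n*m A H) HA≤X)
    1≤X : 1 ≤ X
    1≤X = ≤-trans (s≤s z≤n) H≤X
    collect : ∀ x h a → x + (x + x + (x + (2 * h * a * (2 * h) + h * (4 + 2 * a)))) ≡
              4 * x + 4 * (h * h * a) + (4 * h + 2 * (h * a))
    collect = solve-∀
    total : ∀ x → 4 * x + 4 * x + (4 * x + 2 * x) ≡ 14 * x
    total = solve-∀

  H*a≤ : H * a ≤ 2 * ℓ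
  H*a≤ = begin
    a + L * a    ≤⟨ +-mono-≤ a≤ℓ (≤-trans (≤-reflexive (*-comm L a)) a*L≤ℓ) ⟩
    ℓ + ℓ        ≡⟨ cong (ℓ +_) (sym (+-identityʳ ℓ)) ⟩
    2 * ℓ        ∎
    where open ≤-Reasoning

  A≤ : 2 ≤ ℓ → A ≤ 2 * ℓ * (3 * ℓ)
  A≤ 2≤ℓ = *-mono-≤ s≤ (begin
    suc s        ≤⟨ +-mono-≤ {1} {ℓ} (≤-trans (s≤s z≤n) 2≤ℓ) s≤ ⟩
    ℓ + 2 * ℓ    ∎)
    where
    open ≤-Reasoning
    s≤ : s ≤ 2 * ℓ
    s≤ = ≤-trans (+-monoˡ-≤ ℓ 2≤ℓ) (≤-reflexive (cong (ℓ +_) (sym (+-identityʳ ℓ))))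

  -- The factor `a ^ 2` absorbs one `a` for each `H` through `H * a ≤ 2 * ℓ`, and `A ≤ 6 * ℓ ^ 2`;
  -- the constant is `336 = 14 * 4 * 6`.
  time-≤ : 2 ≤ ℓ → timeBound Δ * a ^ 2 ≤ rate * 336 * ℓ ^ 4
  time-≤ 2≤ℓ = begin
    rate * suc (s + L + (H + (2 * H * A * (2 * H) + H * (4 + 2 * A)))) * (a * (a * 1))
      ≤⟨ *-monoˡ-≤ (a * (a * 1)) (*-monoʳ-≤ rate cost-≤) ⟩
    rate * (14 * (H * H * A)) * (a * (a * 1)) ≡⟨ rearrange₁ rate H A a ⟩
    rate * 14 * (H * a * (H * a) * A)
      ≤⟨ *-monoʳ-≤ (rate * 14) (*-mono-≤ (*-mono-≤ H*a≤ H*a≤) (A≤ 2≤ℓ)) ⟩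
    rate * 14 * (2 * ℓ * (2 * ℓ) * (2 * ℓ * (3 * ℓ))) ≡⟨ rearrange₂ rate ℓ ⟩
    rate * 336 * (ℓ * (ℓ * (ℓ * (ℓ * 1)))) ∎
    where
    open ≤-Reasoning
    rearrange₁ : ∀ r h a b → r * (14 * (h * h * a)) * (b * (b * 1)) ≡ r * 14 * (h * b * (h * b) * a)
    rearrange₁ = solve-∀
    rearrange₂ : ∀ r l → r * 14 * (2 * l * (2 * l) * (2 * l * (3 * l))) ≡ r * 336 * (l * (l * (l * (l * 1))))
    rearrange₂ = solve-∀

-- The vanishing terms and the final bounds

-- As `mkℚᵘ` takes the predecessor of the denominator, this is `(colors Δ ∸ Δ) / Δ` for positive
-- `Δ`, left unreduced so that its two parts stay visible.
excess : ℕ → ℚᵘ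
excess Δ = mkℚᵘ (⁺ (colors Δ ∸ Δ)) (pred Δ)

excess-vanishes : IsLittleO1 (λ Δ → fromℚᵘ (excess Δ))
excess-vanishes (mkℚ (⁺ zero)  q c) (ℚ.*<* (ℤ.+<+ ()))
excess-vanishes (mkℚ -[1+ p ] q c) (ℚ.*<* ())
-- Since `ε ≥ 1 / suc q`, it suffices to use `colors-≤` with `M = suc q`; the double power makes
-- `⌊log₂ ⌊log₂ Δ ⌋ ⌋` at least `3 * M + 2`.
excess-vanishes ε@(mkℚ (⁺ suc p) q c) _ = 2 ^ 2 ^ (3 * suc q + 2) , λ Δ D≤Δ →
  ℚ.toℚᵘ-cancel-≤ (ℚᵘ.≤-respˡ-≃ (ℚᵘ.≃-sym (abs-≃ Δ)) (ℚᵘ.*≤* (begin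
    ⁺ (colors Δ ∸ Δ) ℤ.* ⁺ suc q           ≡⟨ sym (ℤ.pos-* (colors Δ ∸ Δ) (suc q)) ⟩
    ⁺ ((colors Δ ∸ Δ) * suc q)             ≤⟨ ℤ.+≤+ (small-excess Δ D≤Δ) ⟩
    ⁺ (suc p * suc (pred Δ))               ≡⟨ ℤ.pos-* (suc p) (suc (pred Δ)) ⟩
    ⁺ suc p ℤ.* ⁺ suc (pred Δ)             ∎)))
  where
  open ℤ.≤-Reasoning
  abs-≃ : ∀ Δ → toℚᵘ ℚ.∣ fromℚᵘ (excess Δ) ∣ ℚᵘ.≃ excess Δ
  abs-≃ Δ = ℚᵘ.≃-trans (ℚ.toℚᵘ-homo-∣-∣ (fromℚᵘ (excess Δ)))
    (ℚᵘ.∣-∣-cong (ℚ.toℚᵘ-fromℚᵘ (excess Δ)))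
  large : ∀ Δ → 2 ^ 2 ^ (3 * suc q + 2) ≤ Δ → 3 * suc q + 2 ≤ Estimates.a Δ
  large Δ D≤Δ = subst (_≤ Estimates.a Δ) (⌊log₂[2^n]⌋≡n (3 * suc q + 2))
    (⌊log₂⌋-mono-≤ (subst (_≤ ⌊log₂ Δ ⌋) (⌊log₂[2^n]⌋≡n (2 ^ (3 * suc q + 2))) (⌊log₂⌋-mono-≤ D≤Δ)))
  small-excess : ∀ Δ → 2 ^ 2 ^ (3 * suc q + 2) ≤ Δ → (colors Δ ∸ Δ) * suc q ≤ suc p * suc (pred Δ)
  small-excess Δ D≤Δ = ≤-trans (≤-reflexive (*-comm (colors Δ ∸ Δ) (suc q))) (≤-trans
    (≤-reflexive (*-distribˡ-∸ (suc q) (colors Δ) Δ))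
    (≤-trans (m≤n+o⇒m∸n≤o (suc q * colors Δ) (suc q * Δ) (≤-trans (Estimates.colors-≤ Δ (suc q) (large Δ D≤Δ))
        (≤-reflexive (+-comm Δ (suc q * Δ)))))
      (≤-trans (suc-pred-≥ Δ) (m≤n*m (suc (pred Δ)) (suc p)))))
    where
    suc-pred-≥ : ∀ n → n ≤ suc (pred n)
    suc-pred-≥ zero    = z≤n
    suc-pred-≥ (suc n) = ≤-refl

few-colors : AtMost[1+o1]Δ colors
few-colors = (λ Δ → fromℚᵘ (excess Δ)) , excess-vanishes , bound
  where
  bound : ∀ Δ → 1 ≤ Δ → fromℕ (colors Δ) ℚ.≤ (1ℚ ℚ.+ fromℚᵘ (excess Δ)) ℚ.* fromℕ Δ
  bound Δ@(suc d) _ = ℚ.toℚᵘ-cancel-≤ (ℚᵘ.≤-respˡ-≃ (ℚᵘ.≃-sym (ℚ.toℚᵘ-fromℚᵘ (mkℚᵘ (⁺ c) 0)))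
    (ℚᵘ.≤-respʳ-≃ (ℚᵘ.≃-sym right) (ℚᵘ.*≤* (begin
      ⁺ c ℤ.* ⁺ (1 * Δ * 1)                 ≡⟨ sym (ℤ.pos-* c (1 * Δ * 1)) ⟩
      ⁺ (c * (1 * Δ * 1))                   ≤⟨ ℤ.+≤+ (≤-trans (*-monoˡ-≤ (1 * Δ * 1) (m≤n+m∸n c Δ)) (≤-reflexive (rearrange Δ k))) ⟩
      ⁺ ((1 * Δ + k * 1) * Δ * 1)           ≡⟨ ℤ.pos-* ((1 * Δ + k * 1) * Δ) 1 ⟩
      ⁺ ((1 * Δ + k * 1) * Δ) ℤ.* ⁺ 1       ≡⟨ cong (ℤ._* ⁺ 1) (ℤ.pos-* (1 * Δ + k * 1) Δ) ⟩
      ⁺ (1 * Δ + k * 1) ℤ.* ⁺ Δ ℤ.* ⁺ 1     ≡⟨ cong (λ z → z ℤ.* ⁺ Δ ℤ.* ⁺ 1)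
        (trans (ℤ.pos-+ (1 * Δ) (k * 1)) (cong₂ ℤ._+_ (ℤ.pos-* 1 Δ) (ℤ.pos-* k 1))) ⟩
      (⁺ 1 ℤ.* ⁺ Δ ℤ.+ ⁺ k ℤ.* ⁺ 1) ℤ.* ⁺ Δ ℤ.* ⁺ 1 ∎))))
    where
    open ℤ.≤-Reasoning
    c = colors Δ
    k = colors Δ ∸ Δ
    rearrange : ∀ d k → (d + k) * (1 * d * 1) ≡ (1 * d + k * 1) * d * 1
    rearrange = solve-∀
    right : toℚᵘ ((1ℚ ℚ.+ fromℚᵘ (excess Δ)) ℚ.* fromℕ Δ) ℚᵘ.≃
            (ℚᵘ.1ℚᵘ ℚᵘ.+ excess Δ) ℚᵘ.* mkℚᵘ (⁺ Δ) 0
    right = ℚᵘ.≃-trans (ℚ.toℚᵘ-homo-* (1ℚ ℚ.+ fromℚᵘ (excess Δ)) (fromℕ Δ))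
      (ℚᵘ.*-cong (ℚᵘ.≃-trans (ℚ.toℚᵘ-homo-+ 1ℚ (fromℚᵘ (excess Δ)))
                   (ℚᵘ.+-congʳ ℚᵘ.1ℚᵘ (ℚ.toℚᵘ-fromℚᵘ (excess Δ))))
                 (ℚ.toℚᵘ-fromℚᵘ (mkℚᵘ (⁺ Δ) 0)))

little-time : O[log^ 4 +o1/loglog²] timeBound
-- The exponent is exactly 4, so `η` is 0; `4 ≤ Δ` gives the `2 ≤ ℓ` that `time-≤` asks for.
little-time = (λ _ → 0ℚ) , (λ ε 0<ε → 0 , λ _ _ → ℚ.<⇒≤ 0<ε) , rate * 336 , 4 , bound
  where
  bound : ∀ Δ → 4 ≤ Δ → (timeBound Δ * ⌊log₂ ⌊log₂ Δ ⌋ ⌋ ^ 2) ≤ rate * 336 · ⌊log₂ Δ ⌋ ^ℚ (fromℕ 4 ℚ.+ 0ℚ)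
  bound Δ 4≤Δ = subst₂ _≤_ (sym (*-identityʳ _)) (cong (_* ⌊log₂ Δ ⌋ ^ 4) (sym (*-identityʳ (rate * 336))))
    (Estimates.time-≤ Δ (subst (_≤ ⌊log₂ Δ ⌋) (⌊log₂[2^n]⌋≡n 2) (⌊log₂⌋-mono-≤ 4≤Δ)))

theorem3 : ∃[ P ] ∃[ c ] ∃[ colors ] ∃[ time ]
    1 ≤ c
    × MaintainsColoring P c colors time
    × AtMost[1+o1]Δ colors
    × O[log^ 4 +o1/loglog²] time
theorem3 = program , 7 , colors , timeBound , s≤s z≤n , maintains-coloring , few-colors , little-time
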